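{- Let $m=(m_1,m_2,m_3,m_3)$ be a multiplicity with $m_1,m_2\in 2\mathbb{Z}+1$ and $|m|\in 4\mathbb{Z}$. If $2m_i\le |m|+2$ for all $i$, then $\theta_m\in D(m)$ and $\exp(m)=\left(\frac{|m|}{2}-1,\frac{|m|}{2}+1\right)$. Moreover, if $m$ is balanced, then $D(m)$ is generated as an $S$-module by $\theta_m$ and $\theta_{m''}$, where $m''=(m_1+2,m_2+2,m_3,m_3)$.
   Context: Let $\mathbb{K}$ be a field of characteristic zero, $S=\mathbb{K}[x,y]$, $S_k$ the space of homogeneous polynomials of degree $k$, and $\mathrm{Der}(S)=\{f\partial_x+g\partial_y : f,g\in S\}$, acting on polynomials by $\theta(h)=f\,\partial h/\partial x+g\,\partial h/\partial y$; $\theta=f\partial_x+g\partial_y$ is homogeneous of degree $k$ if $f,g\in S_k$. Put $\alpha_1=x$, $\alpha_2=y$, $\alpha_3=x-y$, $\alpha_4=x+y$ (their kernels form the Coxeter arrangement of type $B_2$). For a multiplicity $m=(m_1,m_2,m_3,m_4)\in\mathbb{Z}_{\ge 0}^4$ let $|m|=m_1+m_2+m_3+m_4$ and $D(m)=\{\theta\in\mathrm{Der}(S):\theta(\alpha_i)\in\alpha_i^{m_i}S\ \text{for } i=1,2,3,4\}$. $D(m)$ is a free $S$-module of rank $2$ admitting a homogeneous basis; $\exp(m)$ denotes the multiset of degrees of the elements of a homogeneous basis. The multiplicity $m$ is balanced if $2m_i\le |m|-1$ for all $i$. For real $a$ and integer $n\ge0$ let $\langle a\rangle_n=\prod_{j=0}^{n-1}(a+2j)$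 (with $\langle a\rangle_0=1$); for an integer $n\ge 0$, $n!!$ is the double factorial with $0!!=1$. For $m=(m_1,m_2,m_3,m_3)$ with $m_1,m_2$ odd and $|m|\in4\mathbb{Z}$, let $d=\frac{|m|}{2}-1$ and define $f_m=\sum_{i=0}^{(d-m_1)/2}(-1)^i\frac{\langle m_1+m_2-d\rangle_{(d-m_1)/2-i}}{(d-m_1-2i)!!\,(d-2i)!!\,(2i)!!}x^{d-2i}y^{2i}$, $g_m=\sum_{i=0}^{(d-m_2)/2}(-1)^{i+m_3}\frac{\langle m_1+m_2-d\rangle_{(d-m_2)/2-i}}{(d-m_2-2i)!!\,(d-2i)!!\,(2i)!!}x^{2i}y^{d-2i}$, where a sum whose upper limit is negative is $0$, and $\theta_m=f_m\partial_x-g_m\partial_y$. -}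

module Defs where

open import Level using (Level; _⊔_) renaming (suc to lsuc)
open import Algebra.Bundles using (CommutativeRing)
open import Data.Nat as ℕ using (ℕ; zero; suc; _∸_; _≤ᵇ_; _≡ᵇ_; _%_; _≤_)
open import Data.Nat.DivMod using (_/_)
open import Data.Integer as ℤ using (ℤ; +_; -[1+_])
open import Data.Fin using (Fin)
open import Data.Bool using (if_then_else_; _∧_)
open import Data.Product using (Σ; ∃; _×_; _,_)
open import Relation.Nullary using (¬_)
open import Relation.Binary.PropositionalEquality using (_≡_; _≢_)

record Field (c ℓ : Level) : Set (lsuc (c ⊔ ℓ)) where
  field
    commutativeRing : CommutativeRing c ℓ
  open CommutativeRing commutativeRing public
  field
    _⁻¹     : Carrier → Carrier
    1≉0     : ¬ (1# ≈ 0#)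
    inverseʳ : ∀ x → ¬ (x ≈ 0#) → (x * (x ⁻¹)) ≈ 1#

  ι : ℕ → Carrier
  ι zero    = 0#
  ι (suc n) = 1# + ι n

  ιℤ : ℤ → Carrier
  ιℤ (+ n)    = ι n
  ιℤ -[1+ n ] = - ι (suc n)

record CharZeroField (c ℓ : Level) : Set (lsuc (c ⊔ ℓ)) where
  field
    field′    : Field c ℓ
  open Field field′ public
  field
    charZero : ∀ n → ¬ (ι (suc n) ≈ 0#)

_!! : ℕ → ℕ
zero !!          = 1
suc zero !!      = 1
suc (suc n) !!   = suc (suc n) ℕ.* (n !!)

⟨_⟩_ : ℤ → ℕ → ℤ
⟨ a ⟩ zero  = + 1
⟨ a ⟩ suc n = ⟨ a ⟩ n ℤ.* (a ℤ.+ + (2 ℕ.* n))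

sgn : ℕ → ℤ
sgn zero    = + 1
sgn (suc n) = ℤ.- sgn n

module Poly {c ℓ} (K : CharZeroField c ℓ) where
  open CharZeroField K

  -- a polynomial is given by its coefficient function:
  -- (i , j) ↦ coefficient of x^i y^j, with finite support (see IsPoly)
  Pol : Set c
  Pol = ℕ → ℕ → Carrier

  IsPoly : Pol → Set ℓ
  IsPoly a = ∃ λ N → ∀ i j → N ≤ i ℕ.+ j → a i j ≈ 0#

  _≈ₚ_ : Pol → Pol → Set ℓ
  a ≈ₚ b = ∀ i j → a i j ≈ b i j

  0ₚ : Pol
  0ₚ _ _ = 0#

  mono : Carrier → ℕ → ℕ → Pol
  mono k i j a b = if (a ≡ᵇ i) ∧ (b ≡ᵇ j) then k else 0#

  1ₚ X Y : Pol
  1ₚ = mono 1# 0 0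
  X  = mono 1# 1 0
  Y  = mono 1# 0 1

  _+ₚ_ : Pol → Pol → Pol
  (a +ₚ b) i j = a i j + b i j

  -ₚ_ : Pol → Pol
  (-ₚ a) i j = - a i j

  _-ₚ_ : Pol → Pol → Pol
  a -ₚ b = a +ₚ (-ₚ b)

  sumTo : ℕ → (ℕ → Carrier) → Carrier
  sumTo zero    f = 0#
  sumTo (suc n) f = sumTo n f + f n

  _*ₚ_ : Pol → Pol → Pol
  (a *ₚ b) i j = sumTo (suc i) λ k → sumTo (suc j) λ l → a k l * b (i ∸ k) (j ∸ l)

  _^ₚ_ : Pol → ℕ → Pol
  a ^ₚ zero  = 1ₚ
  a ^ₚ suc n = a *ₚ (a ^ₚ n)

  sumₚ : ℕ → (ℕ → Pol) → Pol
  sumₚ zero    F = 0ₚ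
  sumₚ (suc n) F = sumₚ n F +ₚ F n

  ∂x ∂y : Pol → Pol
  ∂x a i j = ι (suc i) * a (suc i) j
  ∂y a i j = ι (suc j) * a i (suc j)

  Homog : ℕ → Pol → Set ℓ
  Homog k a = ∀ i j → i ℕ.+ j ≢ k → a i j ≈ 0#

  _∣ₚ_ : Pol → Pol → Set (c ⊔ ℓ)
  b ∣ₚ a = ∃ λ q → IsPoly q × (a ≈ₚ (b *ₚ q))

  -- derivations θ = f ∂x + g ∂y, represented by the pair (f , g)
  Der : Set c
  Der = Pol × Pol

  IsDer : Der → Set ℓ
  IsDer (f , g) = IsPoly f × IsPoly g

  apply : Der → Pol → Pol
  apply (f , g) h = (f *ₚ ∂x h) +ₚ (g *ₚ ∂y h)

  _≈ᴰ_ : Der → Der → Set ℓ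
  (f , g) ≈ᴰ (f′ , g′) = (f ≈ₚ f′) × (g ≈ₚ g′)

  _+ᴰ_ : Der → Der → Der
  (f , g) +ᴰ (f′ , g′) = (f +ₚ f′) , (g +ₚ g′)

  _·ᴰ_ : Pol → Der → Der
  p ·ᴰ (f , g) = (p *ₚ f) , (p *ₚ g)

  0ᴰ : Der
  0ᴰ = 0ₚ , 0ₚ

  HomogDer : ℕ → Der → Set ℓ
  HomogDer k (f , g) = Homog k f × Homog k g

  -- the B₂ arrangement: α₁ = x, α₂ = y, α₃ = x - y, α₄ = x + y
  α : Fin 4 → Pol
  α Fin.zero                         = X
  α (Fin.suc Fin.zero)               = Y
  α (Fin.suc (Fin.suc Fin.zero))     = X -ₚ Y
  α (Fin.suc (Fin.suc (Fin.suc _)))  = X +ₚ Y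

  _∈D_ : Der → (Fin 4 → ℕ) → Set (c ⊔ ℓ)
  θ ∈D m = IsDer θ × (∀ i → (α i ^ₚ m i) ∣ₚ apply θ (α i))

  Generates : (Fin 4 → ℕ) → Der → Der → Set (c ⊔ ℓ)
  Generates m θ₁ θ₂ =
    θ₁ ∈D m × θ₂ ∈D m ×
    (∀ θ → θ ∈D m → ∃ λ p → ∃ λ q → IsPoly p × IsPoly q × (θ ≈ᴰ ((p ·ᴰ θ₁) +ᴰ (q ·ᴰ θ₂))))

  IsBasis : (Fin 4 → ℕ) → Der → Der → Set (c ⊔ ℓ)
  IsBasis m θ₁ θ₂ =
    Generates m θ₁ θ₂ ×
    (∀ p q → IsPoly p → IsPoly q → ((p ·ᴰ θ₁) +ᴰ (q ·ᴰ θ₂)) ≈ᴰ 0ᴰ → (p ≈ₚ 0ₚ) × (q ≈ₚ 0ₚ))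

  ExpIs : (Fin 4 → ℕ) → ℕ → ℕ → Set (c ⊔ ℓ)
  ExpIs m d₁ d₂ = ∃ λ θ₁ → ∃ λ θ₂ → IsBasis m θ₁ θ₂ × HomogDer d₁ θ₁ × HomogDer d₂ θ₂

  mult : ℕ → ℕ → ℕ → Fin 4 → ℕ
  mult m₁ m₂ m₃ Fin.zero                     = m₁
  mult m₁ m₂ m₃ (Fin.suc Fin.zero)           = m₂
  mult m₁ m₂ m₃ (Fin.suc (Fin.suc _))        = m₃

  ∣m∣ : ℕ → ℕ → ℕ → ℕ
  ∣m∣ m₁ m₂ m₃ = m₁ ℕ.+ m₂ ℕ.+ m₃ ℕ.+ m₃

  dOf : ℕ → ℕ → ℕ → ℕ
  dOf m₁ m₂ m₃ = ∣m∣ m₁ m₂ m₃ / 2 ∸ 1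

  nTerms : ℕ → ℕ → ℕ
  nTerms d mₖ = if mₖ ≤ᵇ d then suc ((d ∸ mₖ) / 2) else 0

  aOf : ℕ → ℕ → ℕ → ℤ
  aOf m₁ m₂ d = + (m₁ ℕ.+ m₂) ℤ.- + d

  frac : ℤ → ℕ → Carrier
  frac num den = ιℤ num * (ι den ⁻¹)

  fₘ : ℕ → ℕ → ℕ → Pol
  fₘ m₁ m₂ m₃ = sumₚ (nTerms d m₁) λ i →
      mono (frac (sgn i ℤ.* ⟨ aOf m₁ m₂ d ⟩ ((d ∸ m₁) / 2 ∸ i))
                 (((d ∸ m₁ ∸ 2 ℕ.* i) !!) ℕ.* ((d ∸ 2 ℕ.* i) !!) ℕ.* ((2 ℕ.* i) !!)))
           (d ∸ 2 ℕ.* i) (2 ℕ.* i)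
    where d = dOf m₁ m₂ m₃

  gₘ : ℕ → ℕ → ℕ → Pol
  gₘ m₁ m₂ m₃ = sumₚ (nTerms d m₂) λ i →
      mono (frac (sgn (i ℕ.+ m₃) ℤ.* ⟨ aOf m₁ m₂ d ⟩ ((d ∸ m₂) / 2 ∸ i))
                 (((d ∸ m₂ ∸ 2 ℕ.* i) !!) ℕ.* ((d ∸ 2 ℕ.* i) !!) ℕ.* ((2 ℕ.* i) !!)))
           (2 ℕ.* i) (d ∸ 2 ℕ.* i)
    where d = dOf m₁ m₂ m₃

  θₘ : ℕ → ℕ → ℕ → Der
  θₘ m₁ m₂ m₃ = fₘ m₁ m₂ m₃ , (-ₚ gₘ m₁ m₂ m₃)

{-# OPTIONS --safe #-}
module Submission where

-- Write d = 2e + 1, let p and q be the numbers of terms of f_m and g_m, so that p + q = m₃ + 1,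
-- and let a = m₁ + m₂ - d.  Membership of θ_m in D(m) amounts to (x + s y)^m₃ dividing
-- h(p, q) = θ_m(x + s y) for s = ±1.  Two relations hold coefficientwise:
--   h(p, q) = h(p, q-1) - h(p-1, q)   and   (x ∂x - m₁) h(p, q) = a h(p-1, q).
-- By induction the first one yields all but one of the factors x + s y, and differentiating a
-- form divisible by exactly that power contradicts the second.  The recursion ends at pq = 0,
-- where h is a monomial times a power of x² - y², and at p = q = 1, where h ~ x^d + s y^d.
--
-- The basis statement is Saito's criterion.  The determinant of two elements of D(m) of degrees d
-- and d + 2 is a constant times x^m₁ y^m₂ (x² - y²)^m₃, and for θ_m and θ_m″ the coefficient of
-- x^m₁ in it is a product of two leading coefficients, nonzero because a is odd.  If f_m or g_m
-- vanishes, θ_m″ is replaced by θ_m′ with m′ = (m₁, m₂+2, m₃+1) or (m₁+2, m₂, m₃+1).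
--
-- All algebra takes place in the ring K[[y]][[x]] of coefficient functions; a quotient of a
-- polynomial by a linear form is again a polynomial.

open import Defs
open import Level using (_⊔_; 0ℓ) renaming (suc to lsuc)
open import Algebra.Bundles using (CommutativeRing)
import Algebra.Properties.AbelianGroup
import Algebra.Properties.Ring
import Algebra.Properties.Semiring.Exp
import Algebra.Properties.Semiring.Mult
import Algebra.Solver.Ring
import Algebra.Solver.Ring.AlmostCommutativeRing as ACR
open import Data.Bool as Bool using (true; false; _∧_)
open import Data.Fin using (Fin)
open import Data.Fin.Patterns using (0F; 1F; 2F; 3F)
open import Data.Integer as ℤ using (ℤ; +_; -[1+_])
import Data.Integer.Properties as ℤₚ
open import Data.Maybe using (just; nothing)
open import Data.Nat as ℕ using (ℕ; zero; suc; _≤_; _<_; z≤n; s≤s; _∸_; _%_)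
open import Data.Nat.DivMod using (_/_; m*n/n≡m; m≡m%n+[m/n]*n)
import Data.Nat.Properties as ℕₚ
open import Data.Nat.Tactic.RingSolver using () renaming (solve-∀ to ℕ-solve-∀)
open import Data.Product using (∃; _×_; _,_; proj₁; proj₂)
open import Data.Sum using (_⊎_; inj₁; inj₂)
open import Data.Unit using (⊤; tt)
open import Function using (_∘_)
open import Relation.Binary.Definitions using (WeaklyDecidable)
open import Relation.Binary.PropositionalEquality as ≡ using (_≡_; _≢_)
import Relation.Binary.Reasoning.Setoid
open import Relation.Nullary using (¬_; yes; no; contradiction)

-- The recursion moves between multiplicities: h(p, q-1) and h(p-1, q) belong to (m₁, m₂+2, m₃-1)
-- and (m₁+2, m₂, m₃-1). These have the same |m|, hence the same d, while a grows by 2 and the sign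
-- (-1)^m₃ flips. The bounds on m₁ and m₂ say exactly that p, q ≥ 0, so the descent may end at m₁ =
-- d+2 or m₂ = d+2, where one of f_m, g_m is an empty sum.
--
-- The invariant is a + 2(p+q) = 2e + 5. It makes a odd, and at such an end it fixes a so that ⟨a⟩_n
-- cancels against (d-2i)!! and only binomial coefficients remain.
--
-- The first relation loses a factor because both its terms have m₃ - 1 in place of m₃; the
-- derivative recovers it only from a positive exponent, which is why p = q = 1 is a base case of
-- its own.
--
-- Equality in K is not assumed decidable. Divisibility by a linear form is therefore handled by
-- solving for coefficients, and a determinant is shown to be nonzero by exhibiting one coefficient.

-- Normalisation of ring identities with integer coefficients.

module IntegerCoefficients {c ℓ} (R : CommutativeRing c ℓ) where
  open CommutativeRing R
  open Algebra.Properties.Semiring.Mult semiring using (×-homo-+; ×1-homo-*) renaming (_×_ to _⋆_)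
  open Algebra.Properties.Ring ring using (-0#≈0#; -‿involutive; -‿distribˡ-*; -‿distribʳ-*)
  open Algebra.Properties.AbelianGroup +-abelianGroup using () renaming (⁻¹-∙-comm to -‿+-comm)
  open Relation.Binary.Reasoning.Setoid setoid

  ⟦_⟧ : ℤ → Carrier
  ⟦ + n ⟧      = n ⋆ 1#
  ⟦ -[1+ n ] ⟧ = - (suc n ⋆ 1#)

  ⊖-homo : ∀ m n → ⟦ m ℤ.⊖ n ⟧ ≈ (m ⋆ 1#) - (n ⋆ 1#)
  ⊖-homo m zero = sym (trans (+-congˡ -0#≈0#) (+-identityʳ _))
  ⊖-homo zero (suc n) = sym (+-identityˡ _)
  ⊖-homo (suc m) (suc n) = begin
    ⟦ suc m ℤ.⊖ suc n ⟧               ≡⟨ ≡.cong ⟦_⟧ (ℤₚ.[1+m]⊖[1+n]≡m⊖n m n) ⟩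
    ⟦ m ℤ.⊖ n ⟧                       ≈⟨ ⊖-homo m n ⟩
    a - b                             ≈⟨ +-congʳ (trans (+-congˡ (-‿inverseʳ 1#)) (+-identityʳ a)) ⟨
    (a + (1# - 1#)) - b               ≈⟨ +-congʳ (+-assoc a 1# (- 1#)) ⟨
    ((a + 1#) - 1#) - b               ≈⟨ +-assoc (a + 1#) (- 1#) (- b) ⟩
    (a + 1#) + (- 1# - b)             ≈⟨ +-cong (+-comm a 1#) (-‿+-comm 1# b) ⟩
    (1# + a) - (1# + b)               ∎
    where
    a = m ⋆ 1#
    b = n ⋆ 1#

  -‿homo : ∀ i → ⟦ ℤ.- i ⟧ ≈ - ⟦ i ⟧
  -‿homo (+ zero)  = sym -0#≈0#
  -‿homo (+ suc n) = refl
  -‿homo -[1+ n ]  = sym (-‿involutive _)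

  +-homo : ∀ i j → ⟦ i ℤ.+ j ⟧ ≈ ⟦ i ⟧ + ⟦ j ⟧
  +-homo (+ m)    (+ n)    = ×-homo-+ 1# m n
  +-homo (+ m)    -[1+ n ] = ⊖-homo m (suc n)
  +-homo -[1+ m ] (+ n)    = trans (⊖-homo n (suc m)) (+-comm _ _)
  +-homo -[1+ m ] -[1+ n ] = begin
    ⟦ -[1+ m ] ℤ.+ -[1+ n ] ⟧         ≡⟨ ≡.cong ⟦_⟧ (ℤₚ.neg-distrib-+ (+ suc m) (+ suc n)) ⟨
    ⟦ ℤ.- (+ suc m ℤ.+ + suc n) ⟧     ≈⟨ -‿homo (+ suc m ℤ.+ + suc n) ⟩
    - ((suc m ℕ.+ suc n) ⋆ 1#)        ≈⟨ -‿cong (×-homo-+ 1# (suc m) (suc n)) ⟩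
    - (suc m ⋆ 1# + suc n ⋆ 1#)       ≈⟨ -‿+-comm _ _ ⟨
    - (suc m ⋆ 1#) - (suc n ⋆ 1#)     ∎

  pos-*-homo : ∀ m j → ⟦ + m ℤ.* j ⟧ ≈ ⟦ + m ⟧ * ⟦ j ⟧
  pos-*-homo m (+ n)    = trans (reflexive (≡.cong ⟦_⟧ (≡.sym (ℤₚ.pos-* m n)))) (×1-homo-* m n)
  pos-*-homo m -[1+ n ] = begin
    ⟦ + m ℤ.* -[1+ n ] ⟧              ≡⟨ ≡.cong ⟦_⟧ (ℤₚ.neg-distribʳ-* (+ m) (+ suc n)) ⟨
    ⟦ ℤ.- (+ m ℤ.* + suc n) ⟧         ≈⟨ -‿homo (+ m ℤ.* + suc n) ⟩
    - ⟦ + m ℤ.* + suc n ⟧             ≈⟨ -‿cong (pos-*-homo m (+ suc n)) ⟩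
    - (⟦ + m ⟧ * ⟦ + suc n ⟧)         ≈⟨ -‿distribʳ-* _ _ ⟩
    ⟦ + m ⟧ * ⟦ -[1+ n ] ⟧            ∎
  *-homo : ∀ i j → ⟦ i ℤ.* j ⟧ ≈ ⟦ i ⟧ * ⟦ j ⟧
  *-homo (+ m)    j = pos-*-homo m j
  *-homo -[1+ m ] j = begin
    ⟦ -[1+ m ] ℤ.* j ⟧                ≡⟨ ≡.cong ⟦_⟧ (ℤₚ.neg-distribˡ-* (+ suc m) j) ⟨
    ⟦ ℤ.- (+ suc m ℤ.* j) ⟧           ≈⟨ -‿homo (+ suc m ℤ.* j) ⟩
    - ⟦ + suc m ℤ.* j ⟧               ≈⟨ -‿cong (pos-*-homo (suc m) j) ⟩
    - (⟦ + suc m ⟧ * ⟦ j ⟧)           ≈⟨ -‿distribˡ-* _ _ ⟩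
    ⟦ -[1+ m ] ⟧ * ⟦ j ⟧              ∎

  ⟦⟧-morphism : ℤ.+-*-rawRing ACR.-Raw-AlmostCommutative⟶ ACR.fromCommutativeRing R
  ⟦⟧-morphism = record
    { ⟦_⟧    = ⟦_⟧
    ; +-homo = +-homo
    ; *-homo = *-homo
    ; -‿homo = -‿homo
    ; 0-homo = refl
    ; 1-homo = +-identityʳ 1#
    }

  -- Coefficients are compared in ℤ because equality in `R` need not be decidable. Distinct integers
  -- may agree in `R`, so a negative answer carries no information.
  ⟦⟧-weaklyDecidable : WeaklyDecidable (ACR.Induced-equivalence ⟦⟧-morphism)
  ⟦⟧-weaklyDecidable i j with i ℤ.≟ j
  ... | yes ≡.refl = just refl
  ... | no _       = nothing

  module Solver = Algebra.Solver.Ring ℤ.+-*-rawRing (ACR.fromCommutativeRing R) ⟦⟧-morphism ⟦⟧-weaklyDecidable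

-- Divisibility, coprimality and Saito's criterion in a commutative ring.

module Divisibility {c ℓ} (R : CommutativeRing c ℓ) where
  open CommutativeRing R
  open IntegerCoefficients R using (module Solver)
  open Solver using (solve; _:=_; _:*_; _:+_; _:-_; :-_; con)
  open Algebra.Properties.Semiring.Exp semiring using (_^_; ^-congˡ; ^-homo-*) public
  open Relation.Binary.Reasoning.Setoid setoid

  infix 4 _∣_
  _∣_ : Carrier → Carrier → Set (c ⊔ ℓ)
  a ∣ b = ∃ λ q → b ≈ a * q

  -- Only products of linear forms are ever cancelled, so this condition on single elements replaces
  -- the assumption of an integral domain.
  Cancellable : Carrier → Set (c ⊔ ℓ)
  Cancellable u = ∀ t → u * t ≈ 0# → t ≈ 0#

  -- Coprimality in the sense of Euclid's lemma; the comaximal form a u + b v = 1 would exclude the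
  -- pair x, y.
  Coprime : Carrier → Carrier → Set (c ⊔ ℓ)
  Coprime u v = ∀ t → u ∣ v * t → u ∣ t

  ∣-resp : ∀ {a a′ b b′} → a ≈ a′ → b ≈ b′ → a ∣ b → a′ ∣ b′
  ∣-resp a≈ b≈ (q , e) = q , trans (sym b≈) (trans e (*-congʳ a≈))

  ∣-+ : ∀ {a b b′} → a ∣ b → a ∣ b′ → a ∣ b + b′
  ∣-+ {a} {b} {b′} (q , e) (q′ , e′) = q + q′ , trans (+-cong e e′) (sym (distribˡ a q q′))

  ∣-* : ∀ {a b} r → a ∣ b → a ∣ r * b
  ∣-* {a} {b} r (q , e) = r * q , trans (*-congˡ e) (solve 3 (λ r a q → r :* (a :* q) := a :* (r :* q)) refl r a q)

  ∣-- : ∀ {a b b′} → a ∣ b → a ∣ b′ → a ∣ b - b′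
  ∣-- {a} {b} {b′} (q , e) (q′ , e′) = q - q′ ,
    trans (+-cong e (-‿cong e′)) (solve 3 (λ a q q′ → a :* q :- a :* q′ := a :* (q :- q′)) refl a q q′)

  ∣-swap : ∀ {a} b b′ → a ∣ b - b′ → a ∣ b′ - b
  ∣-swap {a} b b′ (q , e) = - q , (begin
    b′ - b         ≈⟨ solve 2 (λ b b′ → b′ :- b := :- (b :- b′)) refl b b′ ⟩
    - (b - b′)     ≈⟨ -‿cong e ⟩
    - (a * q)      ≈⟨ solve 2 (λ a q → :- (a :* q) := a :* (:- q)) refl a q ⟩
    a * - q        ∎)

  ^-∣-^ : ∀ u m n → (u ^ m) ∣ (u ^ (m ℕ.+ n))
  ^-∣-^ u m n = u ^ n , ^-homo-* u m n

  ∣-trans : ∀ {a b c} → a ∣ b → b ∣ c → a ∣ c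
  ∣-trans {a} (q , e) (q′ , e′) = q * q′ , trans e′ (trans (*-congʳ e) (*-assoc a q q′))

  cancel : ∀ {u s t} → Cancellable u → u * s ≈ u * t → s ≈ t
  cancel {u} {s} {t} cu e = begin
    s              ≈⟨ solve 2 (λ s t → s := (s :- t) :+ t) refl s t ⟩
    (s - t) + t    ≈⟨ +-congʳ (cu (s - t) us-t) ⟩
    0# + t         ≈⟨ +-identityˡ t ⟩
    t              ∎
    where
    us-t : u * (s - t) ≈ 0#
    us-t = begin
      u * (s - t)      ≈⟨ solve 3 (λ u s t → u :* (s :- t) := u :* s :- u :* t) refl u s t ⟩
      u * s - u * t    ≈⟨ +-congʳ e ⟩
      u * t - u * t    ≈⟨ -‿inverseʳ (u * t) ⟩
      0#               ∎

  *-cancellable : ∀ {u v} → Cancellable u → Cancellable v → Cancellable (u * v)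
  *-cancellable {u} {v} cu cv t e = cv t (cu (v * t) (trans (sym (*-assoc u v t)) e))

  ^-cancellable : ∀ {u} n → Cancellable u → Cancellable (u ^ n)
  ^-cancellable zero    cu t e = trans (sym (*-identityˡ t)) e
  ^-cancellable (suc n) cu     = *-cancellable cu (^-cancellable n cu)

  -- From u t = v s the hypothesis gives s = u s′, and cancelling u leaves t = v s′.
  coprime-sym : ∀ {u v} → Cancellable u → Coprime u v → Coprime v u
  coprime-sym {u} {v} cu co t (s , e) with co s (t , sym e)
  ... | s′ , e′ = s′ , cancel cu (begin
    u * t           ≈⟨ e ⟩
    v * s           ≈⟨ *-congˡ e′ ⟩
    v * (u * s′)    ≈⟨ solve 3 (λ u v s′ → v :* (u :* s′) := u :* (v :* s′)) refl u v s′ ⟩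
    u * (v * s′)    ∎)

  coprime-* : ∀ {u v w} → Coprime u v → Coprime u w → Coprime u (v * w)
  coprime-* {u} {v} {w} cv cw t d = cw t (cv (w * t) (∣-resp refl (*-assoc v w t) d))

  coprime-^ʳ : ∀ {u v} n → Coprime u v → Coprime u (v ^ n)
  coprime-^ʳ zero    co t d = ∣-resp refl (*-identityˡ t) d
  coprime-^ʳ (suc n) co     = coprime-* co (coprime-^ʳ n co)

  -- Factors of u are taken out of t one at a time; cancelling u in v t = u^(n+1) q leaves the same
  -- problem for u^n.
  coprime-^ˡ : ∀ {u v} n → Cancellable u → Coprime u v → Coprime (u ^ n) v
  coprime-^ˡ zero    cu co t _ = t , sym (*-identityˡ t)
  coprime-^ˡ {u} {v} (suc n) cu co t (q , e)
    with co t (u ^ n * q , trans e (*-assoc u (u ^ n) q))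
  ... | t′ , e′ with coprime-^ˡ n cu co t′ (q , cancel cu (begin
        u * (v * t′)         ≈⟨ solve 3 (λ u v t′ → u :* (v :* t′) := v :* (u :* t′)) refl u v t′ ⟩
        v * (u * t′)         ≈⟨ *-congˡ e′ ⟨
        v * t                ≈⟨ e ⟩
        (u * u ^ n) * q      ≈⟨ *-assoc u (u ^ n) q ⟩
        u * (u ^ n * q)      ∎))
  ... | s , e″ = s , trans e′ (trans (*-congˡ e″) (sym (*-assoc u (u ^ n) s)))

  coprime-^ : ∀ {u v} m n → Cancellable u → Coprime u v → Coprime (u ^ m) (v ^ n)
  coprime-^ m n cu co = coprime-^ʳ n (coprime-^ˡ m cu co)

  coprime-product : ∀ {u v t} → Coprime v u → u ∣ t → v ∣ t → u * v ∣ t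
  coprime-product {u} {v} {t} co (q , e) d with co q (∣-resp refl e d)
  ... | q′ , e′ = q′ , trans e (trans (*-congˡ e′) (sym (*-assoc u v q′)))

  det : Carrier × Carrier → Carrier × Carrier → Carrier
  det (f , g) (f′ , g′) = f * g′ - g * f′

  -- The terms with `y` cancel in g′(f + y g) - g(f′ + y g′). Here f + y g is the value of a
  -- derivation at a form with coefficients 1 and `y`.
  det-∣ : ∀ {a} y {f g f′ g′} → a ∣ f + y * g → a ∣ f′ + y * g′ → a ∣ det (f , g) (f′ , g′)
  det-∣ {a} y {f} {g} {f′} {g′} h h′ = ∣-resp refl
    (solve 5 (λ y f g f′ g′ →
        g′ :* (f :+ y :* g) :- g :* (f′ :+ y :* g′) := f :* g′ :- g :* f′) refl y f g f′ g′)
    (∣-- (∣-* g′ h) (∣-* g h′))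

  -- Cramer's rule: det(θ₁,θ₂) θ = det(θ,θ₂) θ₁ + det(θ₁,θ) θ₂. All three determinants are multiples
  -- of `Q`, and cancelling it leaves the unit `r` on the left. In use `Q` is the product of the
  -- powers α_i^m_i.
  module Saito {θ₁ θ₂ : Carrier × Carrier} {Q r r⁻¹ : Carrier}
    (cQ : Cancellable Q) (rr⁻¹ : r * r⁻¹ ≈ 1#) (Qr : det θ₁ θ₂ ≈ Q * r) where

    f₁ g₁ f₂ g₂ : Carrier
    f₁ = proj₁ θ₁
    g₁ = proj₂ θ₁
    f₂ = proj₁ θ₂
    g₂ = proj₂ θ₂

    private
      cramer : ∀ {z z₁ z₂ s t d₁ d₂} → d₁ ≈ Q * s → d₂ ≈ Q * t →
        det θ₁ θ₂ * z ≈ d₁ * z₁ + d₂ * z₂ → z ≈ (r⁻¹ * s) * z₁ + (r⁻¹ * t) * z₂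
      cramer {z} {z₁} {z₂} {s} {t} {d₁} {d₂} e₁ e₂ e = begin
        z                                        ≈⟨ *-identityˡ z ⟨
        1# * z                                   ≈⟨ *-congʳ rr⁻¹ ⟨
        (r * r⁻¹) * z                            ≈⟨ solve 3 (λ r r⁻¹ z → (r :* r⁻¹) :* z := r⁻¹ :* (r :* z)) refl r r⁻¹ z ⟩
        r⁻¹ * (r * z)                            ≈⟨ *-congˡ (cancel cQ Q-multiple) ⟩
        r⁻¹ * (s * z₁ + t * z₂)                  ≈⟨ solve 5 (λ i s t x y → i :* (s :* x :+ t :* y) := (i :* s) :* x :+ (i :* t) :* y) refl r⁻¹ s t z₁ z₂ ⟩
        (r⁻¹ * s) * z₁ + (r⁻¹ * t) * z₂          ∎
        where
        Q-multiple : Q * (r * z) ≈ Q * (s * z₁ + t * z₂)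
        Q-multiple = begin
          Q * (r * z)                            ≈⟨ *-assoc Q r z ⟨
          (Q * r) * z                            ≈⟨ *-congʳ Qr ⟨
          det θ₁ θ₂ * z                          ≈⟨ e ⟩
          d₁ * z₁ + d₂ * z₂                      ≈⟨ +-cong (*-congʳ e₁) (*-congʳ e₂) ⟩
          (Q * s) * z₁ + (Q * t) * z₂            ≈⟨ solve 5 (λ Q s t x y → (Q :* s) :* x :+ (Q :* t) :* y := Q :* (s :* x :+ t :* y)) refl Q s t z₁ z₂ ⟩
          Q * (s * z₁ + t * z₂)                  ∎

    generate : ∀ {f g} → ((s , _) : Q ∣ det (f , g) θ₂) → ((t , _) : Q ∣ det θ₁ (f , g)) →
      (f ≈ (r⁻¹ * s) * f₁ + (r⁻¹ * t) * f₂) × (g ≈ (r⁻¹ * s) * g₁ + (r⁻¹ * t) * g₂)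
    generate {f} {g} (s , es) (t , et) =
      cramer es et (solve 6 (λ f g f₁ g₁ f₂ g₂ →
        (f₁ :* g₂ :- g₁ :* f₂) :* f := (f :* g₂ :- g :* f₂) :* f₁ :+ (f₁ :* g :- g₁ :* f) :* f₂) refl f g f₁ g₁ f₂ g₂) ,
      cramer es et (solve 6 (λ f g f₁ g₁ f₂ g₂ →
        (f₁ :* g₂ :- g₁ :* f₂) :* g := (f :* g₂ :- g :* f₂) :* g₁ :+ (f₁ :* g :- g₁ :* f) :* g₂) refl f g f₁ g₁ f₂ g₂)

    private
      det-annihilates : ∀ {z} → det θ₁ θ₂ * z ≈ 0# → z ≈ 0#
      det-annihilates {z} e = begin
        z                  ≈⟨ *-identityˡ z ⟨
        1# * z             ≈⟨ *-congʳ rr⁻¹ ⟨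
        (r * r⁻¹) * z      ≈⟨ solve 3 (λ r r⁻¹ z → (r :* r⁻¹) :* z := r⁻¹ :* (r :* z)) refl r r⁻¹ z ⟩
        r⁻¹ * (r * z)      ≈⟨ *-congˡ (cQ (r * z) (trans (sym (*-assoc Q r z)) (trans (*-congʳ (sym Qr)) e))) ⟩
        r⁻¹ * 0#           ≈⟨ zeroʳ r⁻¹ ⟩
        0#                 ∎

      combine : ∀ {a b} x y → a ≈ 0# → b ≈ 0# → x * a - y * b ≈ 0#
      combine {a} {b} x y a0 b0 = begin
        x * a - y * b      ≈⟨ +-cong (*-congˡ a0) (-‿cong (*-congˡ b0)) ⟩
        x * 0# - y * 0#    ≈⟨ solve 2 (λ x y → x :* con (+ 0) :- y :* con (+ 0) := con (+ 0)) refl x y ⟩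
        0#                 ∎

    independent : ∀ p q → p * f₁ + q * f₂ ≈ 0# → p * g₁ + q * g₂ ≈ 0# → (p ≈ 0#) × (q ≈ 0#)
    independent p q ef eg =
      det-annihilates (trans (solve 6 (λ p q f₁ g₁ f₂ g₂ →
        (f₁ :* g₂ :- g₁ :* f₂) :* p := g₂ :* (p :* f₁ :+ q :* f₂) :- f₂ :* (p :* g₁ :+ q :* g₂)) refl p q f₁ g₁ f₂ g₂) (combine g₂ f₂ ef eg)) ,
      det-annihilates (trans (solve 6 (λ p q f₁ g₁ f₂ g₂ →
        (f₁ :* g₂ :- g₁ :* f₂) :* q := f₁ :* (p :* g₁ :+ q :* g₂) :- g₁ :* (p :* f₁ :+ q :* f₂)) refl p q f₁ g₁ f₂ g₂) (combine f₁ g₁ eg ef))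

-- Raising the order of contact by differentiation.

module DerivativeCriterion {c ℓ} (R : CommutativeRing c ℓ)
  (E : CommutativeRing.Carrier R → CommutativeRing.Carrier R) where
  open CommutativeRing R
  open Divisibility R
  open IntegerCoefficients R using (module Solver)
  open Solver using (solve; _:=_; _:*_; _:+_; _:-_; :-_; con)
  open Algebra.Properties.Semiring.Mult semiring using () renaming (_×_ to _⋆_)
  open Relation.Binary.Reasoning.Setoid setoid

  -- In use `E` is x ∂x and `L` is x + k y, so that E L = x. The assumption on `E` is just the
  -- Leibniz rule for multiplication by `L`.
  module _ (E-cong : ∀ {a b} → a ≈ b → E a ≈ E b) {L X : Carrier}
    (E-L : ∀ u → E (L * u) ≈ X * u + L * E u) where

    E-^ : ∀ s u → E (L ^ suc s * u) ≈ (suc s ⋆ 1#) * (X * (L ^ s * u)) + L ^ suc s * E u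
    E-^ zero u = begin
      E ((L * 1#) * u)                                 ≈⟨ E-cong (*-congʳ (*-identityʳ L)) ⟩
      E (L * u)                                        ≈⟨ E-L u ⟩
      X * u + L * E u                                  ≈⟨ +-cong (trans (*-congʳ (+-identityʳ 1#)) (trans (*-identityˡ _) (*-congˡ (*-identityˡ u)))) (*-congʳ (*-identityʳ L)) ⟨
      (1 ⋆ 1#) * (X * (1# * u)) + (L * 1#) * E u       ∎
    E-^ (suc s) u = begin
      E ((L * L ^ suc s) * u)                          ≈⟨ E-cong (*-assoc L (L ^ suc s) u) ⟩
      E (L * (L ^ suc s * u))                          ≈⟨ E-L (L ^ suc s * u) ⟩
      X * (L ^ suc s * u) + L * E (L ^ suc s * u)      ≈⟨ +-congˡ (*-congˡ (E-^ s u)) ⟩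
      X * ((L * L ^ s) * u) + L * ((suc s ⋆ 1#) * (X * (L ^ s * u)) + (L * L ^ s) * E u)
        ≈⟨ solve 6 (λ L P n X u Eu →
              X :* ((L :* P) :* u) :+ L :* (n :* (X :* (P :* u)) :+ (L :* P) :* Eu) :=
              (con (+ 1) :+ n) :* (X :* ((L :* P) :* u)) :+ (L :* (L :* P)) :* Eu)
            refl L (L ^ s) (suc s ⋆ 1#) X u (E u) ⟩
      ((1 ⋆ 1#) + (suc s ⋆ 1#)) * (X * (L ^ suc s * u)) + L ^ suc (suc s) * E u
        ≈⟨ +-congʳ (*-congʳ (+-congʳ (+-identityʳ 1#))) ⟩
      (suc (suc s) ⋆ 1#) * (X * (L ^ suc s * u)) + L ^ suc (suc s) * E u ∎

    -- If h = L^s u with s > 0, then E h ≡ s X L^(s-1) u modulo L^s.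
    ^-∣-raise : ∀ s {h m} → Cancellable L → Coprime L X → Coprime L (suc s ⋆ 1#) →
      L ^ suc s ∣ h → L ^ suc s ∣ E h - m * h → L ^ suc (suc s) ∣ h
    ^-∣-raise s {h} {m} cL coX coN (u , h≈) (t , Eh≈) = proj₁ L∣u , (begin
      h                                  ≈⟨ h≈ ⟩
      L ^ suc s * u                      ≈⟨ *-congˡ (proj₂ L∣u) ⟩
      (L * L ^ s) * (L * proj₁ L∣u)      ≈⟨ solve 3 (λ L P q → (L :* P) :* (L :* q) := (L :* (L :* P)) :* q) refl L (L ^ s) (proj₁ L∣u) ⟩
      L ^ suc (suc s) * proj₁ L∣u        ∎)
      where
      N : Carrier
      N = suc s ⋆ 1#
      -- Both m h and the part L^(s+1) E u of E h contain one more factor L than the remaining part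
      -- of E h, so cancelling L^s leaves a multiple of L.
      L∣NXu : N * (X * u) ≈ L * (t + m * u - E u)
      L∣NXu = cancel (^-cancellable s cL) (begin
        L ^ s * (N * (X * u))
          ≈⟨ solve 7 (λ L P N X u Eu m → P :* (N :* (X :* u)) :=
               ((N :* (X :* (P :* u)) :+ (L :* P) :* Eu) :- m :* ((L :* P) :* u)) :+ (m :* ((L :* P) :* u) :- (L :* P) :* Eu))
               refl L (L ^ s) N X u (E u) m ⟩
        ((N * (X * (L ^ s * u)) + L ^ suc s * E u) - m * (L ^ suc s * u)) + (m * (L ^ suc s * u) - L ^ suc s * E u)
          ≈⟨ +-congʳ (+-cong (trans (E-cong h≈) (E-^ s u)) (-‿cong (*-congˡ h≈))) ⟨
        (E h - m * h) + (m * (L ^ suc s * u) - L ^ suc s * E u)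
          ≈⟨ +-congʳ Eh≈ ⟩
        (L * L ^ s) * t + (m * ((L * L ^ s) * u) - (L * L ^ s) * E u)
          ≈⟨ solve 6 (λ L P t u Eu m → (L :* P) :* t :+ (m :* ((L :* P) :* u) :- (L :* P) :* Eu) :=
               P :* (L :* (t :+ m :* u :- Eu))) refl L (L ^ s) t u (E u) m ⟩
        L ^ s * (L * (t + m * u - E u)) ∎)
      L∣u : L ∣ u
      L∣u = coX u (coN (X * u) (_ , L∣NXu))

-- The ring of formal power series.

module PowerSeries {c ℓ} (R : CommutativeRing c ℓ) where
  open CommutativeRing R
  open IntegerCoefficients R using (module Solver)
  open Solver using (solve; _:=_; _:*_; _:+_; _:-_; :-_; con)
  open Relation.Binary.Reasoning.Setoid setoid

  Series : Set c
  Series = ℕ → Carrier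

  infix 4 _≋_
  infixl 6 _⊕_
  infixl 7 _⊛_

  _≋_ : Series → Series → Set ℓ
  a ≋ b = ∀ n → a n ≈ b n

  -- The product follows a = a₀ + t a′, with a′ the shifted series, so that the ring laws are proved
  -- by induction on the index, without manipulating finite sums.
  _⊕_ _⊛_ : Series → Series → Series
  (a ⊕ b) n = a n + b n
  (a ⊛ b) zero    = a 0 * b 0
  (a ⊛ b) (suc n) = a 0 * b (suc n) + (a ∘ suc ⊛ b) n

  ⊖_ : Series → Series
  (⊖ a) n = - a n

  𝟘 : Series
  𝟘 _ = 0#

  const : Carrier → Series
  const c zero    = c
  const c (suc _) = 0#

  ⊛-cong : ∀ {a a′ b b′} → a ≋ a′ → b ≋ b′ → a ⊛ b ≋ a′ ⊛ b′
  ⊛-cong p q zero    = *-cong (p 0) (q 0)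
  ⊛-cong p q (suc n) = +-cong (*-cong (p 0) (q (suc n))) (⊛-cong (p ∘ suc) q n)

  ⊛-zeroˡ : ∀ b → 𝟘 ⊛ b ≋ 𝟘
  ⊛-zeroˡ b zero    = zeroˡ _
  ⊛-zeroˡ b (suc n) = trans (+-cong (zeroˡ _) (⊛-zeroˡ b n)) (+-identityʳ 0#)

  const-⊛ : ∀ c b n → (const c ⊛ b) n ≈ c * b n
  const-⊛ c b zero    = refl
  const-⊛ c b (suc n) = trans (+-congˡ (⊛-zeroˡ b n)) (+-identityʳ _)

  ⊛-distribʳ : ∀ c a b → (a ⊕ b) ⊛ c ≋ (a ⊛ c) ⊕ (b ⊛ c)
  ⊛-distribʳ c a b zero    = distribʳ _ _ _
  ⊛-distribʳ c a b (suc n) = trans (+-congˡ (⊛-distribʳ c (a ∘ suc) (b ∘ suc) n))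
    (solve 5 (λ a b c x y → (a :+ b) :* c :+ (x :+ y) := (a :* c :+ x) :+ (b :* c :+ y)) refl
      (a 0) (b 0) (c (suc n)) ((a ∘ suc ⊛ c) n) ((b ∘ suc ⊛ c) n))

  ⊛-scale : ∀ k a b n → ((λ m → k * a m) ⊛ b) n ≈ k * (a ⊛ b) n
  ⊛-scale k a b zero    = *-assoc _ _ _
  ⊛-scale k a b (suc n) = trans (+-congˡ (⊛-scale k (a ∘ suc) b n))
    (solve 4 (λ k x y z → (k :* x) :* y :+ k :* z := k :* (x :* y :+ z)) refl
      k (a 0) (b (suc n)) ((a ∘ suc ⊛ b) n))

  -- Mirror image of the defining recursion, shifting the second factor; commutativity comes from
  -- playing the two against each other.
  ⊛-suc : ∀ a b n → (a ⊛ b) (suc n) ≈ a (suc n) * b 0 + (a ⊛ b ∘ suc) n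
  ⊛-suc a b zero    = +-comm _ _
  ⊛-suc a b (suc n) = trans (+-congˡ (⊛-suc (a ∘ suc) b n))
    (solve 3 (λ x y z → x :+ (y :+ z) := y :+ (x :+ z)) refl
      (a 0 * b (suc (suc n))) (a (suc (suc n)) * b 0) ((a ∘ suc ⊛ b ∘ suc) n))

  ⊛-comm : ∀ a b → a ⊛ b ≋ b ⊛ a
  ⊛-comm a b zero    = *-comm _ _
  ⊛-comm a b (suc n) = trans (+-cong (*-comm _ _) (⊛-comm (a ∘ suc) b n)) (sym (⊛-suc b a n))

  ⊛-assoc : ∀ a b c → (a ⊛ b) ⊛ c ≋ a ⊛ (b ⊛ c)
  ⊛-assoc a b c zero    = *-assoc _ _ _
  ⊛-assoc a b c (suc n) = begin
    (a 0 * b 0) * c (suc n) + ((a ⊛ b) ∘ suc ⊛ c) n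
      -- By definition the shift of a ⊛ b is a₀ b′ + a′ ⊛ b, with a prime for the shift.
      ≈⟨ +-congˡ (⊛-distribʳ c (λ m → a 0 * b (suc m)) (a ∘ suc ⊛ b) n) ⟩
    (a 0 * b 0) * c (suc n) + (((λ m → a 0 * b (suc m)) ⊛ c) n + ((a ∘ suc ⊛ b) ⊛ c) n)
      ≈⟨ +-congˡ (+-cong (⊛-scale (a 0) (b ∘ suc) c n) (⊛-assoc (a ∘ suc) b c n)) ⟩
    (a 0 * b 0) * c (suc n) + (a 0 * (b ∘ suc ⊛ c) n + (a ∘ suc ⊛ (b ⊛ c)) n)
      ≈⟨ solve 5 (λ a b c x y → (a :* b) :* c :+ (a :* x :+ y) := a :* (b :* c :+ x) :+ y) refl
           (a 0) (b 0) (c (suc n)) ((b ∘ suc ⊛ c) n) ((a ∘ suc ⊛ (b ⊛ c)) n) ⟩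
    a 0 * (b ⊛ c) (suc n) + (a ∘ suc ⊛ (b ⊛ c)) n ∎

  ⊛-identityˡ : ∀ b → const 1# ⊛ b ≋ b
  ⊛-identityˡ b n = trans (const-⊛ 1# b n) (*-identityˡ _)

  ⊛-distribˡ : ∀ a b c → a ⊛ (b ⊕ c) ≋ (a ⊛ b) ⊕ (a ⊛ c)
  ⊛-distribˡ a b c n = trans (⊛-comm a (b ⊕ c) n)
    (trans (⊛-distribʳ a b c n) (+-cong (⊛-comm b a n) (⊛-comm c a n)))

  seriesRing : CommutativeRing c ℓ
  seriesRing = record
    { Carrier = Series
    ; _≈_ = _≋_
    ; _+_ = _⊕_
    ; _*_ = _⊛_
    ; -_ = ⊖_
    ; 0# = 𝟘
    ; 1# = const 1#
    ; isCommutativeRing = record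
      { isRing = record
        { +-isAbelianGroup = record
          { isGroup = record
            { isMonoid = record
              { isSemigroup = record
                { isMagma = record
                  { isEquivalence = record
                    { refl = λ _ → refl ; sym = λ p n → sym (p n) ; trans = λ p q n → trans (p n) (q n) }
                  ; ∙-cong = λ p q n → +-cong (p n) (q n)
                  }
                ; assoc = λ a b c n → +-assoc (a n) (b n) (c n)
                }
              ; identity = (λ a n → +-identityˡ (a n)) , (λ a n → +-identityʳ (a n))
              }
            ; inverse = (λ a n → -‿inverseˡ (a n)) , (λ a n → -‿inverseʳ (a n))
            ; ⁻¹-cong = λ p n → -‿cong (p n)
            }
          ; comm = λ a b n → +-comm (a n) (b n)
          }
        ; *-cong = ⊛-cong
        ; *-assoc = ⊛-assoc
        ; *-identity = ⊛-identityˡ , (λ b n → trans (⊛-comm b (const 1#) n) (⊛-identityˡ b n))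
        ; distrib = ⊛-distribˡ , ⊛-distribʳ
        }
      ; *-comm = ⊛-comm
      }
    }

-- The ring of coefficient functions in two variables.

module PolynomialRing {c ℓ} (K : CharZeroField c ℓ) where
  open CharZeroField K hiding (zero) public
  open Poly K public
  open Algebra.Properties.Ring ring using (-0#≈0#) public
  module KSolver = IntegerCoefficients.Solver commutativeRing
  module K-Reasoning = Relation.Binary.Reasoning.Setoid setoid
  private
    module S₁ = PowerSeries commutativeRing
    module S₂ = PowerSeries S₁.seriesRing
    module R₂ = CommutativeRing S₂.seriesRing

  sumTo-zero : ∀ n {f} → (∀ k → k < n → f k ≈ 0#) → sumTo n f ≈ 0#
  sumTo-zero zero    e = refl
  sumTo-zero (suc n) e =
    trans (+-cong (sumTo-zero n (λ k k<n → e k (ℕₚ.m<n⇒m<1+n k<n))) (e n ℕₚ.≤-refl)) (+-identityʳ 0#)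

  sumTo-single : ∀ n k₀ {f} → k₀ < n → (∀ k → k < n → k ≢ k₀ → f k ≈ 0#) → sumTo n f ≈ f k₀
  sumTo-single (suc n) k₀ {f} k₀<1+n e with k₀ ℕ.≟ n
  ... | yes ≡.refl = trans (+-congʳ (sumTo-zero n (λ k k<n → e k (ℕₚ.m<n⇒m<1+n k<n) (ℕₚ.<⇒≢ k<n)))) (+-identityˡ _)
  ... | no k₀≢n    = trans (+-cong (sumTo-single n k₀ (ℕₚ.≤∧≢⇒< (ℕₚ.≤-pred k₀<1+n) k₀≢n) (λ k k<n → e k (ℕₚ.m<n⇒m<1+n k<n)))
                                   (e n ℕₚ.≤-refl (k₀≢n ∘ ≡.sym))) (+-identityʳ _)

  sumTo-head : ∀ n f → sumTo (suc n) f ≈ f 0 + sumTo n (f ∘ suc)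
  sumTo-head zero    f = +-comm _ _
  sumTo-head (suc n) f = trans (+-congʳ (sumTo-head n f)) (+-assoc _ _ _)

  private
    convolution : ∀ u v j → sumTo (suc j) (λ l → u l * v (j ∸ l)) ≈ (u S₁.⊛ v) j
    convolution u v zero    = +-identityˡ _
    convolution u v (suc j) = trans (sumTo-head (suc j) (λ l → u l * v (suc j ∸ l))) (+-congˡ (convolution (u ∘ suc) v j))

    -- Read as series in x over series in y, the double sum is a convolution of convolutions; every
    -- ring law for `_*ₚ_` is transported along this identification.
    *ₚ≈⊛ : ∀ a b → (a *ₚ b) ≈ₚ (a S₂.⊛ b)
    *ₚ≈⊛ a b zero    j = trans (+-identityˡ _) (convolution (a 0) (b 0) j)
    *ₚ≈⊛ a b (suc i) j = trans (sumTo-head (suc i) (λ k → sumTo (suc j) λ l → a k l * b (suc i ∸ k) (j ∸ l)))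
      (+-cong (convolution (a 0) (b (suc i)) j) (*ₚ≈⊛ (a ∘ suc) b i j))

    mono₀₀≈const : ∀ k → mono k 0 0 ≈ₚ S₂.const (S₁.const k)
    mono₀₀≈const k zero    zero    = refl
    mono₀₀≈const k zero    (suc j) = refl
    mono₀₀≈const k (suc i) j       = refl

    *ₚ-via-⊛ : ∀ a b {a′ b′} → a ≈ₚ a′ → b ≈ₚ b′ → (a *ₚ b) ≈ₚ (a′ S₂.⊛ b′)
    *ₚ-via-⊛ a b p q i j = trans (*ₚ≈⊛ a b i j) (R₂.*-cong p q i j)

    ≈ₚ-refl : ∀ a → a ≈ₚ a
    ≈ₚ-refl a i j = refl

    *ₚ-cong : ∀ {a a′ b b′} → a ≈ₚ a′ → b ≈ₚ b′ → (a *ₚ b) ≈ₚ (a′ *ₚ b′)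
    *ₚ-cong {a} {a′} {b} {b′} p q i j = trans (*ₚ-via-⊛ a b p q i j) (sym (*ₚ≈⊛ a′ b′ i j))

    *ₚ-assoc : ∀ a b c → ((a *ₚ b) *ₚ c) ≈ₚ (a *ₚ (b *ₚ c))
    *ₚ-assoc a b c i j = trans (*ₚ-via-⊛ (a *ₚ b) c (*ₚ≈⊛ a b) (≈ₚ-refl c) i j)
      (trans (R₂.*-assoc a b c i j) (sym (*ₚ-via-⊛ a (b *ₚ c) (≈ₚ-refl a) (*ₚ≈⊛ b c) i j)))

    *ₚ-comm : ∀ a b → (a *ₚ b) ≈ₚ (b *ₚ a)
    *ₚ-comm a b i j = trans (*ₚ≈⊛ a b i j) (trans (R₂.*-comm a b i j) (sym (*ₚ≈⊛ b a i j)))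

    *ₚ-identityˡ : ∀ a → (1ₚ *ₚ a) ≈ₚ a
    *ₚ-identityˡ a i j = trans (*ₚ-via-⊛ 1ₚ a (mono₀₀≈const 1#) (≈ₚ-refl a) i j) (R₂.*-identityˡ a i j)

    *ₚ-distribˡ : ∀ a b c → (a *ₚ (b +ₚ c)) ≈ₚ ((a *ₚ b) +ₚ (a *ₚ c))
    *ₚ-distribˡ a b c i j = trans (*ₚ≈⊛ a (b +ₚ c) i j)
      (trans (R₂.distribˡ a b c i j) (sym (+-cong (*ₚ≈⊛ a b i j) (*ₚ≈⊛ a c i j))))

    *ₚ-distribʳ : ∀ a b c → ((b +ₚ c) *ₚ a) ≈ₚ ((b *ₚ a) +ₚ (c *ₚ a))
    *ₚ-distribʳ a b c i j = trans (*ₚ≈⊛ (b +ₚ c) a i j)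
      (trans (R₂.distribʳ a b c i j) (sym (+-cong (*ₚ≈⊛ b a i j) (*ₚ≈⊛ c a i j))))

  polRing : CommutativeRing c ℓ
  polRing = record
    { Carrier = Pol
    ; _≈_ = _≈ₚ_
    ; _+_ = _+ₚ_
    ; _*_ = _*ₚ_
    ; -_ = -ₚ_
    ; 0# = 0ₚ
    ; 1# = 1ₚ
    ; isCommutativeRing = record
      { isRing = record
        { +-isAbelianGroup = R₂.+-isAbelianGroup
        ; *-cong = λ {a} {a′} {b} {b′} → *ₚ-cong {a} {a′} {b} {b′}
        ; *-assoc = *ₚ-assoc
        ; *-identity = *ₚ-identityˡ , (λ a i j → trans (*ₚ-comm a 1ₚ i j) (*ₚ-identityˡ a i j))
        ; distrib = *ₚ-distribˡ , *ₚ-distribʳ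
        }
      ; *-comm = *ₚ-comm
      }
    }

  module P = CommutativeRing polRing
  module PSolver = IntegerCoefficients.Solver polRing
  module P-Reasoning = Relation.Binary.Reasoning.Setoid P.setoid

  C : Carrier → Pol
  C k = mono k 0 0

  C-* : ∀ k a i j → (C k *ₚ a) i j ≈ k * a i j
  C-* k a i j = trans (*ₚ-via-⊛ (C k) a (mono₀₀≈const k) (≈ₚ-refl a) i j)
    (trans (S₂.const-⊛ (S₁.const k) a i j) (S₁.const-⊛ k (a i) j))

  X-*-zero : ∀ a j → (X *ₚ a) 0 j ≈ 0#
  X-*-zero a j = trans (*ₚ≈⊛ X a 0 j) (S₁.⊛-zeroˡ (a 0) j)

  X-*-suc : ∀ a i j → (X *ₚ a) (suc i) j ≈ a i j
  X-*-suc a i j = trans (*ₚ≈⊛ X a (suc i) j) (trans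
    (+-cong (S₁.⊛-zeroˡ (a (suc i)) j) (trans (sym (*ₚ≈⊛ 1ₚ a i j)) (*ₚ-identityˡ a i j))) (+-identityˡ _))

  private
    Y-* : ∀ a i j → (Y *ₚ a) i j ≈ (Y 0 S₁.⊛ a i) j
    Y-* a i j = trans (*ₚ-via-⊛ Y a Y≈ (≈ₚ-refl a) i j) (S₂.const-⊛ (Y 0) a i j)
      where
      Y≈ : Y ≈ₚ S₂.const (Y 0)
      Y≈ zero    j = refl
      Y≈ (suc i) j = refl

  Y-*-zero : ∀ a i → (Y *ₚ a) i 0 ≈ 0#
  Y-*-zero a i = trans (Y-* a i 0) (zeroˡ _)

  Y-*-suc : ∀ a i j → (Y *ₚ a) i (suc j) ≈ a i j
  Y-*-suc a i j = trans (Y-* a i (suc j)) (trans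
    (+-cong (zeroˡ _) (trans (S₁.⊛-cong Y≈ (λ _ → refl) j) (S₁.⊛-identityˡ (a i) j))) (+-identityˡ _))
    where
    Y≈ : ∀ j → Y 0 (suc j) ≈ S₁.const 1# j
    Y≈ zero    = refl
    Y≈ (suc j) = refl

  mono-cong : ∀ {k k′} i j → k ≈ k′ → mono k i j ≈ₚ mono k′ i j
  mono-cong i j e a b with (a ℕ.≡ᵇ i) | (b ℕ.≡ᵇ j)
  ... | Bool.true  | Bool.true  = e
  ... | Bool.true  | Bool.false = refl
  ... | Bool.false | _               = refl

-- Monomials, linear forms and the operator x ∂x.

module LinearForms {c ℓ} (K : CharZeroField c ℓ) where
  open PolynomialRing K
  open Divisibility polRing public

  mono-on : ∀ k i j → mono k i j i j ≈ k
  mono-on k zero    zero    = refl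
  mono-on k zero    (suc j) = mono-on k zero j
  mono-on k (suc i) j       = mono-on k i j

  mono-off : ∀ k i j a b → (a ≢ i) ⊎ (b ≢ j) → mono k i j a b ≈ 0#
  mono-off k i j a b ne with a ℕ.≡ᵇ i in a≡ᵇi | b ℕ.≡ᵇ j in b≡ᵇj | ne
  ... | true  | true  | inj₁ a≢i = contradiction (ℕₚ.≡ᵇ⇒≡ a i (≡.subst Bool.T (≡.sym a≡ᵇi) tt)) a≢i
  ... | true  | true  | inj₂ b≢j = contradiction (ℕₚ.≡ᵇ⇒≡ b j (≡.subst Bool.T (≡.sym b≡ᵇj) tt)) b≢j
  ... | true  | false | _ = refl
  ... | false | _     | _ = refl

  mono-zero : ∀ i j → mono 0# i j ≈ₚ 0ₚ
  mono-zero i j a b with (a ℕ.≡ᵇ i) ∧ (b ℕ.≡ᵇ j)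
  ... | true  = refl
  ... | false = refl

  mono-+ : ∀ k k′ i j → mono (k + k′) i j ≈ₚ (mono k i j +ₚ mono k′ i j)
  mono-+ k k′ i j a b with (a ℕ.≡ᵇ i) ∧ (b ℕ.≡ᵇ j)
  ... | true  = refl
  ... | false = sym (+-identityʳ 0#)

  mono-* : ∀ z k i j → mono (z * k) i j ≈ₚ (C z *ₚ mono k i j)
  mono-* z k i j a b = trans (scale a b) (sym (C-* z (mono k i j) a b))
    where
    scale : ∀ a b → mono (z * k) i j a b ≈ z * mono k i j a b
    scale a b with (a ℕ.≡ᵇ i) ∧ (b ℕ.≡ᵇ j)
    ... | true  = refl
    ... | false = sym (zeroʳ z)

  X-mono : ∀ k i j → (X *ₚ mono k i j) ≈ₚ mono k (suc i) j
  X-mono k i j zero    b = X-*-zero (mono k i j) b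
  X-mono k i j (suc a) b = X-*-suc (mono k i j) a b

  Y-mono : ∀ k i j → (Y *ₚ mono k i j) ≈ₚ mono k i (suc j)
  Y-mono k i j a zero    = trans (Y-*-zero (mono k i j) a) (sym (mono-off k i (suc j) a zero (inj₂ λ ())))
  Y-mono k i j a (suc b) = Y-*-suc (mono k i j) a b

  Lin : Carrier → Pol
  Lin k = X +ₚ (C k *ₚ Y)

  Lin-* : ∀ k t i j → (Lin k *ₚ t) i j ≈ (X *ₚ t) i j + k * (Y *ₚ t) i j
  Lin-* k t i j = trans (P.distribʳ t X (C k *ₚ Y) i j)
    (+-congˡ (trans (P.*-assoc (C k) Y t i j) (C-* k (Y *ₚ t) i j)))

  Lin-*-suc-zero : ∀ k t i → (Lin k *ₚ t) (suc i) 0 ≈ t i 0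
  Lin-*-suc-zero k t i = trans (Lin-* k t (suc i) 0)
    (trans (+-cong (X-*-suc t i 0) (trans (*-congˡ (Y-*-zero t (suc i))) (zeroʳ k))) (+-identityʳ _))

  Lin-*-zero-suc : ∀ k t j → (Lin k *ₚ t) 0 (suc j) ≈ k * t 0 j
  Lin-*-zero-suc k t j = trans (Lin-* k t 0 (suc j))
    (trans (+-cong (X-*-zero t (suc j)) (*-congˡ (Y-*-suc t 0 j))) (+-identityˡ _))

  Lin-*-suc-suc : ∀ k t i j → (Lin k *ₚ t) (suc i) (suc j) ≈ t i (suc j) + k * t (suc i) j
  Lin-*-suc-suc k t i j = trans (Lin-* k t (suc i) (suc j)) (+-cong (X-*-suc t i (suc j)) (*-congˡ (Y-*-suc t (suc i) j)))

  Vanish : (ℕ → Set) → Pol → Set ℓ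
  Vanish V a = ∀ i j → V (i ℕ.+ j) → a i j ≈ 0#

  -- Satisfied by nonzero linear forms; taking V to be N ≤_, _≢ k or everything transfers
  -- finiteness, homogeneity or vanishing from u t to t.
  LowersDegree : Pol → Set (lsuc 0ℓ ⊔ c ⊔ ℓ)
  LowersDegree u = ∀ (V : ℕ → Set) t → Vanish V (u *ₚ t) → Vanish (V ∘ suc) t

  -- The coefficients of t are solved for by induction on the power of y: t_(i,0) is read off
  -- directly, and t_(i,j+1) differs from a coefficient of the product by k t_(i+1,j), which has the
  -- same total degree.
  Lin-lowers : ∀ k → LowersDegree (Lin k)
  Lin-lowers k V t van i zero v = trans (sym (Lin-*-suc-zero k t i)) (van (suc i) 0 v)
  Lin-lowers k V t van i (suc j) v = begin
    t i (suc j)                                          ≈⟨ solve 2 (λ x y → x := (x :+ y) :- y) refl _ (k * t (suc i) j) ⟩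
    (t i (suc j) + k * t (suc i) j) - k * t (suc i) j    ≈⟨ +-cong (Lin-*-suc-suc k t i j) (-‿cong (*-congˡ (sym (
                                                              Lin-lowers k V t van (suc i) j (≡.subst (V ∘ suc) (ℕₚ.+-suc i j) v))))) ⟨
    (Lin k *ₚ t) (suc i) (suc j) - k * 0#                ≈⟨ +-congʳ (van (suc i) (suc j) v) ⟩
    0# - k * 0#                                          ≈⟨ solve 1 (λ k → con (+ 0) :- k :* con (+ 0) := con (+ 0)) refl k ⟩
    0#                                                   ∎
    where
    open K-Reasoning
    open KSolver

  X-lowers : LowersDegree X
  X-lowers V t van i j v = trans (sym (X-*-suc t i j)) (van (suc i) j v)

  Y-lowers : LowersDegree Y
  Y-lowers V t van i j v = trans (sym (Y-*-suc t i j)) (van i (suc j) (≡.subst V (≡.sym (ℕₚ.+-suc i j)) v))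

  lowers-^ : ∀ {u} → LowersDegree u → ∀ n (V : ℕ → Set) t → Vanish V ((u ^ n) *ₚ t) → Vanish (λ k → V (n ℕ.+ k)) t
  lowers-^ lu zero V t van i j v = trans (sym (P.*-identityˡ t i j)) (van i j v)
  lowers-^ {u} lu (suc n) V t van = lowers-^ {u} lu n (V ∘ suc) t
    (lu V ((u ^ n) *ₚ t) (λ i j v → trans (sym (P.*-assoc u (u ^ n) t i j)) (van i j v)))

  lowers⇒cancellable : ∀ {u} → LowersDegree u → Cancellable u
  lowers⇒cancellable lu t e i j = lu (λ _ → ⊤) t (λ i j _ → e i j) i j tt

  X-∣ : ∀ {t} → (∀ j → t 0 j ≈ 0#) → X ∣ t
  X-∣ {t} e = t ∘ suc , λ where
    zero    j → trans (e j) (sym (X-*-zero (t ∘ suc) j))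
    (suc i) j → sym (X-*-suc (t ∘ suc) i j)

  Y-∣ : ∀ {t} → (∀ i → t i 0 ≈ 0#) → Y ∣ t
  Y-∣ {t} e = (λ i j → t i (suc j)) , λ where
    i zero    → trans (e i) (sym (Y-*-zero (λ i j → t i (suc j)) i))
    i (suc j) → sym (Y-*-suc (λ i j → t i (suc j)) i j)

  X^-∣ : ∀ n {t} → (∀ i j → i < n → t i j ≈ 0#) → (X ^ n) ∣ t
  X^-∣ zero    {t} e = t , P.sym {1ₚ *ₚ t} {t} (P.*-identityˡ t)
  X^-∣ (suc n) {t} e with X-∣ {t} (λ j → e 0 j (s≤s z≤n))
  ... | s , t≈ with X^-∣ n {s} (λ i j i<n → trans (sym (X-*-suc s i j)) (trans (sym (t≈ (suc i) j)) (e (suc i) j (s≤s i<n))))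
  ... | q , s≈ = q , λ i j → trans (t≈ i j) (trans (P.*-cong {X} {X} (P.refl {X}) s≈ i j) (sym (P.*-assoc X (X ^ n) q i j)))

  Y^-∣ : ∀ n {t} → (∀ i j → j < n → t i j ≈ 0#) → (Y ^ n) ∣ t
  Y^-∣ zero    {t} e = t , P.sym {1ₚ *ₚ t} {t} (P.*-identityˡ t)
  Y^-∣ (suc n) {t} e with Y-∣ {t} (λ i → e i 0 (s≤s z≤n))
  ... | s , t≈ with Y^-∣ n {s} (λ i j j<n → trans (sym (Y-*-suc s i j)) (trans (sym (t≈ i (suc j))) (e i (suc j) (s≤s j<n))))
  ... | q , s≈ = q , λ i j → trans (t≈ i j) (trans (P.*-cong {Y} {Y} (P.refl {Y}) s≈ i j) (sym (P.*-assoc Y (Y ^ n) q i j)))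

  cancellable-X : Cancellable X
  cancellable-X = lowers⇒cancellable {X} X-lowers

  cancellable-Y : Cancellable Y
  cancellable-Y = lowers⇒cancellable {Y} Y-lowers

  cancellable-Lin : ∀ k → Cancellable (Lin k)
  cancellable-Lin k = lowers⇒cancellable {Lin k} (Lin-lowers k)

  coprime-Y-X : Coprime Y X
  coprime-Y-X t (s , e) = Y-∣ λ i → trans (sym (X-*-suc t i 0)) (trans (e (suc i) 0) (Y-*-zero s (suc i)))

  coprime-Y-Lin : ∀ k → Coprime Y (Lin k)
  coprime-Y-Lin k t (s , e) = Y-∣ λ i → trans (sym (Lin-*-suc-zero k t i)) (trans (e (suc i) 0) (Y-*-zero s (suc i)))

  -- Modulo x the form reduces to k y, whence the inverse of k; modulo y it reduces to x for every
  -- k.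
  coprime-X-Lin : ∀ {k k⁻¹} → k⁻¹ * k ≈ 1# → Coprime X (Lin k)
  coprime-X-Lin {k} {k⁻¹} inv t (s , e) = X-∣ λ j → begin
    t 0 j                            ≈⟨ *-identityˡ _ ⟨
    1# * t 0 j                       ≈⟨ *-congʳ inv ⟨
    (k⁻¹ * k) * t 0 j                ≈⟨ *-assoc _ _ _ ⟩
    k⁻¹ * (k * t 0 j)                ≈⟨ *-congˡ (Lin-*-zero-suc k t j) ⟨
    k⁻¹ * (Lin k *ₚ t) 0 (suc j)     ≈⟨ *-congˡ (trans (e 0 (suc j)) (X-*-zero s (suc j))) ⟩
    k⁻¹ * 0#                         ≈⟨ zeroʳ _ ⟩
    0#                               ∎
    where open K-Reasoning

  coprime-Lin-Y : ∀ k → Coprime (Lin k) Y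
  coprime-Lin-Y k = coprime-sym {Y} {Lin k} cancellable-Y (coprime-Y-Lin k)

  coprime-Lin-X : ∀ {k k⁻¹} → k⁻¹ * k ≈ 1# → Coprime (Lin k) X
  coprime-Lin-X {k} inv = coprime-sym {X} {Lin k} cancellable-X (coprime-X-Lin inv)

  coprime-unit : ∀ {u} {k k⁻¹} → k⁻¹ * k ≈ 1# → Coprime u (C k)
  coprime-unit {u} {k} {k⁻¹} inv t d = ∣-resp {u} {u} {C k⁻¹ *ₚ (C k *ₚ t)} {t} (P.refl {u})
    (λ i j → begin
      (C k⁻¹ *ₚ (C k *ₚ t)) i j    ≈⟨ C-* k⁻¹ (C k *ₚ t) i j ⟩
      k⁻¹ * (C k *ₚ t) i j         ≈⟨ *-congˡ (C-* k t i j) ⟩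
      k⁻¹ * (k * t i j)            ≈⟨ *-assoc _ _ _ ⟨
      (k⁻¹ * k) * t i j            ≈⟨ *-congʳ inv ⟩
      1# * t i j                   ≈⟨ *-identityˡ _ ⟩
      t i j                        ∎)
    (∣-* {u} {C k *ₚ t} (C k⁻¹) d)
    where open K-Reasoning

  -- Lin k + Lin (- k) = 2 X, and 2 X is coprime to Lin k.
  coprime-Lin-Lin : ∀ {k k′ k⁻¹ ½} → k⁻¹ * k ≈ 1# → ½ * ι 2 ≈ 1# → k + k′ ≈ 0# → Coprime (Lin k) (Lin k′)
  coprime-Lin-Lin {k} {k′} {k⁻¹} {½} inv half k+k′ t (s , e) =
    coprime-unit {Lin k} half t (coprime-Lin-X inv (C (ι 2) *ₚ t)
      (s +ₚ t , λ i j → begin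
        (X *ₚ (C (ι 2) *ₚ t)) i j                              ≈⟨ shift i j ⟩
        ι 2 * (X *ₚ t) i j                                     ≈⟨ solve 4 (λ k k′ x y → con (+ 2) :* x := (x :+ k′ :* y) :+ (x :+ k :* y) :- (k :+ k′) :* y)
                                                                    refl k k′ ((X *ₚ t) i j) ((Y *ₚ t) i j) ⟩
        ((X *ₚ t) i j + k′ * (Y *ₚ t) i j) + ((X *ₚ t) i j + k * (Y *ₚ t) i j) - (k + k′) * (Y *ₚ t) i j
                                                               ≈⟨ +-cong (+-cong (Lin-* k′ t i j) (Lin-* k t i j)) (-‿cong (*-congʳ (sym k+k′))) ⟨
        (Lin k′ *ₚ t) i j + (Lin k *ₚ t) i j - 0# * (Y *ₚ t) i j
                                                               ≈⟨ +-congʳ (+-congʳ (e i j)) ⟩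
        (Lin k *ₚ s) i j + (Lin k *ₚ t) i j - 0# * (Y *ₚ t) i j
                                                               ≈⟨ solve 2 (λ a y → a :- con (+ 0) :* y := a) refl _ ((Y *ₚ t) i j) ⟩
        (Lin k *ₚ s) i j + (Lin k *ₚ t) i j                    ≈⟨ P.distribˡ (Lin k) s t i j ⟨
        (Lin k *ₚ (s +ₚ t)) i j                                ∎))
    where
    open K-Reasoning
    open KSolver
    shift : ∀ i j → (X *ₚ (C (ι 2) *ₚ t)) i j ≈ ι 2 * (X *ₚ t) i j
    shift i j = trans (P.*-comm X (C (ι 2) *ₚ t) i j) (trans (P.*-assoc (C (ι 2)) t X i j)
      (trans (C-* (ι 2) (t *ₚ X) i j) (*-congˡ (P.*-comm t X i j))))

  -- x ∂x
  E : Pol → Pol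
  E a i j = ι i * a i j

  E-Lin : ∀ k u → E (Lin k *ₚ u) ≈ₚ ((X *ₚ u) +ₚ (Lin k *ₚ E u))
  E-Lin k u i j = begin
    ι i * (Lin k *ₚ u) i j                                                 ≈⟨ *-congˡ (Lin-* k u i j) ⟩
    ι i * ((X *ₚ u) i j + k * (Y *ₚ u) i j)                                ≈⟨ solve 4 (λ n x k y → n :* (x :+ k :* y) := n :* x :+ k :* (n :* y)) refl (ι i) _ k _ ⟩
    ι i * (X *ₚ u) i j + k * (ι i * (Y *ₚ u) i j)                          ≈⟨ +-cong (E-X i) (*-congˡ (E-Y j)) ⟩
    ((X *ₚ u) i j + (X *ₚ E u) i j) + k * (Y *ₚ E u) i j                   ≈⟨ +-assoc _ _ _ ⟩
    (X *ₚ u) i j + ((X *ₚ E u) i j + k * (Y *ₚ E u) i j)                   ≈⟨ +-congˡ (Lin-* k (E u) i j) ⟨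
    (X *ₚ u) i j + (Lin k *ₚ E u) i j                                      ∎
    where
    open K-Reasoning
    open KSolver
    E-X : ∀ i → ι i * (X *ₚ u) i j ≈ (X *ₚ u) i j + (X *ₚ E u) i j
    E-X zero    = trans (zeroˡ _) (sym (trans (+-cong (X-*-zero u j) (X-*-zero (E u) j)) (+-identityʳ 0#)))
    E-X (suc i) = begin
      (1# + ι i) * (X *ₚ u) (suc i) j                ≈⟨ *-congˡ (X-*-suc u i j) ⟩
      (1# + ι i) * u i j                             ≈⟨ distribʳ _ _ _ ⟩
      1# * u i j + ι i * u i j                       ≈⟨ +-cong (trans (*-identityˡ _) (sym (X-*-suc u i j))) (sym (X-*-suc (E u) i j)) ⟩
      (X *ₚ u) (suc i) j + (X *ₚ E u) (suc i) j      ∎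
    E-Y : ∀ j → ι i * (Y *ₚ u) i j ≈ (Y *ₚ E u) i j
    E-Y zero    = trans (*-congˡ (Y-*-zero u i)) (trans (zeroʳ _) (sym (Y-*-zero (E u) i)))
    E-Y (suc j) = trans (*-congˡ (Y-*-suc u i j)) (sym (Y-*-suc (E u) i j))

  E-mono : ∀ k i j → E (mono k i j) ≈ₚ mono (ι i * k) i j
  E-mono k i j a b with a ℕ.≟ i
  ... | no a≢i     = trans (*-congˡ (mono-off k i j a b (inj₁ a≢i))) (trans (zeroʳ _) (sym (mono-off (ι i * k) i j a b (inj₁ a≢i))))
  ... | yes ≡.refl = trans (sym (C-* (ι i) (mono k i j) i b)) (sym (mono-* (ι i) k i j i b))

  -- One convolution argument for degree bounds and for homogeneity: `U`, `V`, `W` are conditions on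
  -- total degrees, and a degree in `U` can only split so that one of the two factors vanishes.
  *-vanish : ∀ {V W U : ℕ → Set} {a b} → (∀ m n → U (m ℕ.+ n) → V m ⊎ W n) →
    Vanish V a → Vanish W b → Vanish U (a *ₚ b)
  *-vanish {V} {W} {U} {a} {b} split va vb i j u =
    sumTo-zero (suc i) λ k k≤i → sumTo-zero (suc j) λ l l≤j → term k l (ℕₚ.≤-pred k≤i) (ℕₚ.≤-pred l≤j)
    where
    total : ∀ k l → k ≤ i → l ≤ j → i ℕ.+ j ≡ (k ℕ.+ l) ℕ.+ ((i ∸ k) ℕ.+ (j ∸ l))
    total k l k≤i l≤j = ≡.trans (≡.sym (≡.cong₂ ℕ._+_ (ℕₚ.m+[n∸m]≡n k≤i) (ℕₚ.m+[n∸m]≡n l≤j)))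
      (ℕ-interchange k (i ∸ k) l (j ∸ l))
      where
      ℕ-interchange : ∀ a b c d → (a ℕ.+ b) ℕ.+ (c ℕ.+ d) ≡ (a ℕ.+ c) ℕ.+ (b ℕ.+ d)
      ℕ-interchange = ℕ-solve-∀
    term : ∀ k l → k ≤ i → l ≤ j → a k l * b (i ∸ k) (j ∸ l) ≈ 0#
    term k l k≤i l≤j with split (k ℕ.+ l) ((i ∸ k) ℕ.+ (j ∸ l)) (≡.subst U (total k l k≤i l≤j) u)
    ... | inj₁ v = trans (*-congʳ (va k l v)) (zeroˡ _)
    ... | inj₂ w = trans (*-congˡ (vb (i ∸ k) (j ∸ l) w)) (zeroʳ _)

-- Double factorials, rising products and identities between the coefficients.

module Scalars {c ℓ} (K : CharZeroField c ℓ) where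
  open PolynomialRing K
  open Algebra.Properties.Semiring.Mult semiring using (×-homo-+; ×1-homo-*) renaming (_×_ to _⋆_)
  open IntegerCoefficients commutativeRing using (⟦_⟧)
  open K-Reasoning
  open KSolver using (solve; _:=_; _:*_; _:+_; _:-_; :-_; con)

  ι≡⋆ : ∀ n → ι n ≡ n ⋆ 1#
  ι≡⋆ zero    = ≡.refl
  ι≡⋆ (suc n) = ≡.cong (λ z → 1# + z) (ι≡⋆ n)

  ιℤ≡⟦⟧ : ∀ i → ιℤ i ≡ ⟦ i ⟧
  ιℤ≡⟦⟧ (+ n)    = ι≡⋆ n
  ιℤ≡⟦⟧ -[1+ n ] = ≡.cong -_ (ι≡⋆ (suc n))

  ι-+ : ∀ m n → ι (m ℕ.+ n) ≈ ι m + ι n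
  ι-+ m n rewrite ι≡⋆ (m ℕ.+ n) | ι≡⋆ m | ι≡⋆ n = ×-homo-+ 1# m n

  ι-* : ∀ m n → ι (m ℕ.* n) ≈ ι m * ι n
  ι-* m n rewrite ι≡⋆ (m ℕ.* n) | ι≡⋆ m | ι≡⋆ n = ×1-homo-* m n

  ιℤ-* : ∀ i j → ιℤ (i ℤ.* j) ≈ ιℤ i * ιℤ j
  ιℤ-* i j rewrite ιℤ≡⟦⟧ (i ℤ.* j) | ιℤ≡⟦⟧ i | ιℤ≡⟦⟧ j = IntegerCoefficients.*-homo commutativeRing i j

  ιℤ-+ : ∀ i j → ιℤ (i ℤ.+ j) ≈ ιℤ i + ιℤ j
  ιℤ-+ i j rewrite ιℤ≡⟦⟧ (i ℤ.+ j) | ιℤ≡⟦⟧ i | ιℤ≡⟦⟧ j = IntegerCoefficients.+-homo commutativeRing i j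

  ιℤ-neg : ∀ i → ιℤ (ℤ.- i) ≈ - ιℤ i
  ιℤ-neg i rewrite ιℤ≡⟦⟧ (ℤ.- i) | ιℤ≡⟦⟧ i = IntegerCoefficients.-‿homo commutativeRing i

  ι-injective : ∀ m n → ι m ≈ ι n → m ≡ n
  ι-injective zero    zero    e = ≡.refl
  ι-injective zero    (suc n) e = contradiction (sym e) (charZero n)
  ι-injective (suc m) zero    e = contradiction e (charZero m)
  ι-injective (suc m) (suc n) e = ≡.cong suc (ι-injective m n (begin
    ι m                  ≈⟨ solve 2 (λ o x → x := (o :+ x) :- o) refl 1# (ι m) ⟩
    (1# + ι m) - 1#      ≈⟨ +-congʳ e ⟩
    (1# + ι n) - 1#      ≈⟨ solve 2 (λ o x → x := (o :+ x) :- o) refl 1# (ι n) ⟨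
    ι n                  ∎))

  ι≉0 : ∀ n → .{{ℕ.NonZero n}} → ¬ (ι n ≈ 0#)
  ι≉0 (suc n) = charZero n

  inverseˡ : ∀ {x} → ¬ (x ≈ 0#) → x ⁻¹ * x ≈ 1#
  inverseˡ {x} x≉0 = trans (*-comm _ _) (inverseʳ x x≉0)

  *-≉0 : ∀ {x y} → ¬ (x ≈ 0#) → ¬ (y ≈ 0#) → ¬ (x * y ≈ 0#)
  *-≉0 {x} {y} x≉0 y≉0 xy≈0 = y≉0 (begin
    y                ≈⟨ *-identityˡ y ⟨
    1# * y           ≈⟨ *-congʳ (inverseˡ x≉0) ⟨
    (x ⁻¹ * x) * y   ≈⟨ *-assoc _ _ _ ⟩
    x ⁻¹ * (x * y)   ≈⟨ *-congˡ xy≈0 ⟩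
    x ⁻¹ * 0#        ≈⟨ zeroʳ _ ⟩
    0#               ∎)

  -‿≉0 : ∀ {x} → ¬ (x ≈ 0#) → ¬ (- x ≈ 0#)
  -‿≉0 {x} x≉0 e = x≉0 (trans (solve 1 (λ x → x := :- (:- x)) refl x) (trans (-‿cong e) -0#≈0#))

  inv : ℕ → Carrier
  inv n = ι n ⁻¹

  inv≉0 : ∀ n → .{{ℕ.NonZero n}} → ¬ (inv n ≈ 0#)
  inv≉0 n e = 1≉0 (trans (sym (inverseʳ (ι n) (ι≉0 n))) (trans (*-congˡ e) (zeroʳ _)))

  inv-unique : ∀ n → .{{ℕ.NonZero n}} → ∀ {x} → ι n * x ≈ 1# → x ≈ inv n
  inv-unique n {x} e = begin
    x                      ≈⟨ *-identityˡ x ⟨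
    1# * x                 ≈⟨ *-congʳ (inverseˡ (ι≉0 n)) ⟨
    (inv n * ι n) * x      ≈⟨ *-assoc _ _ _ ⟩
    inv n * (ι n * x)      ≈⟨ *-congˡ e ⟩
    inv n * 1#             ≈⟨ *-identityʳ _ ⟩
    inv n                  ∎

  inv-* : ∀ m n → .{{_ : ℕ.NonZero m}} .{{_ : ℕ.NonZero n}} → inv (m ℕ.* n) ≈ inv m * inv n
  inv-* m n = sym (inv-unique (m ℕ.* n) {{ℕₚ.m*n≢0 m n}} (begin
    ι (m ℕ.* n) * (inv m * inv n)        ≈⟨ *-congʳ (ι-* m n) ⟩
    (ι m * ι n) * (inv m * inv n)        ≈⟨ solve 4 (λ a b x y → (a :* b) :* (x :* y) := (a :* x) :* (b :* y)) refl (ι m) (ι n) (inv m) (inv n) ⟩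
    (ι m * inv m) * (ι n * inv n)        ≈⟨ *-cong (inverseʳ _ (ι≉0 m)) (inverseʳ _ (ι≉0 n)) ⟩
    1# * 1#                              ≈⟨ *-identityˡ 1# ⟩
    1#                                   ∎))

  ι-inv-* : ∀ m n → .{{_ : ℕ.NonZero m}} .{{_ : ℕ.NonZero n}} → ι m * inv (m ℕ.* n) ≈ inv n
  ι-inv-* m n = begin
    ι m * inv (m ℕ.* n)          ≈⟨ *-congˡ (inv-* m n) ⟩
    ι m * (inv m * inv n)        ≈⟨ *-assoc _ _ _ ⟨
    (ι m * inv m) * inv n        ≈⟨ *-congʳ (inverseʳ _ (ι≉0 m)) ⟩
    1# * inv n                   ≈⟨ *-identityˡ _ ⟩
    inv n                        ∎

  !!-nonZero : ∀ n → ℕ.NonZero (n !!)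
  !!-nonZero zero          = _
  !!-nonZero (suc zero)    = _
  !!-nonZero (suc (suc n)) = ℕₚ.m*n≢0 (suc (suc n)) (n !!) {{_}} {{ !!-nonZero n}}

  2*suc : ∀ n → 2 ℕ.* suc n ≡ suc (suc (2 ℕ.* n))
  2*suc n = ℕₚ.*-suc 2 n

  -- Since d, m₁ and m₂ are odd, (d - m₁ - 2i)!! and (2i)!! are double factorials of even numbers
  -- and (d - 2i)!! is one of an odd number; hence two sequences of reciprocals.
  w v : ℕ → Carrier
  w n = inv ((2 ℕ.* n) !!)
  v n = inv (suc (2 ℕ.* n) !!)

  w-suc : ∀ n → ι (2 ℕ.* suc n) * w (suc n) ≈ w n
  w-suc n = ≡.subst (λ z → ι z * inv (z !!) ≈ w n) (≡.sym (2*suc n)) (ι-inv-* (suc (suc (2 ℕ.* n))) ((2 ℕ.* n) !!) {{_}} {{ !!-nonZero (2 ℕ.* n)}})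

  v-suc : ∀ n → ι (suc (2 ℕ.* suc n)) * v (suc n) ≈ v n
  v-suc n = ≡.subst (λ z → ι (suc z) * inv (suc z !!) ≈ v n) (≡.sym (2*suc n)) (ι-inv-* (suc (suc (suc (2 ℕ.* n)))) (suc (2 ℕ.* n) !!) {{_}} {{ !!-nonZero (suc (2 ℕ.* n))}})

  w≉0 : ∀ n → ¬ (w n ≈ 0#)
  w≉0 n = inv≉0 ((2 ℕ.* n) !!) {{ !!-nonZero (2 ℕ.* n)}}

  v≉0 : ∀ n → ¬ (v n ≈ 0#)
  v≉0 n = inv≉0 (suc (2 ℕ.* n) !!) {{ !!-nonZero (suc (2 ℕ.* n))}}

  sg : ℕ → Carrier
  sg zero    = 1#
  sg (suc n) = - sg n

  sg≉0 : ∀ n → ¬ (sg n ≈ 0#)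
  sg≉0 zero    = 1≉0
  sg≉0 (suc n) = -‿≉0 (sg≉0 n)

  sgn≈sg : ∀ n → ιℤ (sgn n) ≈ sg n
  sgn≈sg zero    = +-identityʳ 1#
  sgn≈sg (suc n) = trans (ιℤ-neg (sgn n)) (-‿cong (sgn≈sg n))

  sg-+ : ∀ m n → sg (m ℕ.+ n) ≈ sg m * sg n
  sg-+ zero    n = sym (*-identityˡ _)
  sg-+ (suc m) n = trans (-‿cong (sg-+ m n)) (solve 2 (λ x y → :- (x :* y) := (:- x) :* y) refl (sg m) (sg n))

  -- The product ⟨a⟩_n with a in the field, where the recursion replaces a by a + 2.
  B : Carrier → ℕ → Carrier
  B a zero    = 1#
  B a (suc n) = B a n * (a + ι (2 ℕ.* n))

  B-cong : ∀ {a a′} n → a ≈ a′ → B a n ≈ B a′ n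
  B-cong zero    e = refl
  B-cong (suc n) e = *-cong (B-cong n e) (+-congʳ e)

  ⟨⟩≈B : ∀ a n → ιℤ (⟨ a ⟩ n) ≈ B (ιℤ a) n
  ⟨⟩≈B a zero    = +-identityʳ 1#
  ⟨⟩≈B a (suc n) = trans (ιℤ-* (⟨ a ⟩ n) (a ℤ.+ + (2 ℕ.* n))) (*-cong (⟨⟩≈B a n) (ιℤ-+ a (+ (2 ℕ.* n))))

  B≉0 : ∀ {a} n → (∀ j → ¬ (a + ι (2 ℕ.* j) ≈ 0#)) → ¬ (B a n ≈ 0#)
  B≉0 zero    ne = 1≉0
  B≉0 (suc n) ne = *-≉0 (B≉0 n ne) (ne n)

  ι-2*suc : ∀ n → ι (2 ℕ.* suc n) ≈ ι 2 + ι (2 ℕ.* n)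
  ι-2*suc n = trans (reflexive (≡.cong ι (2*suc n))) (ι-+ 2 (2 ℕ.* n))

  -- Splitting off the first factor instead of the last is what links coefficients for a with those
  -- for a + 2.
  B-suc : ∀ a n → B a (suc n) ≈ a * B (a + ι 2) n
  B-suc a zero = solve 2 (λ a o → o :* (a :+ con (+ 0)) := a :* o) refl a 1#
  B-suc a (suc n) = begin
    B a (suc n) * (a + ι (2 ℕ.* suc n))                      ≈⟨ *-cong (B-suc a n) (+-congˡ (ι-2*suc n)) ⟩
    (a * B (a + ι 2) n) * (a + (ι 2 + ι (2 ℕ.* n)))          ≈⟨ solve 4 (λ a b t n → (a :* b) :* (a :+ (t :+ n)) := a :* (b :* ((a :+ t) :+ n)))
                                                                  refl a (B (a + ι 2) n) (ι 2) (ι (2 ℕ.* n)) ⟩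
    a * (B (a + ι 2) n * ((a + ι 2) + ι (2 ℕ.* n)))          ∎

  -- The k-th coefficient of f_m and, up to (-1)^m₃, of g_m; here n is the number of terms after the k-th.
  coef : Carrier → ℕ → ℕ → ℕ → Carrier
  coef a e n k = (sg k * B a n) * (w n * (v (e ∸ k) * w k))

  coef-cong : ∀ {a a′} e n k → a ≈ a′ → coef a e n k ≈ coef a′ e n k
  coef-cong e n k a≈ = *-congʳ (*-congˡ (B-cong n a≈))

  -- For f_m with n + 1 terms after the k-th, 2(n+1) is the exponent of x minus m₁. It cancels the
  -- top factor of (2(n+1))!!, while a is split off the rising product.
  coef-even : ∀ a e n k → ι (2 ℕ.* suc n) * coef a e (suc n) k ≈ a * coef (a + ι 2) e n k
  coef-even a e n k = begin
    ι (2 ℕ.* suc n) * ((sg k * B a (suc n)) * (w (suc n) * z))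
      ≈⟨ *-congˡ (*-congʳ (*-congˡ (B-suc a n))) ⟩
    ι (2 ℕ.* suc n) * ((sg k * (a * b)) * (w (suc n) * z))
      ≈⟨ solve 6 (λ t s a b w z → t :* ((s :* (a :* b)) :* (w :* z)) := a :* ((s :* b) :* ((t :* w) :* z)))
           refl (ι (2 ℕ.* suc n)) (sg k) a b (w (suc n)) z ⟩
    a * ((sg k * b) * ((ι (2 ℕ.* suc n) * w (suc n)) * z))
      ≈⟨ *-congˡ (*-congˡ (*-congʳ (w-suc n))) ⟩
    a * ((sg k * b) * (w n * z)) ∎
    where
    z = v (e ∸ k) * w k
    b = B (a + ι 2) n

  -- For g_m, a + 2n is m₁ minus the exponent 2k of x. It extends the rising product at the top, and
  -- a is then split off at the bottom.
  coef-odd : ∀ a e n k → (a + ι (2 ℕ.* n)) * coef a e n k ≈ a * coef (a + ι 2) e n k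
  coef-odd a e n k = begin
    (a + ι (2 ℕ.* n)) * ((sg k * B a n) * z)     ≈⟨ solve 4 (λ t s b z → t :* ((s :* b) :* z) := (s :* (b :* t)) :* z) refl (a + ι (2 ℕ.* n)) (sg k) (B a n) z ⟩
    (sg k * B a (suc n)) * z                     ≈⟨ *-congʳ (*-congˡ (B-suc a n)) ⟩
    (sg k * (a * b)) * z                         ≈⟨ solve 4 (λ s a b z → (s :* (a :* b)) :* z := a :* ((s :* b) :* z)) refl (sg k) a b z ⟩
    a * ((sg k * b) * z)                         ∎
    where
    z = w n * (v (e ∸ k) * w k)
    b = B (a + ι 2) n

  -- Once the common factors are removed this is a + (2n+2) = (a+2) + 2n.
  coef-pascal : ∀ a e n k → coef a e (suc n) k + coef (a + ι 2) e n k ≈ coef (a + ι 2) e (suc n) k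
  coef-pascal a e n k = begin
    (sg k * B a (suc n)) * (w (suc n) * z) + (sg k * b) * (w n * z)
      ≈⟨ +-cong (*-congʳ (*-congˡ (B-suc a n))) (*-congˡ (*-congʳ (trans (sym (w-suc n)) (*-congʳ (ι-2*suc n))))) ⟩
    (sg k * (a * b)) * (w (suc n) * z) + (sg k * b) * (((ι 2 + ι (2 ℕ.* n)) * w (suc n)) * z)
      ≈⟨ solve 7 (λ s a b w z t m → (s :* (a :* b)) :* (w :* z) :+ (s :* b) :* (((t :+ m) :* w) :* z) := (s :* (b :* ((a :+ t) :+ m))) :* (w :* z))
           refl (sg k) a b (w (suc n)) z (ι 2) (ι (2 ℕ.* n)) ⟩
    (sg k * (b * ((a + ι 2) + ι (2 ℕ.* n)))) * (w (suc n) * z) ∎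
    where
    z = v (e ∸ k) * w k
    b = B (a + ι 2) n

  -- At a = 2u+3 the rising product (2u+3)(2u+5)...(2(n+u)+1) consists of the top n factors of
  -- (2(n+u)+1)!!.
  B-v : ∀ u n → B (ι (suc (2 ℕ.* suc u))) n * v (n ℕ.+ u) ≈ v u
  B-v u zero    = *-identityˡ _
  B-v u (suc n) = begin
    (B a n * (a + ι (2 ℕ.* n))) * v (suc (n ℕ.+ u))                    ≈⟨ *-assoc _ _ _ ⟩
    B a n * ((a + ι (2 ℕ.* n)) * v (suc (n ℕ.+ u)))                    ≈⟨ *-congˡ (*-congʳ (trans (sym (ι-+ (suc (2 ℕ.* suc u)) (2 ℕ.* n))) (reflexive (≡.cong ι (arith n u))))) ⟩
    B a n * (ι (suc (2 ℕ.* suc (n ℕ.+ u))) * v (suc (n ℕ.+ u)))        ≈⟨ *-congˡ (v-suc (n ℕ.+ u)) ⟩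
    B a n * v (n ℕ.+ u)                                                ≈⟨ B-v u n ⟩
    v u                                                                ∎
    where
    a = ι (suc (2 ℕ.* suc u))
    arith : ∀ n u → suc (2 ℕ.* suc u) ℕ.+ 2 ℕ.* n ≡ suc (2 ℕ.* suc (n ℕ.+ u))
    arith = ℕ-solve-∀

  -- Up to the factor 1/(2n+2k)!!, the coefficient of t^k in (1 - t)^(n+k).
  binom : ℕ → ℕ → Carrier
  binom n k = sg k * (w n * w k)

  -- The value a = 2u+3 is the one that the invariant a + 2(p+q) = 2e+5 imposes when one of p, q is
  -- zero and the other is e - u + 1.
  coef-binom : ∀ u n k e → e ∸ k ≡ n ℕ.+ u → coef (ι (suc (2 ℕ.* suc u))) e n k ≈ v u * binom n k
  coef-binom u n k e eq rewrite eq = begin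
    (sg k * b) * (w n * (v (n ℕ.+ u) * w k))     ≈⟨ solve 5 (λ s b x y z → (s :* b) :* (x :* (y :* z)) := (b :* y) :* (s :* (x :* z))) refl (sg k) b (w n) (v (n ℕ.+ u)) (w k) ⟩
    (b * v (n ℕ.+ u)) * (sg k * (w n * w k))     ≈⟨ *-congʳ (B-v u n) ⟩
    v u * (sg k * (w n * w k))                   ∎
    where b = B (ι (suc (2 ℕ.* suc u))) n

  binom-sucˡ : ∀ n k → ι (2 ℕ.* suc n) * binom (suc n) k ≈ binom n k
  binom-sucˡ n k = trans (solve 4 (λ t s x y → t :* (s :* (x :* y)) := s :* ((t :* x) :* y)) refl (ι (2 ℕ.* suc n)) (sg k) (w (suc n)) (w k))
    (*-congˡ (*-congʳ (w-suc n)))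

  binom-sucʳ : ∀ n k → ι (2 ℕ.* suc k) * binom n (suc k) ≈ - 1# * binom n k
  binom-sucʳ n k = trans (solve 4 (λ t s x y → t :* ((:- s) :* (x :* y)) := :- (s :* (x :* (t :* y)))) refl (ι (2 ℕ.* suc k)) (sg k) (w n) (w (suc k)))
    (trans (-‿cong (*-congˡ (*-congˡ (w-suc k)))) (sym (-1*x≈-x _)))
    where open Algebra.Properties.Ring ring using (-1*x≈-x)

-- The sums f_m and g_m as families in a, e and the number of terms.

module Families {c ℓ} (K : CharZeroField c ℓ) where
  open PolynomialRing K
  open LinearForms K
  open Scalars K

  sumₚ-cong : ∀ n {F G} → (∀ k → k < n → F k ≈ₚ G k) → sumₚ n F ≈ₚ sumₚ n G
  sumₚ-cong zero    e i j = refl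
  sumₚ-cong (suc n) e i j = +-cong (sumₚ-cong n (λ k k<n → e k (ℕₚ.m<n⇒m<1+n k<n)) i j) (e n ℕₚ.≤-refl i j)

  sumₚ-+ : ∀ n F G → (sumₚ n F +ₚ sumₚ n G) ≈ₚ sumₚ n (λ k → F k +ₚ G k)
  sumₚ-+ zero    F G i j = +-identityʳ 0#
  sumₚ-+ (suc n) F G i j = trans
    (solve 4 (λ a b c d → (a :+ b) :+ (c :+ d) := (a :+ c) :+ (b :+ d)) refl (sumₚ n F i j) (F n i j) (sumₚ n G i j) (G n i j))
    (+-congʳ (sumₚ-+ n F G i j))
    where open KSolver

  sumₚ-* : ∀ n Z F → (Z *ₚ sumₚ n F) ≈ₚ sumₚ n (λ k → Z *ₚ F k)
  sumₚ-* zero    Z F     = P.zeroʳ Z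
  sumₚ-* (suc n) Z F i j = trans (P.distribˡ Z (sumₚ n F) (F n) i j) (+-congʳ (sumₚ-* n Z F i j))

  E-sumₚ : ∀ n F → E (sumₚ n F) ≈ₚ sumₚ n (E ∘ F)
  E-sumₚ zero    F i j = zeroʳ _
  E-sumₚ (suc n) F i j = trans (distribˡ _ _ _) (+-congʳ (E-sumₚ n F i j))

  sumₚ-head : ∀ n F → sumₚ (suc n) F ≈ₚ (F 0 +ₚ sumₚ n (F ∘ suc))
  sumₚ-head zero    F i j = +-comm _ _
  sumₚ-head (suc n) F i j = trans (+-congʳ (sumₚ-head n F i j)) (+-assoc _ _ _)

  ∸-suc : ∀ {k p} → k < p → p ∸ k ≡ suc (p ∸ suc k)
  ∸-suc {k} {p} = ℕₚ.+-∸-assoc 1 {p} {suc k}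

  -- With μ = mono or its flip, this treats g_m and f_m at once.
  module Family (μ : Carrier → ℕ → ℕ → Pol)
    (μ-cong : ∀ {k k′} i j → k ≈ k′ → μ k i j ≈ₚ μ k′ i j)
    (μ-+ : ∀ k k′ i j → μ (k + k′) i j ≈ₚ (μ k i j +ₚ μ k′ i j))
    (μ-* : ∀ z k i j → μ (z * k) i j ≈ₚ (C z *ₚ μ k i j)) where

    term : Carrier → ℕ → ℕ → ℕ → Pol
    term a e p k = μ (coef a e (p ∸ suc k) k) (2 ℕ.* k) (suc (2 ℕ.* (e ∸ k)))

    T : Carrier → ℕ → ℕ → Pol
    T a e p = sumₚ p (term a e p)

    T-cong : ∀ {a a′} e p → a ≈ a′ → T a e p ≈ₚ T a′ e p
    T-cong e p a≈ = sumₚ-cong p λ k _ → μ-cong _ _ (coef-cong e (p ∸ suc k) k a≈)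

    T-pascal : ∀ a e p → (T a e (suc p) +ₚ T (a + ι 2) e p) ≈ₚ T (a + ι 2) e (suc p)
    T-pascal a e p i j = begin
      (sumₚ p f i j + f p i j) + sumₚ p h i j            ≈⟨ solve 3 (λ x y z → (x :+ y) :+ z := (x :+ z) :+ y) refl (sumₚ p f i j) (f p i j) (sumₚ p h i j) ⟩
      (sumₚ p f i j + sumₚ p h i j) + f p i j            ≈⟨ +-cong (trans (sumₚ-+ p f h i j) (sumₚ-cong p f+h≈g i j)) (last i j) ⟩
      sumₚ p g i j + g p i j                             ∎
      where
      open K-Reasoning
      open KSolver
      f = term a e (suc p)
      g = term (a + ι 2) e (suc p)
      h = term (a + ι 2) e p
      -- With no later terms the rising product is empty, so the last coefficient does not depend on
      -- `a`.
      last : f p ≈ₚ g p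
      last rewrite ℕₚ.n∸n≡0 p = λ _ _ → refl
      f+h≈g : ∀ k → k < p → (f k +ₚ h k) ≈ₚ g k
      f+h≈g k k<p rewrite ∸-suc k<p = λ i j →
        trans (sym (μ-+ _ _ _ _ i j)) (μ-cong _ _ (coef-pascal a e (p ∸ suc k) k) i j)

    -- The version for f_m. The last term has x-exponent exactly m₁, so x ∂x - m₁ kills it and one
    -- term fewer remains.
    T-even : (∀ k i j → E (μ k i j) ≈ₚ μ (ι j * k) i j) → ∀ a e p → p ≤ e →
      E (T a e (suc p)) ≈ₚ ((C (ι (suc (2 ℕ.* (e ∸ p)))) *ₚ T a e (suc p)) +ₚ (C a *ₚ T (a + ι 2) e p))
    T-even E-μ a e p p≤e i j = begin
      ι i * (sumₚ p f i j + f p i j)                                             ≈⟨ distribˡ _ _ _ ⟩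
      E (sumₚ p f) i j + E (f p) i j                                             ≈⟨ +-cong (E-sumₚ p f i j) (last i j) ⟩
      sumₚ p (E ∘ f) i j + (C m *ₚ f p) i j                                      ≈⟨ +-congʳ (sumₚ-cong p terms i j) ⟩
      sumₚ p (λ k → (C m *ₚ f k) +ₚ (C a *ₚ h k)) i j + (C m *ₚ f p) i j         ≈⟨ +-congʳ (sumₚ-+ p (λ k → C m *ₚ f k) (λ k → C a *ₚ h k) i j) ⟨
      (sumₚ p (λ k → C m *ₚ f k) i j + sumₚ p (λ k → C a *ₚ h k) i j) + (C m *ₚ f p) i j
                                                                                 ≈⟨ +-congʳ (+-cong (sumₚ-* p (C m) f i j) (sumₚ-* p (C a) h i j)) ⟨
      ((C m *ₚ sumₚ p f) i j + (C a *ₚ sumₚ p h) i j) + (C m *ₚ f p) i j         ≈⟨ solve 3 (λ x y z → (x :+ y) :+ z := (x :+ z) :+ y) refl _ _ _ ⟩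
      ((C m *ₚ sumₚ p f) i j + (C m *ₚ f p) i j) + (C a *ₚ sumₚ p h) i j         ≈⟨ +-congʳ (P.distribˡ (C m) (sumₚ p f) (f p) i j) ⟨
      (C m *ₚ (sumₚ p f +ₚ f p)) i j + (C a *ₚ sumₚ p h) i j                     ∎
      where
      open K-Reasoning
      open KSolver
      m = ι (suc (2 ℕ.* (e ∸ p)))
      f = term a e (suc p)
      h = term (a + ι 2) e p
      last : E (f p) ≈ₚ (C m *ₚ f p)
      last i j = trans (E-μ _ _ _ i j) (μ-* _ _ _ _ i j)
      module _ (k : ℕ) (k<p : k < p) where
        n = p ∸ suc k
        exponent : suc (2 ℕ.* (e ∸ k)) ≡ suc (2 ℕ.* (e ∸ p)) ℕ.+ 2 ℕ.* suc n
        exponent = ≡.cong suc (≡.trans (≡.cong (2 ℕ.*_) (≡.trans (≡.cong (_∸ k) (≡.sym (ℕₚ.m∸n+n≡m p≤e)))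
          (≡.trans (ℕₚ.+-∸-assoc (e ∸ p) (ℕₚ.<⇒≤ k<p)) (≡.cong (e ∸ p ℕ.+_) (∸-suc k<p))))) (ℕₚ.*-distribˡ-+ 2 (e ∸ p) (suc n)))
        scalar : ι (suc (2 ℕ.* (e ∸ k))) * coef a e (suc n) k ≈ m * coef a e (suc n) k + a * coef (a + ι 2) e n k
        scalar = begin
          ι (suc (2 ℕ.* (e ∸ k))) * coef a e (suc n) k                         ≈⟨ *-congʳ (trans (reflexive (≡.cong ι exponent)) (ι-+ (suc (2 ℕ.* (e ∸ p))) (2 ℕ.* suc n))) ⟩
          (m + ι (2 ℕ.* suc n)) * coef a e (suc n) k                           ≈⟨ distribʳ _ _ _ ⟩
          m * coef a e (suc n) k + ι (2 ℕ.* suc n) * coef a e (suc n) k        ≈⟨ +-congˡ (coef-even a e n k) ⟩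
          m * coef a e (suc n) k + a * coef (a + ι 2) e n k                    ∎
      terms : ∀ k → k < p → E (f k) ≈ₚ ((C m *ₚ f k) +ₚ (C a *ₚ h k))
      terms k k<p rewrite ∸-suc k<p = λ i j → trans (E-μ _ _ _ i j) (trans (μ-cong _ _ (scalar k k<p) i j)
        (trans (μ-+ _ _ _ _ i j) (+-cong (μ-* _ _ _ _ i j) (μ-* _ _ _ _ i j))))

    -- The version for g_m. No term is killed, and x ∂x - m₁ yields the opposite sign from the one
    -- for f_m; this is why the sign between the two families flips.
    T-odd : (∀ k i j → E (μ k i j) ≈ₚ μ (ι i * k) i j) → ∀ a m e q → a + ι (2 ℕ.* q) ≈ m →
      (E (T a e (suc q)) +ₚ (C a *ₚ T (a + ι 2) e (suc q))) ≈ₚ (C m *ₚ T a e (suc q))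
    T-odd E-μ a m e q a+2q i j = begin
      E (sumₚ (suc q) f) i j + (C a *ₚ sumₚ (suc q) h) i j                ≈⟨ +-cong (E-sumₚ (suc q) f i j) (sumₚ-* (suc q) (C a) h i j) ⟩
      sumₚ (suc q) (E ∘ f) i j + sumₚ (suc q) (λ k → C a *ₚ h k) i j      ≈⟨ sumₚ-+ (suc q) (E ∘ f) (λ k → C a *ₚ h k) i j ⟩
      sumₚ (suc q) (λ k → E (f k) +ₚ (C a *ₚ h k)) i j                    ≈⟨ sumₚ-cong (suc q) terms i j ⟩
      sumₚ (suc q) (λ k → C m *ₚ f k) i j                                 ≈⟨ sumₚ-* (suc q) (C m) f i j ⟨
      (C m *ₚ sumₚ (suc q) f) i j                                         ∎
      where
      open K-Reasoning
      open KSolver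
      f = term a e (suc q)
      h = term (a + ι 2) e (suc q)
      scalar : ∀ k → k ≤ q → ι (2 ℕ.* k) * coef a e (q ∸ k) k + a * coef (a + ι 2) e (q ∸ k) k ≈ m * coef a e (q ∸ k) k
      scalar k k≤q = begin
        ι (2 ℕ.* k) * x + a * coef (a + ι 2) e n k        ≈⟨ +-congˡ (coef-odd a e n k) ⟨
        ι (2 ℕ.* k) * x + (a + ι (2 ℕ.* n)) * x           ≈⟨ solve 4 (λ k x a n → k :* x :+ (a :+ n) :* x := (a :+ (n :+ k)) :* x) refl (ι (2 ℕ.* k)) x a (ι (2 ℕ.* n)) ⟩
        (a + (ι (2 ℕ.* n) + ι (2 ℕ.* k))) * x             ≈⟨ *-congʳ (+-congˡ (ι-+ (2 ℕ.* n) (2 ℕ.* k))) ⟨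
        (a + ι (2 ℕ.* n ℕ.+ 2 ℕ.* k)) * x                 ≈⟨ *-congʳ (trans (+-congˡ (reflexive (≡.cong ι
                                                               (≡.trans (≡.sym (ℕₚ.*-distribˡ-+ 2 n k)) (≡.cong (2 ℕ.*_) (ℕₚ.m∸n+n≡m k≤q)))))) a+2q) ⟩
        m * x                                             ∎
        where
        n = q ∸ k
        x = coef a e n k
      terms : ∀ k → k < suc q → (E (f k) +ₚ (C a *ₚ h k)) ≈ₚ (C m *ₚ f k)
      terms k k<1+q i j = trans (+-cong (E-μ _ _ _ i j) (sym (μ-* _ _ _ _ i j)))
        (trans (sym (μ-+ _ _ _ _ i j)) (trans (μ-cong _ _ (scalar k (ℕₚ.≤-pred k<1+q)) i j) (μ-* _ _ _ _ i j)))

    module Binomial (Z₁ Z₂ : Pol)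
      (Z₁-μ : ∀ k i j → (Z₁ *ₚ μ k i j) ≈ₚ μ k (suc i) j)
      (Z₂-μ : ∀ k i j → (Z₂ *ₚ μ k i j) ≈ₚ μ k i (suc j)) where

      row : ℕ → ℕ → ℕ → Pol
      row u n k = μ (binom (n ∸ k) k) (2 ℕ.* k) (suc (2 ℕ.* ((n ∸ k) ℕ.+ u)))

      -- This is Z₂^(2u+1) (Z₂² - Z₁²)^n / (2n)!!, written out by the binomial theorem.
      power : ℕ → ℕ → Pol
      power u n = sumₚ (suc n) (row u n)

      T≈power : ∀ u n → T (ι (suc (2 ℕ.* suc u))) (n ℕ.+ u) (suc n) ≈ₚ (C (v u) *ₚ power u n)
      T≈power u n i j = trans (sumₚ-cong (suc n) (λ k k<1+n → terms k (ℕₚ.≤-pred k<1+n)) i j) (sym (sumₚ-* (suc n) (C (v u)) (row u n) i j))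
        where
        terms : ∀ k → k ≤ n → term (ι (suc (2 ℕ.* suc u))) (n ℕ.+ u) (suc n) k ≈ₚ (C (v u) *ₚ row u n k)
        terms k k≤n i j = trans (μ-cong _ _ (coef-binom u (n ∸ k) k (n ℕ.+ u) (ℕₚ.+-∸-comm u k≤n)) i j)
          (trans (μ-* _ _ _ _ i j) (P.*-cong {C (v u)} {C (v u)} (P.refl {C (v u)})
            (λ i j → reflexive (≡.cong (λ x → μ (binom (n ∸ k) k) (2 ℕ.* k) (suc (2 ℕ.* x)) i j) (ℕₚ.+-∸-comm u k≤n))) i j))

      Z₁²-μ : ∀ k i j → ((Z₁ *ₚ Z₁) *ₚ μ k i j) ≈ₚ μ k (suc (suc i)) j
      Z₁²-μ k i j a b = trans (P.*-assoc Z₁ Z₁ (μ k i j) a b)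
        (trans (P.*-cong {Z₁} {Z₁} (P.refl {Z₁}) (Z₁-μ k i j) a b) (Z₁-μ k (suc i) j a b))

      Z₂²-μ : ∀ k i j → ((Z₂ *ₚ Z₂) *ₚ μ k i j) ≈ₚ μ k i (suc (suc j))
      Z₂²-μ k i j a b = trans (P.*-assoc Z₂ Z₂ (μ k i j) a b)
        (trans (P.*-cong {Z₂} {Z₂} (P.refl {Z₂}) (Z₂-μ k i j) a b) (Z₂-μ k i (suc j) a b))

      μ-zero : ∀ {k} i j → k ≈ 0# → μ k i j ≈ₚ 0ₚ
      μ-zero {k} i j k≈0 a b = trans (μ-cong i j (trans k≈0 (sym (zeroˡ k))) a b)
        (trans (μ-* 0# k i j a b) (trans (C-* 0# (μ k i j) a b) (zeroˡ _)))

      -- In the k-th term 2(n+1) = 2(n+1-k) + 2k. Each summand cancels the top factor of one of the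
      -- two double factorials, which gives the two products on the right.
      power-suc : ∀ u n → (C (ι (2 ℕ.* suc n)) *ₚ power u (suc n)) ≈ₚ
                          (((Z₂ *ₚ Z₂) *ₚ power u n) -ₚ ((Z₁ *ₚ Z₁) *ₚ power u n))
      power-suc u n i j = begin
        (C N *ₚ power u (suc n)) i j                             ≈⟨ sumₚ-* (suc (suc n)) (C N) (row u (suc n)) i j ⟩
        sumₚ (suc (suc n)) (λ k → C N *ₚ row u (suc n) k) i j    ≈⟨ sumₚ-cong (suc (suc n)) split i j ⟩
        sumₚ (suc (suc n)) (λ k → f k +ₚ g k) i j                ≈⟨ sumₚ-+ (suc (suc n)) f g i j ⟨
        sumₚ (suc (suc n)) f i j + sumₚ (suc (suc n)) g i j      ≈⟨ +-cong (trans (+-congˡ (f-last i j)) (+-identityʳ _))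
                                                                      (trans (sumₚ-head (suc n) g i j) (trans (+-congʳ (g-head i j)) (+-identityˡ _))) ⟩
        sumₚ (suc n) f i j + sumₚ (suc n) (g ∘ suc) i j          ≈⟨ +-cong (sumₚ-cong (suc n) f-terms i j) (sumₚ-cong (suc n) g-terms i j) ⟩
        sumₚ (suc n) (λ k → (Z₂ *ₚ Z₂) *ₚ row u n k) i j + sumₚ (suc n) (λ k → C (- 1#) *ₚ ((Z₁ *ₚ Z₁) *ₚ row u n k)) i j
                                                                 ≈⟨ +-cong (sumₚ-* (suc n) (Z₂ *ₚ Z₂) (row u n) i j)
                                                                      (trans (P.*-cong {C (- 1#)} {C (- 1#)} (P.refl {C (- 1#)}) (sumₚ-* (suc n) (Z₁ *ₚ Z₁) (row u n)) i j)
                                                                             (sumₚ-* (suc n) (C (- 1#)) (λ k → (Z₁ *ₚ Z₁) *ₚ row u n k) i j)) ⟨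
        ((Z₂ *ₚ Z₂) *ₚ power u n) i j + (C (- 1#) *ₚ ((Z₁ *ₚ Z₁) *ₚ power u n)) i j
                                                                 ≈⟨ +-congˡ (trans (C-* (- 1#) ((Z₁ *ₚ Z₁) *ₚ power u n) i j) (-1*x≈-x _)) ⟩
        ((Z₂ *ₚ Z₂) *ₚ power u n) i j - ((Z₁ *ₚ Z₁) *ₚ power u n) i j ∎
        where
        open K-Reasoning
        open Algebra.Properties.Ring ring using (-1*x≈-x)
        N = ι (2 ℕ.* suc n)
        x = λ k → binom (suc n ∸ k) k
        f g : ℕ → Pol
        f k = μ (ι (2 ℕ.* (suc n ∸ k)) * x k) (2 ℕ.* k) (suc (2 ℕ.* ((suc n ∸ k) ℕ.+ u)))
        g k = μ (ι (2 ℕ.* k) * x k) (2 ℕ.* k) (suc (2 ℕ.* ((suc n ∸ k) ℕ.+ u)))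
        split : ∀ k → k < suc (suc n) → (C N *ₚ row u (suc n) k) ≈ₚ (f k +ₚ g k)
        split k k<2+n i j = trans (sym (μ-* N (x k) _ _ i j)) (trans (μ-cong _ _ (trans (*-congʳ (trans (reflexive (≡.cong ι
          (≡.trans (≡.cong (2 ℕ.*_) (≡.sym (ℕₚ.m∸n+n≡m (ℕₚ.≤-pred k<2+n)))) (ℕₚ.*-distribˡ-+ 2 (suc n ∸ k) k))))
          (ι-+ (2 ℕ.* (suc n ∸ k)) (2 ℕ.* k)))) (distribʳ _ _ _)) i j) (μ-+ _ _ _ _ i j))
        f-last : f (suc n) ≈ₚ 0ₚ
        f-last = μ-zero _ _ (trans (*-congʳ (reflexive (≡.cong (λ z → ι (2 ℕ.* z)) (ℕₚ.n∸n≡0 n)))) (zeroˡ _))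
        g-head : g 0 ≈ₚ 0ₚ
        g-head = μ-zero _ _ (zeroˡ _)
        f-terms : ∀ k → k < suc n → f k ≈ₚ ((Z₂ *ₚ Z₂) *ₚ row u n k)
        f-terms k k<1+n rewrite ∸-suc k<1+n | 2*suc ((n ∸ k) ℕ.+ u) = λ i j →
          trans (μ-cong _ _ (binom-sucˡ (n ∸ k) k) i j) (sym (Z₂²-μ _ _ _ i j))
        g-terms : ∀ k → k < suc n → g (suc k) ≈ₚ (C (- 1#) *ₚ ((Z₁ *ₚ Z₁) *ₚ row u n k))
        g-terms k _ i j = trans (μ-cong _ _ (binom-sucʳ (n ∸ k) k) i j) (trans (μ-* _ _ _ _ i j)
          (P.*-cong {C (- 1#)} {C (- 1#)} (P.refl {C (- 1#)})
            (λ i j → trans (reflexive (≡.cong (λ z → μ (binom (n ∸ k) k) z (suc (2 ℕ.* ((n ∸ k) ℕ.+ u))) i j) (2*suc k))) (sym (Z₁²-μ _ _ _ i j))) i j))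

      power-∣ : ∀ {L} → L ∣ ((Z₂ *ₚ Z₂) -ₚ (Z₁ *ₚ Z₁)) → ∀ u n → (L ^ n) ∣ power u n
      power-∣ L∣ u zero = power u 0 , P.sym {1ₚ *ₚ power u 0} {power u 0} (P.*-identityˡ (power u 0))
      power-∣ {L} (z , Z≈) u (suc n) with power-∣ {L} (z , Z≈) u n
      ... | q , power≈ = coprime-unit {L ^ suc n} (inverseˡ (ι≉0 (2 ℕ.* suc n))) (power u (suc n)) (z *ₚ q , (begin
        C (ι (2 ℕ.* suc n)) *ₚ power u (suc n)                             ≈⟨ power-suc u n ⟩
        ((Z₂ *ₚ Z₂) *ₚ power u n) -ₚ ((Z₁ *ₚ Z₁) *ₚ power u n)             ≈⟨ solve 3 (λ x y p → x :* p :- y :* p := (x :- y) :* p) (λ _ _ → refl) (Z₂ *ₚ Z₂) (Z₁ *ₚ Z₁) (power u n) ⟩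
        ((Z₂ *ₚ Z₂) -ₚ (Z₁ *ₚ Z₁)) *ₚ power u n                            ≈⟨ P.*-cong {(Z₂ *ₚ Z₂) -ₚ (Z₁ *ₚ Z₁)} {L *ₚ z} Z≈ power≈ ⟩
        (L *ₚ z) *ₚ ((L ^ n) *ₚ q)                                         ≈⟨ solve 4 (λ l z p q → (l :* z) :* (p :* q) := (l :* p) :* (z :* q)) (λ _ _ → refl) L z (L ^ n) q ⟩
        (L ^ suc n) *ₚ (z *ₚ q)                                            ∎))
        where
        open P-Reasoning
        open PSolver

-- Divisibility of θ_m(x + s y) by (x + s y)^m₃.

module Contact {c ℓ} (K : CharZeroField c ℓ) where
  open PolynomialRing K
  open LinearForms K
  open Scalars K
  open Families K
  open Algebra.Properties.Semiring.Mult P.semiring using () renaming (_×_ to _⋆_)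
  private
    module FF = Family (λ k i j → mono k j i) (λ i j → mono-cong j i) (λ k k′ i j → mono-+ k k′ j i) (λ z k i j → mono-* z k j i)
    module GG = Family mono mono-cong mono-+ mono-*
    module FB = FF.Binomial Y X (λ k i j → Y-mono k j i) (λ k i j → X-mono k j i)
    module GB = GG.Binomial X Y X-mono Y-mono

  F G : Carrier → ℕ → ℕ → Pol
  F = FF.T
  G = GG.T

  -- θ_m (x + s y) for ρ = - s (-1)^m₃.
  H : Carrier → Carrier → ℕ → ℕ → ℕ → Pol
  H ρ a e p q = F a e p +ₚ (C ρ *ₚ G a e q)

  H-at : ∀ ρ a e p q i j → H ρ a e p q i j ≈ F a e p i j + ρ * G a e q i j
  H-at ρ a e p q i j = +-congˡ (C-* ρ (G a e q) i j)

  H-cong : ∀ {ρ ρ′ a a′} e p q → ρ ≈ ρ′ → a ≈ a′ → H ρ a e p q ≈ₚ H ρ′ a′ e p q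
  H-cong {ρ} {ρ′} {a} {a′} e p q ρ≈ a≈ i j = trans (H-at ρ a e p q i j)
    (trans (+-cong (FF.T-cong e p a≈ i j) (*-cong ρ≈ (GG.T-cong e q a≈ i j))) (sym (H-at ρ′ a′ e p q i j)))

  -- By `T-pascal` the difference of the two f-parts is `F` at a, and that of the two g-parts is `G`
  -- at a up to sign. The sign of `ρ` flips because m₃ drops by one.
  H-pascal : ∀ ρ a e p q → H ρ a e (suc p) (suc q) ≈ₚ (H (- ρ) (a + ι 2) e (suc p) q -ₚ H (- ρ) (a + ι 2) e p (suc q))
  H-pascal ρ a e p q i j = begin
    H ρ a e (suc p) (suc q) i j                        ≈⟨ H-at ρ a e (suc p) (suc q) i j ⟩
    F a e (suc p) i j + ρ * G a e (suc q) i j          ≈⟨ solve 5 (λ f f′ g g′ ρ → f :+ ρ :* g := ((f :+ f′) :+ (:- ρ) :* g′) :- (f′ :+ (:- ρ) :* (g :+ g′))) refl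
                                                            (F a e (suc p) i j) (F a′ e p i j) (G a e (suc q) i j) (G a′ e q i j) ρ ⟩
    ((F a e (suc p) i j + F a′ e p i j) + (- ρ) * G a′ e q i j) - (F a′ e p i j + (- ρ) * (G a e (suc q) i j + G a′ e q i j))
                                                       ≈⟨ +-cong (+-congʳ (FF.T-pascal a e p i j)) (-‿cong (+-congˡ (*-congˡ (GG.T-pascal a e q i j)))) ⟩
    (F a′ e (suc p) i j + (- ρ) * G a′ e q i j) - (F a′ e p i j + (- ρ) * G a′ e (suc q) i j)
                                                       ≈⟨ +-cong (H-at (- ρ) a′ e (suc p) q i j) (-‿cong (H-at (- ρ) a′ e p (suc q) i j)) ⟨
    H (- ρ) a′ e (suc p) q i j - H (- ρ) a′ e p (suc q) i j ∎
    where
    open K-Reasoning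
    open KSolver
    a′ = a + ι 2

  H-euler : ∀ ρ a e p q → p ≤ e → a + ι (2 ℕ.* q) ≈ ι (suc (2 ℕ.* (e ∸ p))) →
    (E (H ρ a e (suc p) (suc q)) -ₚ (C (ι (suc (2 ℕ.* (e ∸ p)))) *ₚ H ρ a e (suc p) (suc q))) ≈ₚ
    (C a *ₚ H (- ρ) (a + ι 2) e p (suc q))
  H-euler ρ a e p q p≤e a+2q i j = begin
    ι i * H ρ a e (suc p) (suc q) i j - (C m *ₚ H ρ a e (suc p) (suc q)) i j
      ≈⟨ +-cong (*-congˡ (H-at ρ a e (suc p) (suc q) i j)) (-‿cong (trans (C-* m (H ρ a e (suc p) (suc q)) i j) (*-congˡ (H-at ρ a e (suc p) (suc q) i j)))) ⟩
    ι i * (f + ρ * g) - m * (f + ρ * g)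
      ≈⟨ solve 7 (λ n f ρ g m a g′ → n :* (f :+ ρ :* g) :- m :* (f :+ ρ :* g) :=
            (n :* f :- m :* f) :+ ρ :* (((n :* g :+ a :* g′) :- m :* g) :- a :* g′)) refl (ι i) f ρ g m a g′ ⟩
    (ι i * f - m * f) + ρ * (((ι i * g + a * g′) - m * g) - a * g′)
      ≈⟨ +-cong (+-congʳ Ef) (*-congˡ (+-congʳ (+-congʳ Eg))) ⟩
    ((m * f + a * f′) - m * f) + ρ * ((m * g - m * g) - a * g′)
      ≈⟨ solve 7 (λ f ρ g m a f′ g′ → ((m :* f :+ a :* f′) :- m :* f) :+ ρ :* ((m :* g :- m :* g) :- a :* g′) :=
            a :* (f′ :+ (:- ρ) :* g′)) refl f ρ g m a f′ g′ ⟩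
    a * (f′ + (- ρ) * g′)
      ≈⟨ *-congˡ (H-at (- ρ) (a + ι 2) e p (suc q) i j) ⟨
    a * H (- ρ) (a + ι 2) e p (suc q) i j
      ≈⟨ C-* a (H (- ρ) (a + ι 2) e p (suc q)) i j ⟨
    (C a *ₚ H (- ρ) (a + ι 2) e p (suc q)) i j ∎
    where
    open K-Reasoning
    open KSolver
    m = ι (suc (2 ℕ.* (e ∸ p)))
    f = F a e (suc p) i j
    g = G a e (suc q) i j
    f′ = F (a + ι 2) e p i j
    g′ = G (a + ι 2) e (suc q) i j
    Ef : ι i * f ≈ m * f + a * f′
    Ef = trans (FF.T-even (λ k i j → E-mono k j i) a e p p≤e i j) (+-cong (C-* m (F a e (suc p)) i j) (C-* a (F (a + ι 2) e p) i j))
    Eg : ι i * g + a * g′ ≈ m * g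
    Eg = trans (+-congˡ (sym (C-* a (G (a + ι 2) e (suc q)) i j)))
      (trans (GG.T-odd E-mono a m e q a+2q i j) (C-* m (G a e (suc q)) i j))

  ⋆≈C : ∀ n → (n ⋆ 1ₚ) ≈ₚ C (ι n)
  ⋆≈C zero    i j = sym (mono-zero 0 0 i j)
  ⋆≈C (suc n) i j = trans (+-congˡ (⋆≈C n i j)) (sym (mono-+ 1# (ι n) 0 0 i j))

  C-unit : ∀ {k} → k ≈ 1# → ∀ a → (C k *ₚ a) ≈ₚ a
  C-unit k≈1 a i j = trans (C-* _ a i j) (trans (*-congʳ k≈1) (*-identityˡ _))

  module _ (s : Carrier) (s²≈1 : s * s ≈ 1#) where
    private
      L : Pol
      L = Lin s

    Lin-∣-X²-Y² : L ∣ ((X *ₚ X) -ₚ (Y *ₚ Y))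
    Lin-∣-X²-Y² = X -ₚ (C s *ₚ Y) , (begin
      (X *ₚ X) -ₚ (Y *ₚ Y)                                   ≈⟨ P.+-congˡ {X *ₚ X} { -ₚ (Y *ₚ Y)} { -ₚ ((C s *ₚ C s) *ₚ (Y *ₚ Y))} (P.-‿cong {Y *ₚ Y} {(C s *ₚ C s) *ₚ (Y *ₚ Y)}
                                                                  (λ i j → sym (trans (P.*-congʳ {Y *ₚ Y} {C s *ₚ C s} {C (s * s)} (λ i j → sym (mono-* s s 0 0 i j)) i j) (C-unit s²≈1 (Y *ₚ Y) i j)))) ⟩
      (X *ₚ X) -ₚ ((C s *ₚ C s) *ₚ (Y *ₚ Y))                 ≈⟨ solve 3 (λ x y s → x :* x :- (s :* s) :* (y :* y) := (x :+ s :* y) :* (x :- s :* y)) (λ _ _ → refl) X Y (C s) ⟩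
      L *ₚ (X -ₚ (C s *ₚ Y))                                 ∎)
      where
      open P-Reasoning
      open PSolver

    Lin-∣-Y²-X² : L ∣ ((Y *ₚ Y) -ₚ (X *ₚ X))
    Lin-∣-Y²-X² = ∣-swap {L} (X *ₚ X) (Y *ₚ Y) Lin-∣-X²-Y²

    -- Replacing x² by y² changes x^(2e+3) y^j by a multiple of x² - y², hence of L. The extra
    -- factor y^j is there so that the induction can collect these powers of y.
    odd-powers-∣ : ∀ κ e j → L ∣ (mono κ (suc (2 ℕ.* e)) j +ₚ (C s *ₚ mono κ 0 (suc (2 ℕ.* e) ℕ.+ j)))
    odd-powers-∣ κ zero j = mono κ 0 j , λ a b → begin
      mono κ 1 j a b + (C s *ₚ mono κ 0 (suc j)) a b             ≈⟨ +-cong (X-mono κ 0 j a b) (P.*-congˡ {C s} {Y *ₚ mono κ 0 j} {mono κ 0 (suc j)} (Y-mono κ 0 j) a b) ⟨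
      (X *ₚ mono κ 0 j) a b + (C s *ₚ (Y *ₚ mono κ 0 j)) a b     ≈⟨ +-congˡ (P.*-assoc (C s) Y (mono κ 0 j) a b) ⟨
      (X *ₚ mono κ 0 j) a b + ((C s *ₚ Y) *ₚ mono κ 0 j) a b     ≈⟨ P.distribʳ (mono κ 0 j) X (C s *ₚ Y) a b ⟨
      (L *ₚ mono κ 0 j) a b                                      ∎
      where open K-Reasoning
    odd-powers-∣ κ (suc e) j = ∣-resp {L} {L} {(M *ₚ ((X *ₚ X) -ₚ (Y *ₚ Y))) +ₚ (M′ +ₚ N)} {mono κ (suc (2 ℕ.* suc e)) j +ₚ (C s *ₚ mono κ 0 (suc (2 ℕ.* suc e) ℕ.+ j))}
        (P.refl {L}) identity
        (∣-+ {L} {M *ₚ ((X *ₚ X) -ₚ (Y *ₚ Y))} {M′ +ₚ N} (∣-* {L} {(X *ₚ X) -ₚ (Y *ₚ Y)} M Lin-∣-X²-Y²) (odd-powers-∣ κ e (suc (suc j))))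
      where
      open K-Reasoning
      M M′ N : Pol
      M = mono κ (suc (2 ℕ.* e)) j
      M′ = mono κ (suc (2 ℕ.* e)) (suc (suc j))
      N = C s *ₚ mono κ 0 (suc (2 ℕ.* e) ℕ.+ suc (suc j))
      exponent : ∀ e j → suc (2 ℕ.* e) ℕ.+ suc (suc j) ≡ suc (2 ℕ.* suc e) ℕ.+ j
      exponent = ℕ-solve-∀
      identity : ((M *ₚ ((X *ₚ X) -ₚ (Y *ₚ Y))) +ₚ (M′ +ₚ N)) ≈ₚ (mono κ (suc (2 ℕ.* suc e)) j +ₚ (C s *ₚ mono κ 0 (suc (2 ℕ.* suc e) ℕ.+ j)))
      identity a b = begin
        (M *ₚ ((X *ₚ X) -ₚ (Y *ₚ Y))) a b + (M′ a b + N a b)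
          ≈⟨ +-congʳ (PSolver.solve 3 (λ m x y → m :* (x :* x :- y :* y) := x :* (x :* m) :- y :* (y :* m)) (λ _ _ → refl) M X Y a b) ⟩
        ((X *ₚ (X *ₚ M)) a b - (Y *ₚ (Y *ₚ M)) a b) + (M′ a b + N a b)
          ≈⟨ +-congʳ (+-cong (trans (P.*-congˡ {X} {X *ₚ M} {mono κ (suc (suc (2 ℕ.* e))) j} (X-mono κ (suc (2 ℕ.* e)) j) a b) (X-mono κ (suc (suc (2 ℕ.* e))) j a b))
                     (-‿cong (trans (P.*-congˡ {Y} {Y *ₚ M} {mono κ (suc (2 ℕ.* e)) (suc j)} (Y-mono κ (suc (2 ℕ.* e)) j) a b) (Y-mono κ (suc (2 ℕ.* e)) (suc j) a b)))) ⟩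
        (mono κ (suc (suc (suc (2 ℕ.* e)))) j a b - M′ a b) + (M′ a b + N a b)
          ≈⟨ KSolver.solve 3 (λ x y z → (x KSolver.:- y) KSolver.:+ (y KSolver.:+ z) KSolver.:= x KSolver.:+ z) refl _ (M′ a b) (N a b) ⟩
        mono κ (suc (suc (suc (2 ℕ.* e)))) j a b + N a b
          ≈⟨ +-cong (reflexive (≡.cong (λ z → mono κ (suc z) j a b) (≡.sym (2*suc e)))) (reflexive (≡.cong (λ z → (C s *ₚ mono κ 0 z) a b) (exponent e j))) ⟩
        mono κ (suc (2 ℕ.* suc e)) j a b + (C s *ₚ mono κ 0 (suc (2 ℕ.* suc e) ℕ.+ j)) a b ∎
        where open PSolver using (_:=_; _:*_; _:-_)

    private
      -- The derivative criterion for x ∂x: E L = x is coprime to L because s is invertible, and the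
      -- exponent is invertible in characteristic zero.
      L-raise : ∀ n {h m} → (L ^ suc n) ∣ h → (L ^ suc n) ∣ (E h -ₚ (m *ₚ h)) → (L ^ suc (suc n)) ∣ h
      L-raise n {h} {m} = DerivativeCriterion.^-∣-raise polRing E (λ p i j → *-congˡ (p i j)) {L} {X} (E-Lin s) n {h} {m}
        (cancellable-Lin s) (coprime-Lin-X s²≈1)
        (λ t d → coprime-unit {L} (inverseˡ (ι≉0 (suc n))) t
          (∣-resp {L} {L} {(suc n ⋆ 1ₚ) *ₚ t} {C (ι (suc n)) *ₚ t} (P.refl {L}) (P.*-congʳ {t} {suc n ⋆ 1ₚ} {C (ι (suc n))} (⋆≈C (suc n))) d))

    -- The equation for `a` is invariant under the recursion, which keeps e, raises a by 2 and
    -- lowers p + q by 1. With p + q = m₃ + 1 the exponent is m₃. The bounds on p and q ensure that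
    -- no e ∸ k is truncated.
    H-∣ : ∀ p q e a → p ≤ suc e → q ≤ suc e → 0 < p ℕ.+ q → a + ι (2 ℕ.* (p ℕ.+ q)) ≈ ι (2 ℕ.* e ℕ.+ 5) →
      (L ^ (p ℕ.+ q ∸ 1)) ∣ H (s * sg (p ℕ.+ q)) a e p q

    private
      a-binom : ∀ n e a → n ≤ e → a + ι (2 ℕ.* suc n) ≈ ι (2 ℕ.* e ℕ.+ 5) → a ≈ ι (suc (2 ℕ.* suc (e ∸ n)))
      a-binom n e a n≤e a≈ = begin
        a                                                                  ≈⟨ solve 2 (λ a x → a := (a :+ x) :- x) refl a (ι (2 ℕ.* suc n)) ⟩
        (a + ι (2 ℕ.* suc n)) - ι (2 ℕ.* suc n)                            ≈⟨ +-congʳ (trans a≈ (trans (reflexive (≡.cong ι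
                                                                                (≡.trans (≡.cong (λ z → 2 ℕ.* z ℕ.+ 5) (≡.sym (ℕₚ.m∸n+n≡m n≤e))) (arith (e ∸ n) n))))
                                                                                (ι-+ (suc (2 ℕ.* suc (e ∸ n))) (2 ℕ.* suc n)))) ⟩
        (ι (suc (2 ℕ.* suc (e ∸ n))) + ι (2 ℕ.* suc n)) - ι (2 ℕ.* suc n)  ≈⟨ solve 2 (λ a x → a := (a :+ x) :- x) refl _ (ι (2 ℕ.* suc n)) ⟨
        ι (suc (2 ℕ.* suc (e ∸ n)))                                        ∎
        where
        open K-Reasoning
        open KSolver
        arith : ∀ u n → 2 ℕ.* (u ℕ.+ n) ℕ.+ 5 ≡ suc (2 ℕ.* suc u) ℕ.+ 2 ℕ.* suc n
        arith = ℕ-solve-∀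

      F-∣ : ∀ n e a → n ≤ e → a + ι (2 ℕ.* suc n) ≈ ι (2 ℕ.* e ℕ.+ 5) → (L ^ n) ∣ F a e (suc n)
      F-∣ n e a n≤e a≈ = ∣-resp {L ^ n} {L ^ n} {C (v u) *ₚ FB.power u n} {F a e (suc n)} (P.refl {L ^ n})
        (λ i j → sym (trans (FF.T-cong e (suc n) (a-binom n e a n≤e a≈) i j)
          (trans (reflexive (≡.cong (λ z → F (ι (suc (2 ℕ.* suc u))) z (suc n) i j) (≡.sym (ℕₚ.m+[n∸m]≡n n≤e)))) (FB.T≈power u n i j))))
        (∣-* {L ^ n} {FB.power u n} (C (v u)) (FB.power-∣ {L} Lin-∣-X²-Y² u n))
        where u = e ∸ n

      G-∣ : ∀ n e a → n ≤ e → a + ι (2 ℕ.* suc n) ≈ ι (2 ℕ.* e ℕ.+ 5) → (L ^ n) ∣ G a e (suc n)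
      G-∣ n e a n≤e a≈ = ∣-resp {L ^ n} {L ^ n} {C (v u) *ₚ GB.power u n} {G a e (suc n)} (P.refl {L ^ n})
        (λ i j → sym (trans (GG.T-cong e (suc n) (a-binom n e a n≤e a≈) i j)
          (trans (reflexive (≡.cong (λ z → G (ι (suc (2 ℕ.* suc u))) z (suc n) i j) (≡.sym (ℕₚ.m+[n∸m]≡n n≤e)))) (GB.T≈power u n i j))))
        (∣-* {L ^ n} {GB.power u n} (C (v u)) (GB.power-∣ {L} Lin-∣-Y²-X² u n))
        where u = e ∸ n

      next-a : ∀ a e r → a + ι (2 ℕ.* suc r) ≈ ι (2 ℕ.* e ℕ.+ 5) → (a + ι 2) + ι (2 ℕ.* r) ≈ ι (2 ℕ.* e ℕ.+ 5)
      next-a a e r a≈ = trans (trans (+-assoc _ _ _) (+-congˡ (sym (ι-2*suc r)))) a≈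

      -- The exponent known in advance is n + 1 > 0. At exponent 0 the derivative of L^0 u gives no
      -- information on u, so p = q = 0, which stands for h(1,1), must be excluded here.
      H-step : ∀ p q n e a → p ℕ.+ q ≡ suc n → suc p ≤ suc e → a + ι (2 ℕ.* (suc p ℕ.+ suc q)) ≈ ι (2 ℕ.* e ℕ.+ 5) →
        (L ^ (p ℕ.+ q)) ∣ H (s * sg (suc p ℕ.+ q)) (a + ι 2) e (suc p) q →
        (L ^ (p ℕ.+ suc q ∸ 1)) ∣ H (s * sg (p ℕ.+ suc q)) (a + ι 2) e p (suc q) →
        (L ^ (p ℕ.+ suc q)) ∣ H (s * sg (suc p ℕ.+ suc q)) a e (suc p) (suc q)
      H-step p q n e a p+q≡ (s≤s p≤e) a≈ d₁ d₂ rewrite ℕₚ.+-suc p q | p+q≡ =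
        L-raise n {h} {C m}
          (∣-resp {L ^ suc n} {L ^ suc n} {H (- ρ) a′ e (suc p) q -ₚ H (- ρ) a′ e p (suc q)} {h} (P.refl {L ^ suc n})
            (λ i j → sym (H-pascal ρ a e p q i j))
            (∣-- {L ^ suc n} {H (- ρ) a′ e (suc p) q} {H (- ρ) a′ e p (suc q)} d₁′ d₂′))
          (∣-resp {L ^ suc n} {L ^ suc n} {C a *ₚ H (- ρ) a′ e p (suc q)} {E h -ₚ (C m *ₚ h)} (P.refl {L ^ suc n})
            (λ i j → sym (H-euler ρ a e p q p≤e a+2q i j))
            (∣-* {L ^ suc n} {H (- ρ) a′ e p (suc q)} (C a) d₂′))
        where
        open K-Reasoning
        open KSolver
        m = ι (suc (2 ℕ.* (e ∸ p)))
        a′ = a + ι 2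
        ρ = s * sg (suc (suc (suc n)))
        h = H ρ a e (suc p) (suc q)
        flip-sign : s * sg (suc (suc n)) ≈ - ρ
        flip-sign = solve 2 (λ s x → s :* x := :- (s :* (:- x))) refl s (sg (suc (suc n)))
        d₁′ : (L ^ suc n) ∣ H (- ρ) a′ e (suc p) q
        d₁′ = ∣-resp {L ^ suc n} {L ^ suc n} {H (s * sg (suc (suc n))) a′ e (suc p) q} {H (- ρ) a′ e (suc p) q} (P.refl {L ^ suc n}) (H-cong e (suc p) q flip-sign refl) d₁
        d₂′ : (L ^ suc n) ∣ H (- ρ) a′ e p (suc q)
        d₂′ = ∣-resp {L ^ suc n} {L ^ suc n} {H (s * sg (suc (suc n))) a′ e p (suc q)} {H (- ρ) a′ e p (suc q)} (P.refl {L ^ suc n}) (H-cong e p (suc q) flip-sign refl) d₂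
        arith : ∀ u p → 2 ℕ.* (u ℕ.+ p) ℕ.+ 5 ≡ suc (2 ℕ.* u) ℕ.+ (2 ℕ.* p ℕ.+ 4)
        arith = ℕ-solve-∀
        arith′ : ∀ p q → 2 ℕ.* suc (suc (p ℕ.+ q)) ≡ 2 ℕ.* q ℕ.+ (2 ℕ.* p ℕ.+ 4)
        arith′ = ℕ-solve-∀
        a+2q : a + ι (2 ℕ.* q) ≈ m
        a+2q = begin
          a + ι (2 ℕ.* q)                                        ≈⟨ solve 3 (λ a q r → a :+ q := (a :+ (q :+ r)) :- r) refl a (ι (2 ℕ.* q)) r ⟩
          (a + (ι (2 ℕ.* q) + r)) - r                            ≈⟨ +-congʳ (+-congˡ (ι-+ (2 ℕ.* q) (2 ℕ.* p ℕ.+ 4))) ⟨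
          (a + ι (2 ℕ.* q ℕ.+ (2 ℕ.* p ℕ.+ 4))) - r              ≈⟨ +-congʳ (+-congˡ (reflexive (≡.cong ι (≡.trans (≡.sym (arith′ p q)) (≡.cong (λ z → 2 ℕ.* suc (suc z)) p+q≡))))) ⟩
          (a + ι (2 ℕ.* suc (suc (suc n)))) - r                  ≈⟨ +-congʳ a≈ ⟩
          ι (2 ℕ.* e ℕ.+ 5) - r                                  ≈⟨ +-congʳ (reflexive (≡.cong ι (≡.trans (≡.cong (λ z → 2 ℕ.* z ℕ.+ 5) (≡.sym (ℕₚ.m∸n+n≡m p≤e))) (arith (e ∸ p) p)))) ⟩
          ι (suc (2 ℕ.* (e ∸ p)) ℕ.+ (2 ℕ.* p ℕ.+ 4)) - r        ≈⟨ +-congʳ (ι-+ (suc (2 ℕ.* (e ∸ p))) (2 ℕ.* p ℕ.+ 4)) ⟩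
          (m + r) - r                                            ≈⟨ solve 2 (λ m r → (m :+ r) :- r := m) refl m r ⟩
          m                                                      ∎
          where r = ι (2 ℕ.* p ℕ.+ 4)

    H-∣ zero zero e a _ _ () _
    H-∣ zero (suc n) e a _ (s≤s n≤e) _ a≈ = ∣-+ {L ^ n} {0ₚ} {C ρ *ₚ G a e (suc n)}
      (0ₚ , P.sym {(L ^ n) *ₚ 0ₚ} {0ₚ} (P.zeroʳ (L ^ n))) (∣-* {L ^ n} {G a e (suc n)} (C ρ) (G-∣ n e a n≤e a≈))
      where ρ = s * sg (suc n)
    H-∣ (suc n) zero e a (s≤s n≤e) _ _ a≈ = ≡.subst (λ z → (L ^ z) ∣ H (s * sg (suc z)) a e (suc n) 0) (≡.sym (ℕₚ.+-identityʳ n))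
      (∣-+ {L ^ n} {F a e (suc n)} {C ρ *ₚ 0ₚ}
        (F-∣ n e a n≤e (≡.subst (λ z → a + ι (2 ℕ.* suc z) ≈ ι (2 ℕ.* e ℕ.+ 5)) (ℕₚ.+-identityʳ n) a≈))
        (∣-* {L ^ n} {0ₚ} (C ρ) (0ₚ , P.sym {(L ^ n) *ₚ 0ₚ} {0ₚ} (P.zeroʳ (L ^ n)))))
      where ρ = s * sg (suc n)
    -- Both families reduce to their first term with the same coefficient `κ`, and the sign is
    -- `sg 2` = 1, so this is κ (x^d + s y^d) with d odd.
    H-∣ (suc zero) (suc zero) e a _ _ _ _ = ∣-resp {L} {L ^ 1} {mono κ (suc (2 ℕ.* e)) 0 +ₚ (C s *ₚ mono κ 0 (suc (2 ℕ.* e) ℕ.+ 0))} {H (s * sg 2) a e 1 1}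
      (P.sym {L *ₚ 1ₚ} {L} (P.*-identityʳ L))
      (λ i j → trans (+-cong (sym (+-identityˡ _)) (trans (C-* s (mono κ 0 (suc (2 ℕ.* e) ℕ.+ 0)) i j)
        (*-congˡ (trans (reflexive (≡.cong (λ z → mono κ 0 z i j) (ℕₚ.+-identityʳ (suc (2 ℕ.* e))))) (sym (+-identityˡ _))))))
        (sym (trans (H-at (s * sg 2) a e 1 1 i j) (+-congˡ (*-congʳ s-sg2)))))
      (odd-powers-∣ κ e 0)
      where
      open KSolver
      κ = coef a e 0 0
      s-sg2 : s * - (- 1#) ≈ s
      s-sg2 = trans (solve 2 (λ s o → s :* (:- (:- o)) := s :* o) refl s 1#) (*-identityʳ s)
    H-∣ (suc (suc p)) (suc q) e a p≤ q≤ _ a≈ = H-step (suc p) q (p ℕ.+ q) e a ≡.refl p≤ a≈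
      (H-∣ (suc (suc p)) q e (a + ι 2) p≤ (ℕₚ.≤-trans (ℕₚ.n≤1+n q) q≤) (s≤s z≤n) (next-a a e (suc (suc (p ℕ.+ q)))
        (≡.subst (λ z → a + ι (2 ℕ.* suc (suc z)) ≈ ι (2 ℕ.* e ℕ.+ 5)) (ℕₚ.+-suc p q) a≈)))
      (H-∣ (suc p) (suc q) e (a + ι 2) (ℕₚ.≤-trans (ℕₚ.n≤1+n (suc p)) p≤) q≤ (s≤s z≤n) (next-a a e (suc p ℕ.+ suc q) a≈))
    H-∣ (suc zero) (suc (suc q)) e a p≤ q≤ _ a≈ = H-step 0 (suc q) q e a ≡.refl p≤ a≈
      (H-∣ 1 (suc q) e (a + ι 2) p≤ (ℕₚ.≤-trans (ℕₚ.n≤1+n (suc q)) q≤) (s≤s z≤n) (next-a a e (suc (suc q)) a≈))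
      (H-∣ 0 (suc (suc q)) e (a + ι 2) z≤n q≤ (s≤s z≤n) (next-a a e (suc (suc q)) a≈))

-- Membership in D(m) and Saito's criterion for the arrangement.

module SaitoCriterion {c ℓ} (K : CharZeroField c ℓ) where
  open PolynomialRing K
  open LinearForms K
  open Scalars K

  IsPoly-resp : ∀ {a b} → a ≈ₚ b → IsPoly a → IsPoly b
  IsPoly-resp e (N , van) = N , λ i j N≤ → trans (sym (e i j)) (van i j N≤)

  IsPoly-+ : ∀ {a b} → IsPoly a → IsPoly b → IsPoly (a +ₚ b)
  IsPoly-+ (M , vanᵃ) (N , vanᵇ) = M ℕ.+ N , λ i j le →
    trans (+-cong (vanᵃ i j (ℕₚ.≤-trans (ℕₚ.m≤m+n M N) le)) (vanᵇ i j (ℕₚ.≤-trans (ℕₚ.m≤n+m N M) le))) (+-identityʳ 0#)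

  IsPoly-neg : ∀ {a} → IsPoly a → IsPoly (-ₚ a)
  IsPoly-neg (M , van) = M , λ i j le → trans (-‿cong (van i j le)) -0#≈0#

  IsPoly-C* : ∀ k {a} → IsPoly a → IsPoly (C k *ₚ a)
  IsPoly-C* k {a} (M , van) = M , λ i j le → trans (C-* k a i j) (trans (*-congˡ (van i j le)) (zeroʳ k))

  IsPoly-* : ∀ {a b} → IsPoly a → IsPoly b → IsPoly (a *ₚ b)
  IsPoly-* {a} {b} (M , vanᵃ) (N , vanᵇ) = M ℕ.+ N , *-vanish {M ≤_} {N ≤_} {M ℕ.+ N ≤_} {a} {b} split vanᵃ vanᵇ
    where
    split : ∀ m n → M ℕ.+ N ≤ m ℕ.+ n → M ≤ m ⊎ N ≤ n
    split m n le with M ℕ.≤? m | N ℕ.≤? n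
    ... | yes M≤m | _       = inj₁ M≤m
    ... | no _    | yes N≤n = inj₂ N≤n
    ... | no M≰m  | no N≰n  = contradiction le (ℕₚ.<⇒≱ (ℕₚ.+-mono-< (ℕₚ.≰⇒> M≰m) (ℕₚ.≰⇒> N≰n)))

  IsPoly-det : ∀ {θ θ′} → IsDer θ → IsDer θ′ → IsPoly (det θ θ′)
  IsPoly-det {f , g} {f′ , g′} (pf , pg) (pf′ , pg′) = IsPoly-+ {f *ₚ g′} { -ₚ (g *ₚ f′)} (IsPoly-* {f} {g′} pf pg′) (IsPoly-neg {g *ₚ f′} (IsPoly-* {g} {f′} pg pf′))

  Homog-* : ∀ {k l a b} → Homog k a → Homog l b → Homog (k ℕ.+ l) (a *ₚ b)
  Homog-* {k} {l} {a} {b} ha hb = *-vanish {_≢ k} {_≢ l} {_≢ k ℕ.+ l} {a} {b} split ha hb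
    where
    split : ∀ m n → m ℕ.+ n ≢ k ℕ.+ l → m ≢ k ⊎ n ≢ l
    split m n ne with m ℕ.≟ k
    ... | no m≢k     = inj₁ m≢k
    ... | yes ≡.refl = inj₂ λ n≡l → ne (≡.cong (m ℕ.+_) n≡l)

  Homog-det : ∀ {k l θ θ′} → HomogDer k θ → HomogDer l θ′ → Homog (k ℕ.+ l) (det θ θ′)
  Homog-det {θ = f , g} {θ′ = f′ , g′} (hf , hg) (hf′ , hg′) i j ne =
    trans (+-cong (Homog-* {a = f} {b = g′} hf hg′ i j ne) (-‿cong (Homog-* {a = g} {b = f′} hg hf′ i j ne))) (-‿inverseʳ 0#)

  quotient-IsPoly : ∀ {u t} → LowersDegree u → ∀ n → IsPoly ((u ^ n) *ₚ t) → IsPoly t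
  quotient-IsPoly {u} {t} lu n (N , van) = N , λ i j N≤ → lowers-^ {u} lu n (N ≤_) t van i j (ℕₚ.≤-trans N≤ (ℕₚ.m≤n+m _ n))

  ^ₚ≡^ : ∀ u n → u ^ₚ n ≡ u ^ n
  ^ₚ≡^ u zero    = ≡.refl
  ^ₚ≡^ u (suc n) = ≡.cong (u *ₚ_) (^ₚ≡^ u n)

  ∂x-X : ∂x X ≈ₚ C 1#
  ∂x-X zero    j = trans (*-congʳ (+-identityʳ 1#)) (*-identityˡ _)
  ∂x-X (suc i) j = zeroʳ _

  ∂y-X : ∂y X ≈ₚ C 0#
  ∂y-X i j = trans (trans (*-congˡ (mono-off 1# 1 0 i (suc j) (inj₂ λ ()))) (zeroʳ _)) (sym (mono-zero 0 0 i j))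

  ∂x-Y : ∂x Y ≈ₚ C 0#
  ∂x-Y i j = trans (zeroʳ _) (sym (mono-zero 0 0 i j))

  ∂y-Y : ∂y Y ≈ₚ C 1#
  ∂y-Y i       zero    = trans (*-congʳ (+-identityʳ 1#)) (*-identityˡ _)
  ∂y-Y zero    (suc j) = zeroʳ _
  ∂y-Y (suc i) (suc j) = zeroʳ _

  apply-linear : ∀ f g h {k l} → ∂x h ≈ₚ C k → ∂y h ≈ₚ C l → ∀ i j → apply (f , g) h i j ≈ k * f i j + l * g i j
  apply-linear f g h {k} {l} hx hy i j = +-cong (part f (∂x h) hx) (part g (∂y h) hy)
    where
    part : ∀ f ∂h {k} → ∂h ≈ₚ C k → (f *ₚ ∂h) i j ≈ k * f i j
    part f ∂h {k} e = trans (P.*-congˡ {f} {∂h} {C k} e i j) (trans (P.*-comm f (C k) i j) (C-* k f i j))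

  ∂-combination : ∀ (k l : Carrier) (n : ℕ) a b → ι n * a ≈ k → ι n * b ≈ l → ι n * (a - b) ≈ k - l
  ∂-combination k l n a b ea eb = trans (solve 3 (λ n a b → n :* (a :- b) := n :* a :- n :* b) refl (ι n) a b) (+-cong ea (-‿cong eb))
    where open KSolver

  C-sub : ∀ k l i j → C k i j - C l i j ≈ C (k - l) i j
  C-sub k l zero    zero    = refl
  C-sub k l zero    (suc j) = -‿inverseʳ 0#
  C-sub k l (suc i) j       = -‿inverseʳ 0#

  -- The α_i rewritten so that the last two are instances of `Lin`, to which the lemmas on
  -- divisibility apply.
  form : Fin 4 → Pol
  form 0F = X
  form 1F = Y
  form 2F = Lin (- 1#)
  form 3F = Lin 1#

  value : Der → Fin 4 → Pol
  value (f , g) 0F = f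
  value (f , g) 1F = g
  value (f , g) 2F = f +ₚ (C (- 1#) *ₚ g)
  value (f , g) 3F = f +ₚ (C 1# *ₚ g)

  α≈form : ∀ i → α i ≈ₚ form i
  α≈form 0F a b = refl
  α≈form 1F a b = refl
  α≈form 2F a b = +-congˡ (sym (trans (C-* (- 1#) Y a b) (-1*x≈-x _)))
    where open Algebra.Properties.Ring ring using (-1*x≈-x)
  α≈form 3F a b = +-congˡ (sym (trans (C-* 1# Y a b) (*-identityˡ _)))

  apply≈value : ∀ θ i → apply θ (α i) ≈ₚ value θ i
  apply≈value (f , g) 0F a b = trans (apply-linear f g X ∂x-X ∂y-X a b)
    (trans (+-cong (*-identityˡ _) (zeroˡ _)) (+-identityʳ _))
  apply≈value (f , g) 1F a b = trans (apply-linear f g Y ∂x-Y ∂y-Y a b)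
    (trans (+-cong (zeroˡ _) (*-identityˡ _)) (+-identityˡ _))
  apply≈value (f , g) 2F a b = trans (apply-linear f g (X -ₚ Y)
      (λ i j → trans (∂-combination _ _ (suc i) (X (suc i) j) (Y (suc i) j) (∂x-X i j) (∂x-Y i j)) (C-sub 1# 0# i j))
      (λ i j → trans (∂-combination _ _ (suc j) (X i (suc j)) (Y i (suc j)) (∂y-X i j) (∂y-Y i j)) (C-sub 0# 1# i j)) a b)
    (+-cong (trans (*-congʳ (trans (+-congˡ -0#≈0#) (+-identityʳ 1#))) (*-identityˡ _)) (trans (*-congʳ (+-identityˡ _)) (sym (C-* (- 1#) g a b))))
  apply≈value (f , g) 3F a b = trans (apply-linear f g (X +ₚ Y)
      (λ i j → trans (distribˡ _ _ _) (trans (+-cong (∂x-X i j) (∂x-Y i j)) (sym (mono-+ 1# 0# 0 0 i j))))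
      (λ i j → trans (distribˡ _ _ _) (trans (+-cong (∂y-X i j) (∂y-Y i j)) (sym (mono-+ 0# 1# 0 0 i j)))) a b)
    (+-cong (trans (*-congʳ (+-identityʳ 1#)) (*-identityˡ _)) (trans (*-congʳ (+-identityˡ _)) (sym (C-* 1# g a b))))

  form-lowers : ∀ i → LowersDegree (form i)
  form-lowers 0F = X-lowers
  form-lowers 1F = Y-lowers
  form-lowers 2F = Lin-lowers (- 1#)
  form-lowers 3F = Lin-lowers 1#

  value-IsPoly : ∀ θ → IsDer θ → ∀ i → IsPoly (value θ i)
  value-IsPoly (f , g) (pf , pg) 0F = pf
  value-IsPoly (f , g) (pf , pg) 1F = pg
  value-IsPoly (f , g) (pf , pg) 2F = IsPoly-+ {f} {C (- 1#) *ₚ g} pf (IsPoly-C* (- 1#) {g} pg)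
  value-IsPoly (f , g) (pf , pg) 3F = IsPoly-+ {f} {C 1# *ₚ g} pf (IsPoly-C* 1# {g} pg)

  α^≈form^ : ∀ i n → (α i ^ₚ n) ≈ₚ (form i ^ n)
  α^≈form^ i n a b = trans (reflexive (≡.cong (λ z → z a b) (^ₚ≡^ (α i) n))) (^-congˡ n {α i} {form i} (α≈form i) a b)

  ∈D⇒∣ : ∀ θ m → θ ∈D m → ∀ i → (form i ^ m i) ∣ value θ i
  ∈D⇒∣ θ m (_ , div) i with div i
  ... | q , _ , e = ∣-resp {α i ^ₚ m i} {form i ^ m i} {apply θ (α i)} {value θ i} (α^≈form^ i (m i)) (apply≈value θ i) (q , e)

  ∣⇒∈D : ∀ θ m → IsDer θ → (∀ i → (form i ^ m i) ∣ value θ i) → θ ∈D m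
  ∣⇒∈D θ m der div = der , λ i →
    let q , e = div i in
    q , quotient-IsPoly {form i} {q} (form-lowers i) (m i) (IsPoly-resp {value θ i} {(form i ^ m i) *ₚ q} e (value-IsPoly θ der i)) ,
    λ a b → trans (apply≈value θ i a b) (trans (e a b) (sym (P.*-congʳ {q} {α i ^ₚ m i} {form i ^ m i} (α^≈form^ i (m i)) a b)))

  1·1 : 1# * 1# ≈ 1#
  1·1 = *-identityˡ 1#

  -1·-1 : - 1# * - 1# ≈ 1#
  -1·-1 = trans (solve 1 (λ o → (:- o) :* (:- o) := o :* o) refl 1#) 1·1
    where open KSolver

  module _ (m : Fin 4 → ℕ) where
    private
      power : Fin 4 → Pol
      power i = form i ^ m i

    Q : Pol
    Q = ((power 0F *ₚ power 1F) *ₚ power 2F) *ₚ power 3F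

    power-cancellable : ∀ i → Cancellable (power i)
    power-cancellable i = ^-cancellable {form i} (m i) (lowers⇒cancellable {form i} (form-lowers i))

    Q-cancellable : Cancellable Q
    Q-cancellable = *-cancellable {(power 0F *ₚ power 1F) *ₚ power 2F} {power 3F}
      (*-cancellable {power 0F *ₚ power 1F} {power 2F}
        (*-cancellable {power 0F} {power 1F} (power-cancellable 0F) (power-cancellable 1F)) (power-cancellable 2F))
      (power-cancellable 3F)

    Q-* : ∀ t → (Q *ₚ t) ≈ₚ (power 0F *ₚ (power 1F *ₚ (power 2F *ₚ (power 3F *ₚ t))))
    Q-* t = solve 5 (λ a b c d t → (((a :* b) :* c) :* d) :* t := a :* (b :* (c :* (d :* t)))) (λ _ _ → refl)
      (power 0F) (power 1F) (power 2F) (power 3F) t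
      where open PSolver

    Q-lowers : ∀ V t → Vanish V (Q *ₚ t) → Vanish (λ k → V (m 0F ℕ.+ (m 1F ℕ.+ (m 2F ℕ.+ (m 3F ℕ.+ k))))) t
    Q-lowers V t van =
      lowers-^ {form 3F} (form-lowers 3F) (m 3F) (λ k → V (m 0F ℕ.+ (m 1F ℕ.+ (m 2F ℕ.+ k)))) t
        (lowers-^ {form 2F} (form-lowers 2F) (m 2F) (λ k → V (m 0F ℕ.+ (m 1F ℕ.+ k))) (power 3F *ₚ t)
          (lowers-^ {form 1F} (form-lowers 1F) (m 1F) (λ k → V (m 0F ℕ.+ k)) (power 2F *ₚ (power 3F *ₚ t))
            (lowers-^ {form 0F} (form-lowers 0F) (m 0F) V (power 1F *ₚ (power 2F *ₚ (power 3F *ₚ t)))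
              (λ i j v → trans (sym (Q-* t i j)) (van i j v)))))

    powers-coprime : ∀ i j → Coprime (form i) (form j) → Coprime (power i) (power j)
    powers-coprime i j = coprime-^ {form i} {form j} (m i) (m j) (lowers⇒cancellable {form i} (form-lowers i))

    -- The forms are pairwise coprime and are adjoined one at a time; for x - y against x + y this
    -- rests on the invertibility of 2.
    Q-∣ : ∀ t → (∀ i → power i ∣ t) → Q ∣ t
    Q-∣ t div = coprime-product {(power 0F *ₚ power 1F) *ₚ power 2F} {power 3F} {t}
      (coprime-* {power 3F} {power 0F *ₚ power 1F} {power 2F}
        (coprime-* {power 3F} {power 0F} {power 1F}
          (powers-coprime 3F 0F (coprime-Lin-X 1·1)) (powers-coprime 3F 1F (coprime-Lin-Y 1#)))
        (powers-coprime 3F 2F (coprime-Lin-Lin 1·1 (inverseˡ (ι≉0 2)) (-‿inverseʳ 1#))))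
      (coprime-product {power 0F *ₚ power 1F} {power 2F} {t}
        (coprime-* {power 2F} {power 0F} {power 1F}
          (powers-coprime 2F 0F (coprime-Lin-X -1·-1)) (powers-coprime 2F 1F (coprime-Lin-Y (- 1#))))
        (coprime-product {power 0F} {power 1F} {t} (powers-coprime 1F 0F coprime-Y-X) (div 0F) (div 1F))
        (div 2F))
      (div 3F)

    -- For each i the determinant is a combination of the values of θ and θ′ at α_i, both multiples
    -- of α_i^m_i.
    det-divisible : ∀ θ θ′ → θ ∈D m → θ′ ∈D m → Q ∣ det θ θ′
    det-divisible θ@(f , g) θ′@(f′ , g′) θ∈ θ′∈ = Q-∣ (det θ θ′) divide
      where
      div = ∈D⇒∣ θ m θ∈
      div′ = ∈D⇒∣ θ′ m θ′∈
      divide : ∀ i → power i ∣ det θ θ′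
      divide 0F = ∣-- {power 0F} {f *ₚ g′} {g *ₚ f′}
        (∣-resp {power 0F} {power 0F} {g′ *ₚ f} {f *ₚ g′} (P.refl {power 0F}) (P.*-comm g′ f) (∣-* {power 0F} {f} g′ (div 0F)))
        (∣-* {power 0F} {f′} g (div′ 0F))
      divide 1F = ∣-- {power 1F} {f *ₚ g′} {g *ₚ f′} (∣-* {power 1F} {g′} f (div′ 1F))
        (∣-resp {power 1F} {power 1F} {f′ *ₚ g} {g *ₚ f′} (P.refl {power 1F}) (P.*-comm f′ g) (∣-* {power 1F} {g} f′ (div 1F)))
      divide 2F = det-∣ {power 2F} (C (- 1#)) {f} {g} {f′} {g′} (div 2F) (div′ 2F)
      divide 3F = det-∣ {power 3F} (C 1#) {f} {g} {f′} {g′} (div 3F) (div′ 3F)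

    -- By `degrees` the determinant has the degree of `Q`, so the quotient `r` is homogeneous of
    -- degree 0. It is a nonzero constant by `det≉0`, hence a unit.
    module _ {θ₁ θ₂ : Der} {d₁ d₂ : ℕ} (θ₁∈ : θ₁ ∈D m) (θ₂∈ : θ₂ ∈D m)
      (h₁ : HomogDer d₁ θ₁) (h₂ : HomogDer d₂ θ₂)
      (degrees : d₁ ℕ.+ d₂ ≡ m 0F ℕ.+ (m 1F ℕ.+ (m 2F ℕ.+ m 3F)))
      (det≉0 : ¬ (det θ₁ θ₂ ≈ₚ 0ₚ)) where
      private
        r : Pol
        r = proj₁ (det-divisible θ₁ θ₂ θ₁∈ θ₂∈)

        Qr : det θ₁ θ₂ ≈ₚ (Q *ₚ r)
        Qr = proj₂ (det-divisible θ₁ θ₂ θ₁∈ θ₂∈)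

        r-constant : Homog 0 r
        r-constant i j i+j≢0 = Q-lowers (_≢ d₁ ℕ.+ d₂) r
          (λ a b ne → trans (sym (Qr a b)) (Homog-det {θ = θ₁} {θ′ = θ₂} h₁ h₂ a b ne)) i j
          (λ eq → i+j≢0 (ℕₚ.+-cancelˡ-≡ (m 3F) _ 0 (ℕₚ.+-cancelˡ-≡ (m 2F) _ _ (ℕₚ.+-cancelˡ-≡ (m 1F) _ _
            (ℕₚ.+-cancelˡ-≡ (m 0F) _ _ (≡.trans eq (≡.trans degrees
              (≡.cong (λ z → m 0F ℕ.+ (m 1F ℕ.+ (m 2F ℕ.+ z))) (≡.sym (ℕₚ.+-identityʳ (m 3F)))))))))))

        r≈C : r ≈ₚ C (r 0 0)
        r≈C zero    zero    = refl
        r≈C zero    (suc j) = r-constant 0 (suc j) λ ()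
        r≈C (suc i) j       = r-constant (suc i) j λ ()

        r₀₀≉0 : ¬ (r 0 0 ≈ 0#)
        r₀₀≉0 r₀₀≈0 = det≉0 λ i j → trans (Qr i j) (trans
          (P.*-congˡ {Q} {r} {0ₚ} (λ a b → trans (r≈C a b) (trans (mono-cong 0 0 r₀₀≈0 a b) (mono-zero 0 0 a b))) i j) (P.zeroʳ Q i j))

        r⁻¹ : Pol
        r⁻¹ = C (r 0 0 ⁻¹)

        rr⁻¹ : (r *ₚ r⁻¹) ≈ₚ 1ₚ
        rr⁻¹ i j = trans (P.*-congʳ {r⁻¹} {r} {C (r 0 0)} r≈C i j)
          (trans (sym (mono-* (r 0 0) (r 0 0 ⁻¹) 0 0 i j)) (mono-cong 0 0 (inverseʳ _ r₀₀≉0) i j))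

        module S = Saito {θ₁} {θ₂} {Q} {r} {r⁻¹} Q-cancellable rr⁻¹ Qr

        quotient-isPoly : ∀ θ θ′ → IsDer θ → IsDer θ′ → ((q , _) : Q ∣ det θ θ′) → IsPoly q
        quotient-isPoly θ θ′ p p′ (q , e) =
          let N , van = IsPoly-resp {det θ θ′} {Q *ₚ q} e (IsPoly-det {θ} {θ′} p p′) in
          N , λ i j N≤ → Q-lowers (N ≤_) q van i j
            (ℕₚ.≤-trans N≤ (ℕₚ.≤-trans (ℕₚ.≤-trans (ℕₚ.≤-trans (ℕₚ.m≤n+m _ (m 3F)) (ℕₚ.m≤n+m _ (m 2F))) (ℕₚ.m≤n+m _ (m 1F))) (ℕₚ.m≤n+m _ (m 0F))))

      saito : IsBasis m θ₁ θ₂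
      saito = (θ₁∈ , θ₂∈ , generates) , λ p q _ _ (ef , eg) → S.independent p q ef eg
        where
        generates : ∀ θ → θ ∈D m → ∃ λ p → ∃ λ q → IsPoly p × IsPoly q × (θ ≈ᴰ ((p ·ᴰ θ₁) +ᴰ (q ·ᴰ θ₂)))
        generates θ θ∈ =
          let s = det-divisible θ θ₂ θ∈ θ₂∈
              t = det-divisible θ₁ θ θ₁∈ θ∈
          in r⁻¹ *ₚ proj₁ s , r⁻¹ *ₚ proj₁ t ,
             IsPoly-C* (r 0 0 ⁻¹) {proj₁ s} (quotient-isPoly θ θ₂ (proj₁ θ∈) (proj₁ θ₂∈) s) ,
             IsPoly-C* (r 0 0 ⁻¹) {proj₁ t} (quotient-isPoly θ₁ θ (proj₁ θ₁∈) (proj₁ θ∈) t) ,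
             S.generate {proj₁ θ} {proj₂ θ} s t

-- Homogeneity, orders of vanishing and leading coefficients.

module Leading {c ℓ} (K : CharZeroField c ℓ) where
  open PolynomialRing K
  open LinearForms K
  open Scalars K
  open Families K
  open Contact K

  sumₚ-at : ∀ n f i j → sumₚ n f i j ≡ sumTo n (λ k → f k i j)
  sumₚ-at zero    f i j = ≡.refl
  sumₚ-at (suc n) f i j = ≡.cong (_+ f n i j) (sumₚ-at n f i j)

  sumₚ-vanish : ∀ n {f i j} → (∀ k → k < n → f k i j ≈ 0#) → sumₚ n f i j ≈ 0#
  sumₚ-vanish n {f} {i} {j} e = trans (reflexive (sumₚ-at n f i j)) (sumTo-zero n e)

  sumₚ-single : ∀ n k₀ {f i j} → k₀ < n → (∀ k → k < n → k ≢ k₀ → f k i j ≈ 0#) → sumₚ n f i j ≈ f k₀ i j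
  sumₚ-single n k₀ {f} {i} {j} lt e = trans (reflexive (sumₚ-at n f i j)) (sumTo-single n k₀ lt e)

  2*-cancel : ∀ {m n} → 2 ℕ.* m ≡ 2 ℕ.* n → m ≡ n
  2*-cancel {m} {n} = ℕₚ.*-cancelˡ-≡ m n 2

  term-degree : ∀ {e k} → k ≤ e → suc (2 ℕ.* (e ∸ k)) ℕ.+ 2 ℕ.* k ≡ suc (2 ℕ.* e)
  term-degree {e} {k} k≤e = ≡.cong suc (≡.trans (≡.sym (ℕₚ.*-distribˡ-+ 2 (e ∸ k) k)) (≡.cong (2 ℕ.*_) (ℕₚ.m∸n+n≡m k≤e)))

  F-Homog : ∀ a e p → p ≤ suc e → Homog (suc (2 ℕ.* e)) (F a e p)
  F-Homog a e p p≤1+e i j ne = sumₚ-vanish p λ k k<p → mono-off _ _ _ i j (off k (ℕₚ.≤-pred (ℕₚ.≤-trans k<p p≤1+e)))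
    where
    off : ∀ k → k ≤ e → i ≢ suc (2 ℕ.* (e ∸ k)) ⊎ j ≢ 2 ℕ.* k
    off k k≤e with i ℕ.≟ suc (2 ℕ.* (e ∸ k))
    ... | no i≢      = inj₁ i≢
    ... | yes ≡.refl = inj₂ λ where ≡.refl → ne (term-degree k≤e)

  G-Homog : ∀ a e q → q ≤ suc e → Homog (suc (2 ℕ.* e)) (G a e q)
  G-Homog a e q q≤1+e i j ne = sumₚ-vanish q λ k k<q → mono-off _ _ _ i j (off k (ℕₚ.≤-pred (ℕₚ.≤-trans k<q q≤1+e)))
    where
    off : ∀ k → k ≤ e → i ≢ 2 ℕ.* k ⊎ j ≢ suc (2 ℕ.* (e ∸ k))
    off k k≤e with i ℕ.≟ 2 ℕ.* k
    ... | no i≢      = inj₁ i≢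
    ... | yes ≡.refl = inj₂ λ where ≡.refl → ne (≡.trans (ℕₚ.+-comm (2 ℕ.* k) _) (term-degree k≤e))

  exponent-bound : ∀ {r e p k} → r ℕ.+ p ≡ suc e → k < p → suc (2 ℕ.* r) ≤ suc (2 ℕ.* (e ∸ k))
  exponent-bound {r} {e} {p} {k} r+p k<p = s≤s (ℕₚ.*-monoʳ-≤ 2
    (ℕₚ.≤-trans (ℕₚ.m≤m+n r (p ∸ suc k)) (ℕₚ.≤-reflexive (≡.trans (≡.sym (ℕₚ.+-∸-assoc r k<p)) (≡.cong (_∸ suc k) r+p)))))

  F-order : ∀ a {r e p} → r ℕ.+ p ≡ suc e → ∀ i j → i < suc (2 ℕ.* r) → F a e p i j ≈ 0#
  F-order a {r} {e} {p} r+p i j i< = sumₚ-vanish p λ k k<p →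
    mono-off _ _ _ i j (inj₁ (ℕₚ.<⇒≢ (ℕₚ.<-≤-trans i< (exponent-bound {r} {e} {p} {k} r+p k<p))))

  G-order : ∀ a {r e q} → r ℕ.+ q ≡ suc e → ∀ i j → j < suc (2 ℕ.* r) → G a e q i j ≈ 0#
  G-order a {r} {e} {q} r+q i j j< = sumₚ-vanish q λ k k<q →
    mono-off _ _ _ i j (inj₂ (ℕₚ.<⇒≢ (ℕₚ.<-≤-trans j< (exponent-bound {r} {e} {q} {k} r+q k<q))))

  -- The number a may be negative, and the rising product then passes from negative to positive
  -- factors; for odd a it steps over zero.
  coef≉0 : ∀ {a} e n k → (∀ j → ¬ (a + ι (2 ℕ.* j) ≈ 0#)) → ¬ (coef a e n k ≈ 0#)
  coef≉0 e n k odd = *-≉0 (*-≉0 (sg≉0 k) (B≉0 n odd)) (*-≉0 (w≉0 n) (*-≉0 (v≉0 (e ∸ k)) (w≉0 k)))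

  module _ {a : Carrier} (odd : ∀ j → ¬ (a + ι (2 ℕ.* j) ≈ 0#)) where
    -- The last term, k = p, is the only one with y^(2p), and it carries the lowest power of x,
    -- which is x^m₁.
    F-lead : ∀ r p → ¬ (F a (r ℕ.+ p) (suc p) (suc (2 ℕ.* r)) (2 ℕ.* p) ≈ 0#)
    F-lead r p e = coef≉0 (r ℕ.+ p) (p ∸ p) p odd (begin
      coef a (r ℕ.+ p) (p ∸ p) p                                                                ≈⟨ mono-on _ (suc (2 ℕ.* r)) (2 ℕ.* p) ⟨
      mono (coef a (r ℕ.+ p) (p ∸ p) p) (suc (2 ℕ.* r)) (2 ℕ.* p) (suc (2 ℕ.* r)) (2 ℕ.* p)     ≡⟨ ≡.cong (λ z → mono (coef a (r ℕ.+ p) (p ∸ p) p) (suc (2 ℕ.* z)) (2 ℕ.* p) (suc (2 ℕ.* r)) (2 ℕ.* p)) (ℕₚ.m+n∸n≡m r p) ⟨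
      mono (coef a (r ℕ.+ p) (p ∸ p) p) (suc (2 ℕ.* (r ℕ.+ p ∸ p))) (2 ℕ.* p) (suc (2 ℕ.* r)) (2 ℕ.* p)
        ≈⟨ sumₚ-single (suc p) p {i = suc (2 ℕ.* r)} {j = 2 ℕ.* p} ℕₚ.≤-refl (λ k _ k≢p → mono-off (coef a (r ℕ.+ p) (p ∸ k) k) (suc (2 ℕ.* (r ℕ.+ p ∸ k))) (2 ℕ.* k) (suc (2 ℕ.* r)) (2 ℕ.* p) (inj₂ λ eq → k≢p (≡.sym (2*-cancel {p} {k} eq)))) ⟨
      F a (r ℕ.+ p) (suc p) (suc (2 ℕ.* r)) (2 ℕ.* p)                                           ≈⟨ e ⟩
      0#                                                                                        ∎)
      where open K-Reasoning

    -- Only the first term is free of x, and it is a multiple of y^d.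
    G-lead : ∀ e q → ¬ (G a e (suc q) 0 (suc (2 ℕ.* e)) ≈ 0#)
    G-lead e q eq = coef≉0 e q 0 odd (trans (sym (mono-on _ 0 (suc (2 ℕ.* e))))
      (trans (sym (sumₚ-single (suc q) 0 {i = 0} {j = suc (2 ℕ.* e)} (s≤s z≤n)
        (λ k _ k≢0 → mono-off (coef a e (q ∸ k) k) (2 ℕ.* k) (suc (2 ℕ.* (e ∸ k))) 0 (suc (2 ℕ.* e)) (inj₁ λ eq → k≢0 (≡.sym (2*-cancel {0} {k} eq)))))) eq))

  -- Since f has order at least m in x, the coefficient of x^m only sees the part of g free of x;
  -- homogeneity of f then leaves a single exponent of y.
  *-lead : ∀ {k m j₀ f g} j₁ → Homog k f → (∀ i j → i < m → f i j ≈ 0#) → m ℕ.+ j₀ ≡ k →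
    (f *ₚ g) m (j₀ ℕ.+ j₁) ≈ f m j₀ * g 0 j₁
  *-lead {k} {m} {j₀} {f} {g} j₁ hf low m+j₀ = begin
    (f *ₚ g) m (j₀ ℕ.+ j₁)
      ≈⟨ sumTo-single (suc m) m ℕₚ.≤-refl (λ i i≤m i≢m → sumTo-zero (suc (j₀ ℕ.+ j₁)) λ l _ →
           trans (*-congʳ (low i l (ℕₚ.≤∧≢⇒< (ℕₚ.≤-pred i≤m) i≢m))) (zeroˡ _)) ⟩
    sumTo (suc (j₀ ℕ.+ j₁)) (λ l → f m l * g (m ∸ m) (j₀ ℕ.+ j₁ ∸ l))
      ≈⟨ sumTo-single (suc (j₀ ℕ.+ j₁)) j₀ (s≤s (ℕₚ.m≤m+n j₀ j₁)) (λ l _ l≢j₀ →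
           trans (*-congʳ (hf m l λ m+l → l≢j₀ (ℕₚ.+-cancelˡ-≡ m l j₀ (≡.trans m+l (≡.sym m+j₀))))) (zeroˡ _)) ⟩
    f m j₀ * g (m ∸ m) (j₀ ℕ.+ j₁ ∸ j₀)
      ≡⟨ ≡.cong₂ (λ x y → f m j₀ * g x y) (ℕₚ.n∸n≡0 m) (ℕₚ.m+n∸m≡n j₀ j₁) ⟩
    f m j₀ * g 0 j₁ ∎
    where open K-Reasoning

  -- The coefficient of x^m y^(j₀+j₁) is inspected. The product g f′ does not contribute to it
  -- because f′ has order greater than m in x.
  det≉0 : ∀ {k m j₀ j₁ f g f′ g′} → Homog k f → (∀ i j → i < m → f i j ≈ 0#) → m ℕ.+ j₀ ≡ k → ¬ (f m j₀ ≈ 0#) →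
    (∀ i j → i < suc m → f′ i j ≈ 0#) → ¬ (g′ 0 j₁ ≈ 0#) → ¬ (det (f , g) (f′ , g′) ≈ₚ 0ₚ)
  det≉0 {k} {m} {j₀} {j₁} {f} {g} {f′} {g′} hf low m+j₀ f≉0 low′ g′≉0 e = *-≉0 f≉0 g′≉0 (begin
    f m j₀ * g′ 0 j₁                           ≈⟨ *-lead {f = f} {g = g′} j₁ hf low m+j₀ ⟨
    (f *ₚ g′) m J                              ≈⟨ +-identityʳ _ ⟨
    (f *ₚ g′) m J + 0#                         ≈⟨ +-congˡ -0#≈0# ⟨
    (f *ₚ g′) m J - 0#                         ≈⟨ +-congˡ (-‿cong gf′≈0) ⟨
    (f *ₚ g′) m J - (g *ₚ f′) m J              ≈⟨ e m J ⟩
    0#                                         ∎)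
    where
    open K-Reasoning
    J = j₀ ℕ.+ j₁
    gf′≈0 : (g *ₚ f′) m J ≈ 0#
    gf′≈0 = sumTo-zero (suc m) λ i _ → sumTo-zero (suc J) λ l _ →
      trans (*-congˡ (low′ (m ∸ i) (J ∸ l) (s≤s (ℕₚ.m∸n≤m m i)))) (zeroʳ _)

  det-antisym : ∀ θ θ′ → det θ θ′ ≈ₚ 0ₚ → det θ′ θ ≈ₚ 0ₚ
  det-antisym (f , g) (f′ , g′) e i j = trans
    (solve 4 (λ f g f′ g′ → f′ :* g :- g′ :* f := :- (f :* g′ :- g :* f′)) (λ _ _ → refl) f g f′ g′ i j)
    (trans (-‿cong (e i j)) -0#≈0#)
    where open PSolver

-- The hypotheses of the theorem in subtraction-free form: d = 2e + 1, and f_m, g_m have p, q terms.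
record Shape (m₁ m₂ m₃ e p q : ℕ) : Set where
  constructor shape
  field
    {r₁ r₂} : ℕ
    m₁≡ : m₁ ≡ suc (2 ℕ.* r₁)
    m₂≡ : m₂ ≡ suc (2 ℕ.* r₂)
    r₁+p : r₁ ℕ.+ p ≡ suc e
    r₂+q : r₂ ℕ.+ q ≡ suc e
    p+q : p ℕ.+ q ≡ suc m₃

-- Written as a multiple of 2 on the right, the form from which the halving in `dOf` can be
-- computed.
Shape-total : ∀ {m₁ m₂ m₃ e p q} → Shape m₁ m₂ m₃ e p q → m₁ ℕ.+ m₂ ℕ.+ m₃ ℕ.+ m₃ ≡ (2 ℕ.* suc e) ℕ.* 2
Shape-total {m₁} {m₂} {m₃} {e} {p} {q} (shape {r₁} {r₂} ≡.refl ≡.refl r₁+p r₂+q p+q) = begin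
  suc (2 ℕ.* r₁) ℕ.+ suc (2 ℕ.* r₂) ℕ.+ m₃ ℕ.+ m₃    ≡⟨ left r₁ r₂ m₃ ⟩
  2 ℕ.* (r₁ ℕ.+ r₂) ℕ.+ 2 ℕ.* suc m₃                  ≡⟨ ≡.cong (λ z → 2 ℕ.* (r₁ ℕ.+ r₂) ℕ.+ 2 ℕ.* z) p+q ⟨
  2 ℕ.* (r₁ ℕ.+ r₂) ℕ.+ 2 ℕ.* (p ℕ.+ q)               ≡⟨ right r₁ r₂ p q ⟩
  2 ℕ.* ((r₁ ℕ.+ p) ℕ.+ (r₂ ℕ.+ q))                   ≡⟨ ≡.cong₂ (λ x y → 2 ℕ.* (x ℕ.+ y)) r₁+p r₂+q ⟩
  2 ℕ.* (suc e ℕ.+ suc e)                             ≡⟨ final e ⟩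
  (2 ℕ.* suc e) ℕ.* 2                                 ∎
  where
  open ≡.≡-Reasoning
  left : ∀ r₁ r₂ m₃ → suc (2 ℕ.* r₁) ℕ.+ suc (2 ℕ.* r₂) ℕ.+ m₃ ℕ.+ m₃ ≡ 2 ℕ.* (r₁ ℕ.+ r₂) ℕ.+ 2 ℕ.* suc m₃
  left = ℕ-solve-∀
  right : ∀ r₁ r₂ p q → 2 ℕ.* (r₁ ℕ.+ r₂) ℕ.+ 2 ℕ.* (p ℕ.+ q) ≡ 2 ℕ.* ((r₁ ℕ.+ p) ℕ.+ (r₂ ℕ.+ q))
  right = ℕ-solve-∀
  final : ∀ e → 2 ℕ.* (suc e ℕ.+ suc e) ≡ (2 ℕ.* suc e) ℕ.* 2
  final = ℕ-solve-∀

-- Identification of θ_m with the families, membership in D(m), and bases.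

module Explicit {c ℓ} (K : CharZeroField c ℓ) where
  open PolynomialRing K
  open LinearForms K
  open Scalars K
  open Families K
  open Contact K
  open SaitoCriterion K
  open Leading K

  dOf≡ : ∀ {m₁ m₂ m₃ e p q} → Shape m₁ m₂ m₃ e p q → dOf m₁ m₂ m₃ ≡ suc (2 ℕ.* e)
  dOf≡ {e = e} S = ≡.cong (_∸ 1) (≡.trans (≡.cong (_/ 2) (Shape-total S)) (≡.trans (m*n/n≡m (2 ℕ.* suc e) 2) (2*suc e)))

  2*-half : ∀ n → 2 ℕ.* n / 2 ≡ n
  2*-half n = ≡.trans (≡.cong (_/ 2) (ℕₚ.*-comm 2 n)) (m*n/n≡m n 2)

  2*-difference : ∀ {r p e} → r ℕ.+ suc p ≡ suc e → 2 ℕ.* e ∸ 2 ℕ.* r ≡ 2 ℕ.* p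
  2*-difference {r} {p} {e} r+p = ≡.trans (≡.sym (ℕₚ.*-distribˡ-∸ 2 e r)) (≡.cong (2 ℕ.*_)
    (≡.trans (≡.cong (_∸ r) (ℕₚ.suc-injective (≡.trans (≡.sym r+p) (ℕₚ.+-suc r p)))) (ℕₚ.m+n∸m≡n r p)))

  -- For p = 0 one has m₁ = d + 2 and the guard in `nTerms` returns 0, where the truncated
  -- difference d ∸ m₁ alone would count one term. Otherwise (d - m₁)/2 = p - 1.
  nTerms≡ : ∀ {r p e} → r ℕ.+ p ≡ suc e → nTerms (suc (2 ℕ.* e)) (suc (2 ℕ.* r)) ≡ p
  nTerms≡ {r} {zero} {e} r+p with suc (2 ℕ.* r) ℕ.≤ᵇ suc (2 ℕ.* e) in eq
  ... | false = ≡.refl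
  ... | true  = contradiction (ℕₚ.*-cancelˡ-≤ 2 (ℕₚ.≤-pred (ℕₚ.≤ᵇ⇒≤ _ _ (≡.subst Bool.T (≡.sym eq) tt))))
    (ℕₚ.<⇒≱ (ℕₚ.≤-reflexive (≡.trans (≡.sym r+p) (ℕₚ.+-identityʳ r))))
  nTerms≡ {r} {suc p} {e} r+p with suc (2 ℕ.* r) ℕ.≤ᵇ suc (2 ℕ.* e) in eq
  ... | true  = ≡.cong suc (≡.trans (≡.cong (_/ 2) (2*-difference {r} r+p)) (2*-half p))
  ... | false = contradiction (ℕₚ.≤⇒≤ᵇ (s≤s (ℕₚ.*-monoʳ-≤ 2 r≤e))) (≡.subst (λ b → ¬ Bool.T b) (≡.sym eq) (λ ()))
    where
    r≤e : r ≤ e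
    r≤e = ≡.subst (r ≤_) (ℕₚ.suc-injective (≡.trans (≡.sym (ℕₚ.+-suc r p)) r+p)) (ℕₚ.m≤m+n r p)

  frac≈coef : ∀ A s e n k → n ≤ e → k ≤ n →
    frac (sgn s ℤ.* ⟨ A ⟩ (n ∸ k)) (((2 ℕ.* n ∸ 2 ℕ.* k) !!) ℕ.* ((suc (2 ℕ.* e) ∸ 2 ℕ.* k) !!) ℕ.* ((2 ℕ.* k) !!)) ≈
    (sg s * B (ιℤ A) (n ∸ k)) * (w (n ∸ k) * (v (e ∸ k) * w k))
  frac≈coef A s e n k n≤e k≤n = *-cong
    (trans (ιℤ-* (sgn s) (⟨ A ⟩ (n ∸ k))) (*-cong (sgn≈sg s) (⟨⟩≈B A (n ∸ k))))
    (begin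
      inv (((2 ℕ.* n ∸ 2 ℕ.* k) !!) ℕ.* ((suc (2 ℕ.* e) ∸ 2 ℕ.* k) !!) ℕ.* z)  ≡⟨ ≡.cong₂ (λ i j → inv ((i !!) ℕ.* (j !!) ℕ.* z)) (≡.sym (ℕₚ.*-distribˡ-∸ 2 n k))
                                                                                 (≡.trans (ℕₚ.+-∸-assoc 1 (ℕₚ.*-monoʳ-≤ 2 (ℕₚ.≤-trans k≤n n≤e))) (≡.cong suc (≡.sym (ℕₚ.*-distribˡ-∸ 2 e k)))) ⟩
      inv (x ℕ.* y ℕ.* z)                                                        ≈⟨ inv-* (x ℕ.* y) z {{ℕₚ.m*n≢0 x y {{x≢0}} {{y≢0}}}} {{z≢0}} ⟩
      inv (x ℕ.* y) * inv z                                                      ≈⟨ *-congʳ (inv-* x y {{x≢0}} {{y≢0}}) ⟩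
      (inv x * inv y) * inv z                                                    ≈⟨ *-assoc _ _ _ ⟩
      inv x * (inv y * inv z)                                                    ∎)
    where
    open K-Reasoning
    x = (2 ℕ.* (n ∸ k)) !!
    y = suc (2 ℕ.* (e ∸ k)) !!
    z = (2 ℕ.* k) !!
    x≢0 = !!-nonZero (2 ℕ.* (n ∸ k))
    y≢0 = !!-nonZero (suc (2 ℕ.* (e ∸ k)))
    z≢0 = !!-nonZero (2 ℕ.* k)

  private
    fterm : ℤ → ℕ → ℕ → ℕ → ℕ → Pol
    fterm A d n t i = mono (frac (sgn i ℤ.* ⟨ A ⟩ (n ∸ i)) (((t ∸ 2 ℕ.* i) !!) ℕ.* ((d ∸ 2 ℕ.* i) !!) ℕ.* ((2 ℕ.* i) !!))) (d ∸ 2 ℕ.* i) (2 ℕ.* i)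

    gterm : ℤ → ℕ → ℕ → ℕ → ℕ → ℕ → Pol
    gterm A m₃ d n t i = mono (frac (sgn (i ℕ.+ m₃) ℤ.* ⟨ A ⟩ (n ∸ i)) (((t ∸ 2 ℕ.* i) !!) ℕ.* ((d ∸ 2 ℕ.* i) !!) ℕ.* ((2 ℕ.* i) !!))) (2 ℕ.* i) (d ∸ 2 ℕ.* i)

    odd∸even : ∀ {e k} → k ≤ e → suc (2 ℕ.* e) ∸ 2 ℕ.* k ≡ suc (2 ℕ.* (e ∸ k))
    odd∸even {e} {k} k≤e = ≡.trans (ℕₚ.+-∸-assoc 1 (ℕₚ.*-monoʳ-≤ 2 k≤e)) (≡.cong suc (≡.sym (ℕₚ.*-distribˡ-∸ 2 e k)))

    -- The sum is empty for p = 0, so the truncated value p ∸ 1 is harmless there; for p > 0 it is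
    -- (d - m₁)/2.
    sum-shape : ∀ (φ : ℕ → ℕ → ℕ → Pol) {r p e} → r ℕ.+ p ≡ suc e → ∀ i j →
      sumₚ (nTerms (suc (2 ℕ.* e)) (suc (2 ℕ.* r))) (φ ((suc (2 ℕ.* e) ∸ suc (2 ℕ.* r)) / 2) (suc (2 ℕ.* e) ∸ suc (2 ℕ.* r))) i j ≡
      sumₚ p (φ (p ∸ 1) (2 ℕ.* (p ∸ 1))) i j
    sum-shape φ {r} {zero}  {e} r+p i j = ≡.cong (λ N → sumₚ N (φ ((2 ℕ.* e ∸ 2 ℕ.* r) / 2) (2 ℕ.* e ∸ 2 ℕ.* r)) i j) (nTerms≡ {r} r+p)
    sum-shape φ {r} {suc p} {e} r+p i j = ≡.cong₂ (λ N (n , t) → sumₚ N (φ n t) i j) (nTerms≡ {r} r+p)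
      (≡.cong₂ _,_ (≡.trans (≡.cong (_/ 2) (2*-difference {r} r+p)) (2*-half p)) (2*-difference {r} r+p))

    bounds : ∀ {r p e k} → r ℕ.+ p ≡ suc e → k < p → (p ∸ 1 ≤ e) × (k ≤ p ∸ 1) × (p ∸ 1 ∸ k ≡ p ∸ suc k)
    bounds {r} {suc p} {e} r+p k<p = ≡.subst (p ≤_) (ℕₚ.suc-injective (≡.trans (≡.sym (ℕₚ.+-suc r p)) r+p)) (ℕₚ.m≤n+m p r) , ℕₚ.≤-pred k<p , ≡.refl

  module _ {m₁ m₂ m₃ e p q : ℕ} (S : Shape m₁ m₂ m₃ e p q) where
    open Shape S
    private
      A : ℤ
      A = aOf m₁ m₂ (suc (2 ℕ.* e))

    a : Carrier
    a = ιℤ A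

    fₘ≈F : fₘ m₁ m₂ m₃ ≈ₚ F a e p
    fₘ≈F i j = trans (reflexive (≡.trans
        (≡.cong₂ (λ d m → sumₚ (nTerms d m) (fterm (aOf m₁ m₂ d) d ((d ∸ m) / 2) (d ∸ m)) i j) (dOf≡ S) m₁≡)
        (sum-shape (fterm A (suc (2 ℕ.* e))) {r₁} {p} {e} r₁+p i j)))
      (sumₚ-cong p terms i j)
      where
      terms : ∀ k → k < p → fterm A (suc (2 ℕ.* e)) (p ∸ 1) (2 ℕ.* (p ∸ 1)) k ≈ₚ mono (coef a e (p ∸ suc k) k) (suc (2 ℕ.* (e ∸ k))) (2 ℕ.* k)
      terms k k<p i j with bounds {r₁} {p} {e} {k} r₁+p k<p
      ... | n≤e , k≤n , n≡ = trans (mono-cong _ _ (trans (frac≈coef A k e (p ∸ 1) k n≤e k≤n) (reflexive (≡.cong (λ n → coef a e n k) n≡))) i j)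
        (reflexive (≡.cong (λ z → mono (coef a e (p ∸ suc k) k) z (2 ℕ.* k) i j) (odd∸even (ℕₚ.≤-trans k≤n n≤e))))

    gₘ≈G : gₘ m₁ m₂ m₃ ≈ₚ (C (sg m₃) *ₚ G a e q)
    gₘ≈G i j = trans (reflexive (≡.trans
        (≡.cong₂ (λ d m → sumₚ (nTerms d m) (gterm (aOf m₁ m₂ d) m₃ d ((d ∸ m) / 2) (d ∸ m)) i j) (dOf≡ S) m₂≡)
        (sum-shape (gterm A m₃ (suc (2 ℕ.* e))) {r₂} {q} {e} r₂+q i j)))
      (trans (sumₚ-cong q terms i j) (sym (sumₚ-* q (C (sg m₃)) (λ k → mono (coef a e (q ∸ suc k) k) (2 ℕ.* k) (suc (2 ℕ.* (e ∸ k)))) i j)))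
      where
      open KSolver
      sign : ∀ n k → (sg (k ℕ.+ m₃) * B a n) * (w n * (v (e ∸ k) * w k)) ≈ sg m₃ * coef a e n k
      sign n k = trans (*-congʳ (*-congʳ (sg-+ k m₃))) (solve 4 (λ x y b z → ((x :* y) :* b) :* z := y :* ((x :* b) :* z)) refl (sg k) (sg m₃) (B a n) (w n * (v (e ∸ k) * w k)))
      terms : ∀ k → k < q → gterm A m₃ (suc (2 ℕ.* e)) (q ∸ 1) (2 ℕ.* (q ∸ 1)) k ≈ₚ (C (sg m₃) *ₚ mono (coef a e (q ∸ suc k) k) (2 ℕ.* k) (suc (2 ℕ.* (e ∸ k))))
      terms k k<q i j with bounds {r₂} {q} {e} {k} r₂+q k<q
      ... | n≤e , k≤n , n≡ = trans (mono-cong _ _ (trans (frac≈coef A (k ℕ.+ m₃) e (q ∸ 1) k n≤e k≤n)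
          (trans (sign (q ∸ 1 ∸ k) k) (reflexive (≡.cong (λ n → sg m₃ * coef a e n k) n≡)))) i j)
        (trans (reflexive (≡.cong (λ z → mono (sg m₃ * coef a e (q ∸ suc k) k) (2 ℕ.* k) z i j) (odd∸even (ℕₚ.≤-trans k≤n n≤e)))) (mono-* _ _ _ _ i j))

    a-equation : a + ι (2 ℕ.* (p ℕ.+ q)) ≈ ι (2 ℕ.* e ℕ.+ 5)
    a-equation = begin
      ιℤ A + ι s                                     ≈⟨ +-congʳ (trans (ιℤ-+ (+ (m₁ ℕ.+ m₂)) (ℤ.- + d)) (+-congˡ (ιℤ-neg (+ d)))) ⟩
      (ι (m₁ ℕ.+ m₂) - ι d) + ι s                    ≈⟨ solve 3 (λ m d s → (m :- d) :+ s := (m :+ s) :- d) refl (ι (m₁ ℕ.+ m₂)) (ι d) (ι s) ⟩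
      (ι (m₁ ℕ.+ m₂) + ι s) - ι d                    ≈⟨ +-congʳ (ι-+ (m₁ ℕ.+ m₂) s) ⟨
      ι (m₁ ℕ.+ m₂ ℕ.+ s) - ι d                      ≈⟨ +-congʳ (reflexive (≡.cong ι total)) ⟩
      ι (2 ℕ.* e ℕ.+ 5 ℕ.+ d) - ι d                  ≈⟨ +-congʳ (ι-+ (2 ℕ.* e ℕ.+ 5) d) ⟩
      (ι (2 ℕ.* e ℕ.+ 5) + ι d) - ι d                ≈⟨ solve 2 (λ x d → (x :+ d) :- d := x) refl _ (ι d) ⟩
      ι (2 ℕ.* e ℕ.+ 5)                              ∎
      where
      open K-Reasoning
      open KSolver
      d = suc (2 ℕ.* e)
      s = 2 ℕ.* (p ℕ.+ q)
      regroup : ∀ r₁ r₂ p q → suc (2 ℕ.* r₁) ℕ.+ suc (2 ℕ.* r₂) ℕ.+ 2 ℕ.* (p ℕ.+ q) ≡ 2 ℕ.* (r₁ ℕ.+ p) ℕ.+ 2 ℕ.* (r₂ ℕ.+ q) ℕ.+ 2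
      regroup = ℕ-solve-∀
      final : ∀ e → 2 ℕ.* suc e ℕ.+ 2 ℕ.* suc e ℕ.+ 2 ≡ 2 ℕ.* e ℕ.+ 5 ℕ.+ suc (2 ℕ.* e)
      final = ℕ-solve-∀
      total : m₁ ℕ.+ m₂ ℕ.+ s ≡ 2 ℕ.* e ℕ.+ 5 ℕ.+ d
      total = ≡.trans (≡.cong₂ (λ x y → x ℕ.+ y ℕ.+ s) m₁≡ m₂≡) (≡.trans (regroup r₁ r₂ p q)
        (≡.trans (≡.cong₂ (λ x y → 2 ℕ.* x ℕ.+ 2 ℕ.* y ℕ.+ 2) r₁+p r₂+q) (final e)))

    -- By `a-equation` a is the image of an odd integer. Moving 2(p+q) across turns a + 2j = 0 into
    -- an equality between an even and an odd natural number.
    a-odd : ∀ j → ¬ (a + ι (2 ℕ.* j) ≈ 0#)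
    a-odd j a+2j≈0 = ℕₚ.even≢odd (p ℕ.+ q) (e ℕ.+ 2 ℕ.+ j) (≡.trans (ι-injective (2 ℕ.* (p ℕ.+ q)) (2 ℕ.* e ℕ.+ 5 ℕ.+ 2 ℕ.* j) (begin
      ι (2 ℕ.* (p ℕ.+ q))                                  ≈⟨ +-identityʳ _ ⟨
      ι (2 ℕ.* (p ℕ.+ q)) + 0#                             ≈⟨ +-congˡ a+2j≈0 ⟨
      ι (2 ℕ.* (p ℕ.+ q)) + (a + ι (2 ℕ.* j))              ≈⟨ solve 3 (λ x a y → x :+ (a :+ y) := (a :+ x) :+ y) refl (ι (2 ℕ.* (p ℕ.+ q))) a (ι (2 ℕ.* j)) ⟩
      (a + ι (2 ℕ.* (p ℕ.+ q))) + ι (2 ℕ.* j)              ≈⟨ +-congʳ a-equation ⟩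
      ι (2 ℕ.* e ℕ.+ 5) + ι (2 ℕ.* j)                      ≈⟨ ι-+ (2 ℕ.* e ℕ.+ 5) (2 ℕ.* j) ⟨
      ι (2 ℕ.* e ℕ.+ 5 ℕ.+ 2 ℕ.* j)                        ∎)) (parity e j))
      where
      open K-Reasoning
      open KSolver
      parity : ∀ e j → 2 ℕ.* e ℕ.+ 5 ℕ.+ 2 ℕ.* j ≡ suc (2 ℕ.* (e ℕ.+ 2 ℕ.+ j))
      parity = ℕ-solve-∀

    private
      p≤1+e : p ≤ suc e
      p≤1+e = ≡.subst (p ≤_) r₁+p (ℕₚ.m≤n+m p r₁)

      q≤1+e : q ≤ suc e
      q≤1+e = ≡.subst (q ≤_) r₂+q (ℕₚ.m≤n+m q r₂)

      gₘ-at : ∀ i j → gₘ m₁ m₂ m₃ i j ≈ sg m₃ * G a e q i j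
      gₘ-at i j = trans (gₘ≈G i j) (C-* (sg m₃) (G a e q) i j)

    θₘ-Homog : HomogDer (suc (2 ℕ.* e)) (θₘ m₁ m₂ m₃)
    θₘ-Homog = (λ i j ne → trans (fₘ≈F i j) (F-Homog a e p p≤1+e i j ne)) ,
      (λ i j ne → trans (-‿cong (trans (gₘ-at i j) (trans (*-congˡ (G-Homog a e q q≤1+e i j ne)) (zeroʳ _)))) -0#≈0#)

    θₘ-IsDer : IsDer (θₘ m₁ m₂ m₃)
    θₘ-IsDer = isPoly (proj₁ θₘ-Homog) , isPoly (proj₂ θₘ-Homog)
      where
      isPoly : ∀ {f} → Homog (suc (2 ℕ.* e)) f → IsPoly f
      isPoly h = suc (suc (2 ℕ.* e)) , λ i j le → h i j (λ eq → ℕₚ.<⇒≢ le (≡.sym eq))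

    fₘ-order : ∀ i j → i < m₁ → fₘ m₁ m₂ m₃ i j ≈ 0#
    fₘ-order i j i<m₁ = trans (fₘ≈F i j) (F-order a {r₁} {e} {p} r₁+p i j (≡.subst (i <_) m₁≡ i<m₁))

    gₘ-order : ∀ i j → j < m₂ → gₘ m₁ m₂ m₃ i j ≈ 0#
    gₘ-order i j j<m₂ = trans (gₘ-at i j) (trans (*-congˡ (G-order a {r₂} {e} {q} r₂+q i j (≡.subst (j <_) m₂≡ j<m₂))) (zeroʳ _))

    private
      contact : ∀ s → s * s ≈ 1# → (Lin s ^ m₃) ∣ (fₘ m₁ m₂ m₃ +ₚ (C s *ₚ (-ₚ gₘ m₁ m₂ m₃)))
      contact s s²≈1 = ∣-resp {Lin s ^ (p ℕ.+ q ∸ 1)} {Lin s ^ m₃} {H (s * sg (p ℕ.+ q)) a e p q} {fₘ m₁ m₂ m₃ +ₚ (C s *ₚ (-ₚ gₘ m₁ m₂ m₃))}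
        (λ i j → reflexive (≡.cong (λ z → (Lin s ^ z) i j) (≡.cong (_∸ 1) p+q)))
        (λ i j → trans (H-at (s * sg (p ℕ.+ q)) a e p q i j) (+-cong (sym (fₘ≈F i j)) (begin
          (s * sg (p ℕ.+ q)) * G a e q i j        ≡⟨ ≡.cong (λ z → (s * sg z) * G a e q i j) p+q ⟩
          (s * - sg m₃) * G a e q i j             ≈⟨ solve 3 (λ s x g → (s :* (:- x)) :* g := s :* (:- (x :* g))) refl s (sg m₃) (G a e q i j) ⟩
          s * - (sg m₃ * G a e q i j)             ≈⟨ *-congˡ (-‿cong (gₘ-at i j)) ⟨
          s * - gₘ m₁ m₂ m₃ i j                   ≈⟨ C-* s (-ₚ gₘ m₁ m₂ m₃) i j ⟨
          (C s *ₚ (-ₚ gₘ m₁ m₂ m₃)) i j           ∎)))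
        (H-∣ s s²≈1 p q e a p≤1+e q≤1+e (≡.subst (0 <_) (≡.sym p+q) (s≤s z≤n)) a-equation)
        where
        open K-Reasoning
        open KSolver

    θₘ∈D : θₘ m₁ m₂ m₃ ∈D mult m₁ m₂ m₃
    θₘ∈D = ∣⇒∈D (θₘ m₁ m₂ m₃) (mult m₁ m₂ m₃) θₘ-IsDer λ where
      0F → X^-∣ m₁ {fₘ m₁ m₂ m₃} fₘ-order
      1F → Y^-∣ m₂ { -ₚ gₘ m₁ m₂ m₃} (λ i j j<m₂ → trans (-‿cong (gₘ-order i j j<m₂)) -0#≈0#)
      2F → contact (- 1#) -1·-1
      3F → contact 1# 1·1

  fₘ-lead : ∀ {m₁ m₂ m₃ e p q} → Shape m₁ m₂ m₃ e (suc p) q → ¬ (fₘ m₁ m₂ m₃ m₁ (2 ℕ.* p) ≈ 0#) × (m₁ ℕ.+ 2 ℕ.* p ≡ suc (2 ℕ.* e))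
  fₘ-lead {m₁} {m₂} {m₃} {e} {p} {q} S@(shape {r₁} m₁≡ m₂≡ r₁+p r₂+q p+q) =
    (λ eq → F-lead {a S} (a-odd S) r₁ p (trans (reflexive (≡.cong₂ (λ x y → F (a S) x (suc p) y (2 ℕ.* p)) (≡.sym e≡) (≡.sym m₁≡)))
      (trans (sym (fₘ≈F S m₁ (2 ℕ.* p))) eq))) ,
    ≡.trans (≡.cong (ℕ._+ 2 ℕ.* p) m₁≡) (≡.trans (≡.cong suc (≡.sym (ℕₚ.*-distribˡ-+ 2 r₁ p))) (≡.cong (λ z → suc (2 ℕ.* z)) (≡.sym e≡)))
    where
    e≡ : e ≡ r₁ ℕ.+ p
    e≡ = ℕₚ.suc-injective (≡.trans (≡.sym r₁+p) (ℕₚ.+-suc r₁ p))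

  gₘ-lead : ∀ {m₁ m₂ m₃ e p q} → Shape m₁ m₂ m₃ e p (suc q) → ¬ (- gₘ m₁ m₂ m₃ 0 (suc (2 ℕ.* e)) ≈ 0#)
  gₘ-lead {m₁} {m₂} {m₃} {e} {p} {q} S = -‿≉0 λ eq → *-≉0 (sg≉0 m₃) (G-lead {a S} (a-odd S) e q)
    (trans (sym (C-* (sg m₃) (G (a S) e (suc q)) 0 (suc (2 ℕ.* e)))) (trans (sym (gₘ≈G S 0 (suc (2 ℕ.* e)))) eq))

  ∈D-mono : ∀ θ {m m′} → (∀ i → m i ≤ m′ i) → θ ∈D m′ → θ ∈D m
  ∈D-mono θ {m} {m′} m≤m′ θ∈ = ∣⇒∈D θ m (proj₁ θ∈) λ i →
    ∣-trans {form i ^ m i} {form i ^ m′ i} {value θ i}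
      (≡.subst (λ z → (form i ^ m i) ∣ (form i ^ z)) (ℕₚ.m+[n∸m]≡n (m≤m′ i)) (^-∣-^ (form i) (m i) (m′ i ∸ m i)))
      (∈D⇒∣ θ m′ θ∈ i)

  mult-mono : ∀ {m₁ m₂ m₃ n₁ n₂ n₃} → m₁ ≤ n₁ → m₂ ≤ n₂ → m₃ ≤ n₃ → ∀ i → mult m₁ m₂ m₃ i ≤ mult n₁ n₂ n₃ i
  mult-mono le₁ le₂ le₃ 0F = le₁
  mult-mono le₁ le₂ le₃ 1F = le₂
  mult-mono le₁ le₂ le₃ 2F = le₃
  mult-mono le₁ le₂ le₃ 3F = le₃

  module _ {m₁ m₂ m₃ n₁ n₂ n₃ e p q p′ q′ : ℕ} (S : Shape m₁ m₂ m₃ e p q) (S′ : Shape n₁ n₂ n₃ (suc e) p′ q′)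
    (le₁ : m₁ ≤ n₁) (le₂ : m₂ ≤ n₂) (le₃ : m₃ ≤ n₃) where

    -- D(m) shrinks as m grows, so the derivation of a larger multiplicity of total |m| + 4 lies in
    -- D(m). Its degree is d + 2, and d + (d + 2) = |m| is what Saito's criterion asks for.
    basis : ¬ (det (θₘ m₁ m₂ m₃) (θₘ n₁ n₂ n₃) ≈ₚ 0ₚ) → IsBasis (mult m₁ m₂ m₃) (θₘ m₁ m₂ m₃) (θₘ n₁ n₂ n₃)
    basis = saito (mult m₁ m₂ m₃) {θₘ m₁ m₂ m₃} {θₘ n₁ n₂ n₃} (θₘ∈D S)
      (∈D-mono (θₘ n₁ n₂ n₃) {mult m₁ m₂ m₃} {mult n₁ n₂ n₃} (mult-mono le₁ le₂ le₃) (θₘ∈D S′))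
      (θₘ-Homog S) (θₘ-Homog S′)
      (≡.trans (total e) (≡.trans (≡.sym (Shape-total S)) (reassoc m₁ m₂ m₃)))
      where
      total : ∀ e → suc (2 ℕ.* e) ℕ.+ suc (2 ℕ.* suc e) ≡ (2 ℕ.* suc e) ℕ.* 2
      total = ℕ-solve-∀
      reassoc : ∀ x y z → x ℕ.+ y ℕ.+ z ℕ.+ z ≡ x ℕ.+ (y ℕ.+ (z ℕ.+ z))
      reassoc = ℕ-solve-∀

  -- Raising m₁ by 2 pushes the order in x of the second f beyond m₁, where the first f has its
  -- leading coefficient; the second g contributes its pure power of y.
  basis-p>0 : ∀ {m₁ m₂ m₃ n₂ n₃ e p q p′ q′} → Shape m₁ m₂ m₃ e (suc p) q → Shape (m₁ ℕ.+ 2) n₂ n₃ (suc e) p′ (suc q′) →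
    m₂ ≤ n₂ → m₃ ≤ n₃ → IsBasis (mult m₁ m₂ m₃) (θₘ m₁ m₂ m₃) (θₘ (m₁ ℕ.+ 2) n₂ n₃)
  basis-p>0 {m₁} {m₂} {m₃} {n₂} {n₃} {e} {p} S S′ le₂ le₃ = basis S S′ (ℕₚ.m≤m+n m₁ 2) le₂ le₃
    (det≉0 {j₁ = suc (2 ℕ.* suc e)} {f = fₘ m₁ m₂ m₃} {g = -ₚ gₘ m₁ m₂ m₃} {f′ = fₘ (m₁ ℕ.+ 2) n₂ n₃} {g′ = -ₚ gₘ (m₁ ℕ.+ 2) n₂ n₃}
      (proj₁ (θₘ-Homog S)) (fₘ-order S) (proj₂ (fₘ-lead S)) (proj₁ (fₘ-lead S))
      (λ i j i≤m₁ → fₘ-order S′ i j (ℕₚ.≤-trans i≤m₁ (ℕₚ.≤-trans (ℕₚ.n≤1+n (suc m₁)) (ℕₚ.≤-reflexive (ℕₚ.+-comm 2 m₁)))))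
      (gₘ-lead S′))

  -- Here f_m = 0, so the determinant is read with the two derivations exchanged. With m₁ kept and
  -- p′ = 1 the second f is a nonzero multiple of x^m₁, and the factor free of x comes from g_m.
  basis-p=0 : ∀ {m₁ m₂ m₃ n₂ n₃ e q q′} → Shape m₁ m₂ m₃ e 0 (suc q) → Shape m₁ n₂ n₃ (suc e) 1 q′ →
    m₂ ≤ n₂ → m₃ ≤ n₃ → IsBasis (mult m₁ m₂ m₃) (θₘ m₁ m₂ m₃) (θₘ m₁ n₂ n₃)
  basis-p=0 {m₁} {m₂} {m₃} {n₂} {n₃} {e} S S′ le₂ le₃ = basis S S′ ℕₚ.≤-refl le₂ le₃ λ det≈0 →
    det≉0 {j₁ = suc (2 ℕ.* e)} {f = fₘ m₁ n₂ n₃} {g = -ₚ gₘ m₁ n₂ n₃} {f′ = fₘ m₁ m₂ m₃} {g′ = -ₚ gₘ m₁ m₂ m₃}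
      (proj₁ (θₘ-Homog S′)) (fₘ-order S′) (proj₂ (fₘ-lead S′)) (proj₁ (fₘ-lead S′))
      (λ i j _ → fₘ≈F S i j) (gₘ-lead S) (det-antisym (θₘ m₁ m₂ m₃) (θₘ m₁ n₂ n₃) det≈0)

-- Arithmetic of multiplicities and numbers of terms.

-- With |m| = 4(e+1) and m₁ = 2r₁+1 the bound 2m₁ ≤ |m|+2 reads r₁ ≤ e+1, so that p = e+1-r₁ is a
-- genuine difference; q is obtained likewise from m₂. Comparing totals then gives p + q = m₃ + 1.
Shape-exists : ∀ {m₁ m₂ m₃} → let M = m₁ ℕ.+ m₂ ℕ.+ m₃ ℕ.+ m₃ in
  m₁ % 2 ≡ 1 → m₂ % 2 ≡ 1 → M % 4 ≡ 0 → 2 ℕ.* m₁ ≤ M ℕ.+ 2 → 2 ℕ.* m₂ ≤ M ℕ.+ 2 →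
  ∃ λ e → ∃ λ p → ∃ λ q → Shape m₁ m₂ m₃ e p q
Shape-exists {m₁} {m₂} {m₃} odd₁ odd₂ div₄ le₁ le₂ = build (M / 4) (≡.trans (m≡m%n+[m/n]*n M 4) (≡.cong (ℕ._+ M / 4 ℕ.* 4) div₄))
  where
  M = m₁ ℕ.+ m₂ ℕ.+ m₃ ℕ.+ m₃
  odd-form : ∀ m → m % 2 ≡ 1 → m ≡ suc (2 ℕ.* (m / 2))
  odd-form m odd = ≡.trans (m≡m%n+[m/n]*n m 2) (≡.cong₂ ℕ._+_ odd (ℕₚ.*-comm (m / 2) 2))
  r₁ = m₁ / 2
  r₂ = m₂ / 2
  double : ∀ r → 2 ℕ.* suc (2 ℕ.* r) ≡ 4 ℕ.* r ℕ.+ 2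
  double = ℕ-solve-∀
  half-bound : ∀ m t → m ≡ suc (2 ℕ.* (m / 2)) → M ≡ t ℕ.* 4 → 2 ℕ.* m ≤ M ℕ.+ 2 → m / 2 ≤ t
  half-bound m t m≡ M≡ le = ℕₚ.*-cancelˡ-≤ 4 (ℕₚ.+-cancelʳ-≤ 2 _ _ (≡.subst₂ _≤_
    (≡.trans (≡.cong (2 ℕ.*_) m≡) (double (m / 2))) (≡.cong (ℕ._+ 2) (≡.trans M≡ (ℕₚ.*-comm t 4))) le))
  total : ∀ r₁ r₂ m₃ → suc (2 ℕ.* r₁) ℕ.+ suc (2 ℕ.* r₂) ℕ.+ m₃ ℕ.+ m₃ ≡ 2 ℕ.* (r₁ ℕ.+ r₂ ℕ.+ suc m₃)
  total = ℕ-solve-∀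
  fourfold : ∀ t → t ℕ.* 4 ≡ 2 ℕ.* (t ℕ.+ t)
  fourfold = ℕ-solve-∀
  interchange : ∀ a b c d → a ℕ.+ b ℕ.+ (c ℕ.+ d) ≡ (a ℕ.+ c) ℕ.+ (b ℕ.+ d)
  interchange = ℕ-solve-∀
  build : ∀ t → M ≡ t ℕ.* 4 → ∃ λ e → ∃ λ p → ∃ λ q → Shape m₁ m₂ m₃ e p q
  build t M≡ with odd-form m₁ odd₁ | odd-form m₂ odd₂
  -- The total |m| cannot be 0, since m₁ is odd.
  build zero    M≡ | m₁≡ | m₂≡ = contradiction (≡.trans (≡.sym (≡.cong (λ m → m ℕ.+ m₂ ℕ.+ m₃ ℕ.+ m₃) m₁≡)) M≡) λ ()
  build (suc e) M≡ | m₁≡ | m₂≡ = e , p , q , shape m₁≡ m₂≡ r₁+p r₂+q (ℕₚ.+-cancelˡ-≡ (r₁ ℕ.+ r₂) _ _ (begin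
      r₁ ℕ.+ r₂ ℕ.+ (p ℕ.+ q)           ≡⟨ interchange r₁ r₂ p q ⟩
      (r₁ ℕ.+ p) ℕ.+ (r₂ ℕ.+ q)         ≡⟨ ≡.cong₂ ℕ._+_ r₁+p r₂+q ⟩
      suc e ℕ.+ suc e                   ≡⟨ ℕₚ.*-cancelˡ-≡ _ _ 2 (≡.trans (≡.sym (total r₁ r₂ m₃))
                                             (≡.trans (≡.sym (≡.cong₂ (λ x y → x ℕ.+ y ℕ.+ m₃ ℕ.+ m₃) m₁≡ m₂≡)) (≡.trans M≡ (fourfold (suc e))))) ⟨
      r₁ ℕ.+ r₂ ℕ.+ suc m₃              ∎))
    where
    open ≡.≡-Reasoning
    p = suc e ∸ r₁
    q = suc e ∸ r₂
    r₁+p : r₁ ℕ.+ p ≡ suc e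
    r₁+p = ℕₚ.m+[n∸m]≡n (half-bound m₁ (suc e) m₁≡ M≡ le₁)
    r₂+q : r₂ ℕ.+ q ≡ suc e
    r₂+q = ℕₚ.m+[n∸m]≡n (half-bound m₂ (suc e) m₂≡ M≡ le₂)

Shape-swap : ∀ {m₁ m₂ m₃ e p q} → Shape m₁ m₂ m₃ e p q → Shape m₂ m₁ m₃ e q p
Shape-swap {p = p} {q} (shape m₁≡ m₂≡ r₁+p r₂+q p+q) = shape m₂≡ m₁≡ r₂+q r₁+p (≡.trans (ℕₚ.+-comm q p) p+q)

private
  odd+2 : ∀ {m} r → m ≡ suc (2 ℕ.* r) → m ℕ.+ 2 ≡ suc (2 ℕ.* suc r)
  odd+2 {m} r m≡ = ≡.trans (≡.cong (ℕ._+ 2) m≡) (arith r)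
    where
    arith : ∀ r → suc (2 ℕ.* r) ℕ.+ 2 ≡ suc (2 ℕ.* suc r)
    arith = ℕ-solve-∀

-- The subscripts are the increments of m₁, m₂, m₃. Here p and q are unchanged.
Shape-add₂₂₀ : ∀ {m₁ m₂ m₃ e p q} → Shape m₁ m₂ m₃ e p q → Shape (m₁ ℕ.+ 2) (m₂ ℕ.+ 2) m₃ (suc e) p q
Shape-add₂₂₀ (shape {r₁} {r₂} m₁≡ m₂≡ r₁+p r₂+q p+q) = shape (odd+2 r₁ m₁≡) (odd+2 r₂ m₂≡) (≡.cong suc r₁+p) (≡.cong suc r₂+q) p+q

Shape-add₂₀₁ : ∀ {m₁ m₂ m₃ e p q} → Shape m₁ m₂ m₃ e p q → Shape (m₁ ℕ.+ 2) m₂ (suc m₃) (suc e) p (suc q)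
Shape-add₂₀₁ {p = p} {q} (shape {r₁} {r₂} m₁≡ m₂≡ r₁+p r₂+q p+q) = shape (odd+2 r₁ m₁≡) m₂≡ (≡.cong suc r₁+p)
  (≡.trans (ℕₚ.+-suc r₂ q) (≡.cong suc r₂+q)) (≡.trans (ℕₚ.+-suc p q) (≡.cong suc p+q))

-- If p = 0 then m₁ = d + 2 = |m|/2 + 1, so 2m₁ = |m| + 2.
unbalanced : ∀ {m₁ m₂ m₃ e q} → Shape m₁ m₂ m₃ e 0 q → ¬ (2 ℕ.* m₁ ℕ.+ 1 ≤ m₁ ℕ.+ m₂ ℕ.+ m₃ ℕ.+ m₃)
unbalanced {e = e} S le = ℕₚ.m+1+n≰m ((2 ℕ.* suc e) ℕ.* 2) {2} (≡.subst₂ _≤_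
    (≡.trans (≡.cong (λ m → 2 ℕ.* m ℕ.+ 1) (≡.trans m₁≡ (≡.cong (λ r → suc (2 ℕ.* r)) (≡.trans (≡.sym (ℕₚ.+-identityʳ r₁)) r₁+p)))) (arith e))
    (Shape-total S) le)
  where
  open Shape S
  arith : ∀ e → 2 ℕ.* suc (2 ℕ.* suc e) ℕ.+ 1 ≡ (2 ℕ.* suc e) ℕ.* 2 ℕ.+ 3
  arith = ℕ-solve-∀

-- Exponents and generators, by cases on which of f_m, g_m vanish.

module Theorem {c ℓ} (K : CharZeroField c ℓ) where
  open PolynomialRing K
  open Explicit K

  exponents : ∀ {m₁ m₂ m₃ n₁ n₂ n₃ e p q p′ q′} → Shape m₁ m₂ m₃ e p q → Shape n₁ n₂ n₃ (suc e) p′ q′ →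
    IsBasis (mult m₁ m₂ m₃) (θₘ m₁ m₂ m₃) (θₘ n₁ n₂ n₃) → ExpIs (mult m₁ m₂ m₃) (dOf m₁ m₂ m₃) (dOf m₁ m₂ m₃ ℕ.+ 2)
  exponents {m₁} {m₂} {m₃} {n₁} {n₂} {n₃} {e} S S′ B = θₘ m₁ m₂ m₃ , θₘ n₁ n₂ n₃ , B ,
    ≡.subst (λ d → HomogDer d (θₘ m₁ m₂ m₃)) (≡.sym (dOf≡ S)) (θₘ-Homog S) ,
    ≡.subst (λ d → HomogDer d (θₘ n₁ n₂ n₃)) (≡.trans (≡.sym (odd+2 e ≡.refl)) (≡.cong (ℕ._+ 2) (≡.sym (dOf≡ S)))) (θₘ-Homog S′)

  -- Passing to m″ keeps p and q, so if f_m or g_m is an empty sum then so is its counterpart for m″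
  -- and the determinant of θ_m and θ_m″ vanishes. Balanced multiplicities have p, q > 0 and avoid
  -- this; in the other cases a multiplicity that adds a term to the empty sum gives the exponents.
  conclusion : ∀ {m₁ m₂ m₃ e} p q → Shape m₁ m₂ m₃ e p q → let m = mult m₁ m₂ m₃ in
    ExpIs m (dOf m₁ m₂ m₃) (dOf m₁ m₂ m₃ ℕ.+ 2) ×
    ((∀ i → 2 ℕ.* m i ℕ.+ 1 ≤ ∣m∣ m₁ m₂ m₃) → Generates m (θₘ m₁ m₂ m₃) (θₘ (m₁ ℕ.+ 2) (m₂ ℕ.+ 2) m₃))
  conclusion zero zero (shape _ _ _ _ ())
  conclusion {m₁} {m₂} {m₃} zero (suc q) S =
    exponents S S′ (basis-p=0 S S′ (ℕₚ.m≤m+n m₂ 2) (ℕₚ.n≤1+n m₃)) ,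
    λ balanced → contradiction (balanced 0F) (unbalanced S)
    where S′ = Shape-swap (Shape-add₂₀₁ (Shape-swap S))
  conclusion {m₁} {m₂} {m₃} (suc p) zero S =
    exponents S (Shape-add₂₀₁ S) (basis-p>0 S (Shape-add₂₀₁ S) ℕₚ.≤-refl (ℕₚ.n≤1+n m₃)) ,
    λ balanced → contradiction (balanced 1F) (λ le → unbalanced (Shape-swap S)
      (≡.subst (λ z → 2 ℕ.* m₂ ℕ.+ 1 ≤ z ℕ.+ m₃ ℕ.+ m₃) (ℕₚ.+-comm m₁ m₂) le))
  conclusion {m₁} {m₂} {m₃} (suc p) (suc q) S = exponents S (Shape-add₂₂₀ S) B , λ _ → proj₁ B
    where
    B : IsBasis (mult m₁ m₂ m₃) (θₘ m₁ m₂ m₃) (θₘ (m₁ ℕ.+ 2) (m₂ ℕ.+ 2) m₃)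
    B = basis-p>0 S (Shape-add₂₂₀ S) (ℕₚ.m≤m+n m₂ 2) ℕₚ.≤-refl

open import Data.Nat using (_+_; _*_)

theorem3p3 : ∀ {c ℓ} (K : CharZeroField c ℓ) (m₁ m₂ m₃ : ℕ) →
    let open Poly K
        m = mult m₁ m₂ m₃
        M = ∣m∣ m₁ m₂ m₃
        d = dOf m₁ m₂ m₃
    in m₁ % 2 ≡ 1 → m₂ % 2 ≡ 1 → M % 4 ≡ 0 →
       (∀ i → 2 * m i ≤ M + 2) →
       (θₘ m₁ m₂ m₃ ∈D m) × ExpIs m d (d + 2) ×
       ((∀ i → 2 * m i + 1 ≤ M) → Generates m (θₘ m₁ m₂ m₃) (θₘ (m₁ + 2) (m₂ + 2) m₃))
theorem3p3 K m₁ m₂ m₃ odd₁ odd₂ div₄ bound =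
  let e , p , q , S = Shape-exists {m₁} {m₂} {m₃} odd₁ odd₂ div₄ (bound 0F) (bound 1F)
  in Explicit.θₘ∈D K S , Theorem.conclusion K p q S
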